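{- Let $q$ be a fixed prime power and $k\ge 2$ a fixed integer. Let $\mathfrak t=(t_1,\dots,t_k)$ be a fixed $k$-tuple of nonnegative integers, and let $\mathfrak m=(m_1,\dots,m_k)$, $\mathfrak n=(n_1,\dots,n_k)$ be $k$-tuples of nonnegative integers such that $\mathfrak t\le\mathfrak m$, $\mathfrak t\le\mathfrak n$, and $\max\{m_i,n_i\}>2t_i+1$ for all $1\le i\le k$. Then $$P_k(\mathfrak m;\mathfrak n)=\sum_{\mathfrak 0\le\mathfrak d\le\mathfrak t}N_k(\mathfrak m-\mathfrak d)N_k(\mathfrak n-\mathfrak d)A_k(\mathfrak d)+O\Bigl(q^{\max_{1\le j\le k}\bigl(\frac{m_j-t_j}{m_j+1}\prod_{i=1}^k(m_i+1)+\frac{n_j-t_j}{n_j+1}\prod_{i=1}^k(n_i+1)\bigr)}\Bigr),$$ where the constant in the $O$-term is independent of $\mathfrak m$ and $\mathfrak n$ (it may depend on $q,k,\mathfrak t$).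
   Context: $\mathbb F_q$ is the finite field with $q$ elements. Two polynomials in $\mathbb F_q[x_1,\dots,x_k]$ are identified if they differ by a factor in $\mathbb F_q^\times$; the classes are called normalized polynomials. The vector degree of a nonzero $f$ is $\operatorname{Deg} f=(\deg_{x_1}f,\dots,\deg_{x_k}f)$. $k$-tuples of nonnegative integers are ordered componentwise, $\mathfrak 0$ is the zero tuple, and $\mathfrak a<\mathfrak b$ means $\mathfrak a\le\mathfrak b$ and $\mathfrak a\ne\mathfrak b$. $\mathcal N_k(\mathfrak m)$ is the set of normalized polynomials $f\in\mathbb F_q[x_1,\dots,x_k]$ with $\operatorname{Deg} f=\mathfrak m$, $N_k(\mathfrak m)=|\mathcal N_k(\mathfrak m)|$, and $I_k(\mathfrak m)$ is the number of irreducible elements of $\mathcal N_k(\mathfrak m)$. $P_k(\mathfrak m;\mathfrak n)=|\{(f,g)\in\mathcal N_k(\mathfrak m)\times\mathcal N_k(\mathfrak n):\gcd(f,g)=1\}|$. Finally $$A_k(\mathfrak d)=\sum_{h\in\mathcal N_k(\mathfrak d)}\mu(h)=\sum_{(a_{\mathfrak i})}(-1)^{\sum_{\mathfrak i}a_{\mathfrak i}}\prod_{\mathfrak 0<\mathfrak i\le\mathfrak d}\binom{I_k(\mathfrak i)}{a_{\mathfrak i}},$$ where the last sum is over families $(a_{\mathfrak i})_{\mathfrak 0<\mathfrak i\le\mathfrak d}$ of nonnegative integers with $\sum_{\mathfrak i}a_{\mathfrak i}\mathfrak i=\mathfrak d$, and $\mu(h)=(-1)^s$ if $h$ is a product of $s$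 distinct irreducible normalized polynomials, $\mu(h)=0$ if $h$ is divisible by the square of an irreducible. -}

module Defs where

open import Algebra.Bundles using (CommutativeRing; RawSemiring)
import Algebra.Definitions.RawMagma as MagmaDefinitions
import Algebra.Definitions.RawSemiring as SemiringDefinitions
open import Data.Empty using (⊥; ⊥-elim)
open import Data.Fin.Base using (Fin)
import Data.Fin.Properties as Fin
open import Data.Integer.Base as ℤ using (ℤ; 0ℤ; -1ℤ)
open import Data.List.Base as List
  using (List; []; _∷_; length; filter; deduplicate; cartesianProduct;
         cartesianProductWith; upTo; allFin)
open import Data.List.Extrema.Nat using (max)
open import Data.List.Membership.Propositional using (_∈_; find; lose)
open import Data.List.Membership.Propositional.Properties
  using (∈-cartesianProductWith⁺; ∈-cartesianProductWith⁻; ∈-upTo⁺; ∈-upTo⁻;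
         ∈-map⁺; ∈-allFin)
open import Data.List.Relation.Binary.Pointwise.Base as PW using ([]; _∷_)
open import Data.List.Relation.Unary.All as All using (All; []; _∷_)
open import Data.List.Relation.Unary.AllPairs as AllPairs using (AllPairs; []; _∷_)
open import Data.List.Relation.Unary.Any as Any using (Any; here; there)
open import Data.List.Relation.Unary.Unique.Propositional using (Unique)
import Data.List.Relation.Unary.Unique.Propositional.Properties as Unique
open import Data.Nat.Base as ℕ using (ℕ; zero; suc; _≤_; _<_; _∸_; z≤n; s≤s)
import Data.Nat.Properties as ℕ
open import Data.Product.Base using (∃; _×_; _,_; proj₁; proj₂; uncurry)
open import Data.Sum.Base using (_⊎_; inj₁; inj₂; [_,_]′)
open import Data.Vec.Base as Vec using (Vec; []; _∷_; lookup; zipWith; replicate)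
import Data.Vec.Properties as Vec
open import Data.Vec.Relation.Binary.Pointwise.Inductive as Pointwise
  using (Pointwise; []; _∷_)
open import Function.Base using (_∘_)
open import Function.Bundles using (Inverse)
open import Function.Properties.Inverse using (Inverse⇒Injection)
open import Level using (Level) renaming (suc to lsuc; _⊔_ to _⊔ˡ_)
open import Relation.Binary.Definitions using (Decidable; tri<; tri≈; tri>)
open import Relation.Binary.PropositionalEquality as ≡
  using (_≡_; _≢_; refl; cong; cong₂; subst)
open import Relation.Nullary.Decidable
  using (Dec; yes; no; ¬?; _×-dec_; _⊎-dec_; map′; decidable-stable; via-injection)
open import Relation.Nullary.Negation using (¬_; contradiction)

-- The cardinality q of such a ring is automatically a prime power.
record FiniteField (c ℓ : Level) (q : ℕ) : Set (lsuc (c ⊔ˡ ℓ)) where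
  field
    commutativeRing : CommutativeRing c ℓ
  open CommutativeRing commutativeRing public
  field
    1≉0     : 1# ≉ 0#
    inverse : ∀ x → x ≉ 0# → ∃ λ y → x * y ≈ 1#
    finite  : Inverse setoid (≡.setoid (Fin q))

Exponent : ℕ → Set
Exponent = Vec ℕ

module _ {k : ℕ} where

  infix  4 _≼_ _≼?_
  infixl 6 _⊞_ _⊟_

  _≼_ : Exponent k → Exponent k → Set
  _≼_ = Pointwise _≤_

  _≼?_ : Decidable _≼_
  _≼?_ = Pointwise.decidable ℕ._≤?_

  _⊞_ : Exponent k → Exponent k → Exponent k
  _⊞_ = zipWith ℕ._+_

  _⊟_ : Exponent k → Exponent k → Exponent k
  _⊟_ = zipWith _∸_

  𝟘 : Exponent k
  𝟘 = replicate k 0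

  _≟ᵉ_ : Decidable {A = Exponent k} _≡_
  _≟ᵉ_ = Vec.≡-dec ℕ._≟_

-- All exponents below m, each exactly once.
box : ∀ {k} → Exponent k → List (Exponent k)
box []      = [] ∷ []
box (d ∷ m) = cartesianProductWith _∷_ (upTo (suc d)) (box m)

∈-box⁺ : ∀ {k} {e m : Exponent k} → e ≼ m → e ∈ box m
∈-box⁺ []        = here refl
∈-box⁺ (le ∷ es) = ∈-cartesianProductWith⁺ _∷_ (∈-upTo⁺ (s≤s le)) (∈-box⁺ es)

∈-box⁻ : ∀ {k} {e : Exponent k} (m : Exponent k) → e ∈ box m → e ≼ m
∈-box⁻ {e = []} []      _ = []
∈-box⁻          (d ∷ m) p
  with _ , _ , i , j , refl ← ∈-cartesianProductWith⁻ _∷_ (upTo (suc d)) (box m) p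
  = ℕ.≤-pred (∈-upTo⁻ i) ∷ ∈-box⁻ m j

box-unique : ∀ {k} (m : Exponent k) → Unique (box m)
box-unique []      = [] ∷ []
box-unique (d ∷ m) =
  Unique.cartesianProductWith⁺ _∷_ Vec.∷-injective (Unique.upTo⁺ (suc d)) (box-unique m)

≼-trans : ∀ {k} {a b c : Exponent k} → a ≼ b → b ≼ c → a ≼ c
≼-trans = Pointwise.trans ℕ.≤-trans

≼-lookup⁻ : ∀ {k} {a b : Exponent k} → (∀ i → lookup a i ≤ lookup b i) → a ≼ b
≼-lookup⁻ {a = []}    {[]}    h = []
≼-lookup⁻ {a = _ ∷ _} {_ ∷ _} h = h Fin.zero ∷ ≼-lookup⁻ (h ∘ Fin.suc)

a≼a⊞b : ∀ {k} (a b : Exponent k) → a ≼ a ⊞ b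
a≼a⊞b []      []      = []
a≼a⊞b (x ∷ a) (y ∷ b) = ℕ.m≤m+n x y ∷ a≼a⊞b a b

b≼a⊞b : ∀ {k} (a b : Exponent k) → b ≼ a ⊞ b
b≼a⊞b []      []      = []
b≼a⊞b (x ∷ a) (y ∷ b) = ℕ.m≤n+m y x ∷ b≼a⊞b a b

⊞-mono-≼ : ∀ {k} {a b c d : Exponent k} → a ≼ b → c ≼ d → a ⊞ c ≼ b ⊞ d
⊞-mono-≼ []      []      = []
⊞-mono-≼ (p ∷ r) (s ∷ t) = ℕ.+-mono-≤ p s ∷ ⊞-mono-≼ r t

a⊞[e⊟a]≡e : ∀ {k} {a e : Exponent k} → a ≼ e → a ⊞ (e ⊟ a) ≡ e
a⊞[e⊟a]≡e []      = refl
a⊞[e⊟a]≡e (p ∷ r) = cong₂ _∷_ (ℕ.m+[n∸m]≡n p) (a⊞[e⊟a]≡e r)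

[a⊞b]⊟a≡b : ∀ {k} (a b : Exponent k) → (a ⊞ b) ⊟ a ≡ b
[a⊞b]⊟a≡b []      []      = refl
[a⊞b]⊟a≡b (x ∷ a) (y ∷ b) = cong₂ _∷_ (ℕ.m+n∸m≡n x y) ([a⊞b]⊟a≡b a b)

sum-⊞ : ∀ {k} (a b : Exponent k) → Vec.sum (a ⊞ b) ≡ Vec.sum a ℕ.+ Vec.sum b
sum-⊞ []      []      = refl
sum-⊞ (x ∷ a) (y ∷ b) = ≡.trans (cong (x ℕ.+ y ℕ.+_) (sum-⊞ a b)) (lemma x y (Vec.sum a) (Vec.sum b))
  where
  lemma : ∀ x y s t → x ℕ.+ y ℕ.+ (s ℕ.+ t) ≡ x ℕ.+ s ℕ.+ (y ℕ.+ t)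
  lemma x y s t = begin
    x ℕ.+ y ℕ.+ (s ℕ.+ t)   ≡⟨ ℕ.+-assoc x y (s ℕ.+ t) ⟩
    x ℕ.+ (y ℕ.+ (s ℕ.+ t)) ≡⟨ cong (x ℕ.+_) (ℕ.+-comm y (s ℕ.+ t)) ⟩
    x ℕ.+ (s ℕ.+ t ℕ.+ y)   ≡⟨ cong (x ℕ.+_) (ℕ.+-assoc s t y) ⟩
    x ℕ.+ (s ℕ.+ (t ℕ.+ y)) ≡⟨ cong (λ z → x ℕ.+ (s ℕ.+ z)) (ℕ.+-comm t y) ⟩
    x ℕ.+ (s ℕ.+ (y ℕ.+ t)) ≡⟨ ℕ.+-assoc x s (y ℕ.+ t) ⟨
    x ℕ.+ s ℕ.+ (y ℕ.+ t)   ∎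
    where open ≡.≡-Reasoning

-- Lexicographic order; it supplies leading monomials, from which the degree
-- bounds that make divisibility and irreducibility decidable are derived.
infix 4 _≺_

_≺_ : ∀ {k} → Exponent k → Exponent k → Set
[]      ≺ []      = ⊥
(x ∷ a) ≺ (y ∷ b) = x < y ⊎ (x ≡ y × a ≺ b)

≺-irrefl : ∀ {k} (a : Exponent k) → ¬ a ≺ a
≺-irrefl (x ∷ a) (inj₁ p)       = ℕ.<-irrefl refl p
≺-irrefl (x ∷ a) (inj₂ (_ , p)) = ≺-irrefl a p

≺-trans : ∀ {k} (a b c : Exponent k) → a ≺ b → b ≺ c → a ≺ c
≺-trans []      []      []      ()
≺-trans (x ∷ a) (y ∷ b) (z ∷ c) (inj₁ p)          (inj₁ r)          = inj₁ (ℕ.<-trans p r)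
≺-trans (x ∷ a) (y ∷ b) (z ∷ c) (inj₁ p)          (inj₂ (refl , _)) = inj₁ p
≺-trans (x ∷ a) (y ∷ b) (z ∷ c) (inj₂ (refl , _)) (inj₁ r)          = inj₁ r
≺-trans (x ∷ a) (y ∷ b) (z ∷ c) (inj₂ (refl , p)) (inj₂ (refl , r)) = inj₂ (refl , ≺-trans a b c p r)

≺-total : ∀ {k} (a b : Exponent k) → a ≺ b ⊎ a ≡ b ⊎ b ≺ a
≺-total []      []      = inj₂ (inj₁ refl)
≺-total (x ∷ a) (y ∷ b) with ℕ.<-cmp x y
... | tri< p _ _    = inj₁ (inj₁ p)
... | tri> _ _ p    = inj₂ (inj₂ (inj₁ p))
... | tri≈ _ refl _ with ≺-total a b
...   | inj₁ p           = inj₁ (inj₂ (refl , p))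
...   | inj₂ (inj₁ refl) = inj₂ (inj₁ refl)
...   | inj₂ (inj₂ p)    = inj₂ (inj₂ (inj₂ (refl , p)))

⊞-monoˡ-≺ : ∀ {k} (c a b : Exponent k) → a ≺ b → a ⊞ c ≺ b ⊞ c
⊞-monoˡ-≺ []      []      []      ()
⊞-monoˡ-≺ (z ∷ c) (x ∷ a) (y ∷ b) (inj₁ p)          = inj₁ (ℕ.+-monoˡ-< z p)
⊞-monoˡ-≺ (z ∷ c) (x ∷ a) (y ∷ b) (inj₂ (refl , p)) = inj₂ (refl , ⊞-monoˡ-≺ c a b p)

⊞-monoʳ-≺ : ∀ {k} (c a b : Exponent k) → a ≺ b → c ⊞ a ≺ c ⊞ b
⊞-monoʳ-≺ []      []      []      ()
⊞-monoʳ-≺ (z ∷ c) (x ∷ a) (y ∷ b) (inj₁ p)          = inj₁ (ℕ.+-monoʳ-< z p)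
⊞-monoʳ-≺ (z ∷ c) (x ∷ a) (y ∷ b) (inj₂ (refl , p)) = inj₂ (refl , ⊞-monoʳ-≺ c a b p)

words : ∀ {a} {A : Set a} → ℕ → List A → List (List A)
words zero    xs = [] ∷ []
words (suc l) xs = [] ∷ cartesianProductWith _∷_ xs (words l xs)

module _ {c ℓ : Level} {q : ℕ} (𝔽 : FiniteField c ℓ q) where

  private
    open module F = FiniteField 𝔽 hiding (refl; sym; trans; inverse; finite; zero)

  _≈?_ : Decidable _≈_
  _≈?_ = via-injection (Inverse⇒Injection F.finite) Fin._≟_

  -- Elements of 𝔽[x₁,…,xₖ] as finitely supported coefficient functions.  The
  -- field bound is any bound for the support, not the degree; it plays no role
  -- in equality of polynomials.
  record Polynomial (k : ℕ) : Set (c ⊔ˡ ℓ) where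
    field
      coeff  : Exponent k → Carrier
      bound  : Exponent k
      vanish : ∀ e → ¬ e ≼ bound → coeff e ≈ 0#

  open Polynomial

  ∑ : ∀ {a} {A : Set a} → List A → (A → Carrier) → Carrier
  ∑ []       t = 0#
  ∑ (x ∷ xs) t = t x + ∑ xs t

  ∑-cong : ∀ {a} {A : Set a} (xs : List A) {s t : A → Carrier} →
           (∀ x → s x ≈ t x) → ∑ xs s ≈ ∑ xs t
  ∑-cong []       h = F.refl
  ∑-cong (x ∷ xs) h = +-cong (h x) (∑-cong xs h)

  ∑-zero : ∀ {a} {A : Set a} (xs : List A) {t : A → Carrier} →
           (∀ {x} → x ∈ xs → t x ≈ 0#) → ∑ xs t ≈ 0#
  ∑-zero []       h = F.refl
  ∑-zero (x ∷ xs) h =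
    F.trans (+-cong (h (here refl)) (∑-zero xs (h ∘ there))) (+-identityˡ 0#)

  ∑-single : ∀ {a} {A : Set a} {xs : List A} {t : A → Carrier} {y : A} →
             Unique xs → y ∈ xs → (∀ {x} → x ∈ xs → x ≢ y → t x ≈ 0#) →
             ∑ xs t ≈ t y
  ∑-single (y∉ ∷ _) (here refl) h =
    F.trans (+-congˡ (∑-zero _ λ x∈ → h (there x∈) (All.lookup y∉ x∈ ∘ ≡.sym)))
            (+-identityʳ _)
  ∑-single (x∉ ∷ u) (there y∈) h =
    F.trans (+-cong (h (here refl) (All.lookup x∉ y∈))
                    (∑-single u y∈ (h ∘ there)))
            (+-identityˡ _)

  *≉0 : ∀ {x y} → x ≉ 0# → y ≉ 0# → x * y ≉ 0#
  *≉0 {x} {y} x≉0 y≉0 xy≈0 with x⁻¹ , xx⁻¹≈1 ← F.inverse x x≉0 = y≉0 (begin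
    y             ≈⟨ *-identityˡ y ⟨
    1# * y        ≈⟨ *-congʳ xx⁻¹≈1 ⟨
    x * x⁻¹ * y   ≈⟨ *-congʳ (*-comm x x⁻¹) ⟩
    x⁻¹ * x * y   ≈⟨ *-assoc x⁻¹ x y ⟩
    x⁻¹ * (x * y) ≈⟨ *-congˡ xy≈0 ⟩
    x⁻¹ * 0#      ≈⟨ zeroʳ x⁻¹ ⟩
    0#            ∎)
    where open import Relation.Binary.Reasoning.Setoid F.setoid

  module _ {k : ℕ} where

    infix  4 _≈ᴾ_
    infixl 6 _+ᴾ_
    infixl 7 _*ᴾ_ _·_

    _≈ᴾ_ : Polynomial k → Polynomial k → Set ℓ
    f ≈ᴾ g = ∀ e → coeff f e ≈ coeff g e

    0ᴾ : Polynomial k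
    0ᴾ = record { coeff = λ _ → 0# ; bound = 𝟘 ; vanish = λ _ _ → F.refl }

    1ᴾ : Polynomial k
    1ᴾ = record { coeff = δ ; bound = 𝟘 ; vanish = vanish-δ }
      where
      δ : Exponent k → Carrier
      δ e with e ≟ᵉ 𝟘
      ... | yes _ = 1#
      ... | no  _ = 0#
      vanish-δ : ∀ e → ¬ e ≼ 𝟘 → δ e ≈ 0#
      vanish-δ e e⋠𝟘 with e ≟ᵉ 𝟘
      ... | yes refl = contradiction (Pointwise.refl ℕ.≤-refl) e⋠𝟘
      ... | no  _    = F.refl

    _+ᴾ_ : Polynomial k → Polynomial k → Polynomial k
    f +ᴾ g = record
      { coeff  = λ e → coeff f e + coeff g e
      ; bound  = bound f ⊞ bound g
      ; vanish = λ e e⋠ → F.trans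
          (+-cong (vanish f e λ e≼ → e⋠ (≼-trans e≼ (a≼a⊞b (bound f) (bound g))))
                  (vanish g e λ e≼ → e⋠ (≼-trans e≼ (b≼a⊞b (bound f) (bound g)))))
          (+-identityˡ 0#)
      }

    _*ᴾ_ : Polynomial k → Polynomial k → Polynomial k
    f *ᴾ g = record
      { coeff  = λ e → ∑ (box e) λ a → coeff f a * coeff g (e ⊟ a)
      ; bound  = bound f ⊞ bound g
      ; vanish = λ e e⋠ → ∑-zero (box e) λ {a} a∈ → vanishing e e⋠ a (∈-box⁻ e a∈)
      }
      where
      vanishing : ∀ e → ¬ e ≼ bound f ⊞ bound g → ∀ a → a ≼ e →
                  coeff f a * coeff g (e ⊟ a) ≈ 0#
      vanishing e e⋠ a a≼e with a ≼? bound f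
      ... | no  a⋠ = F.trans (*-congʳ (vanish f a a⋠)) (zeroˡ _)
      ... | yes a≼ = F.trans (*-congˡ (vanish g (e ⊟ a) λ b≼ →
              e⋠ (subst (_≼ bound f ⊞ bound g) (a⊞[e⊟a]≡e a≼e) (⊞-mono-≼ a≼ b≼))))
            (zeroʳ _)

    _·_ : Carrier → Polynomial k → Polynomial k
    x · f = record
      { coeff  = λ e → x * coeff f e
      ; bound  = bound f
      ; vanish = λ e e⋠ → F.trans (*-congˡ (vanish f e e⋠)) (zeroʳ x)
      }

  polynomials : ℕ → RawSemiring (c ⊔ˡ ℓ) ℓ
  polynomials k = record
    { Carrier = Polynomial k
    ; _≈_ = _≈ᴾ_ ; _+_ = _+ᴾ_ ; _*_ = _*ᴾ_ ; 0# = 0ᴾ ; 1# = 1ᴾ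
    }

  module _ {k : ℕ} where

    open SemiringDefinitions (polynomials k) public
      using (_∣_; Coprime; Irreducible; mkIrred)
    open MagmaDefinitions (RawSemiring.*-rawMagma (polynomials k))
      using (_,_)

    infix 4 _~_

    -- The normalized polynomials are the classes of _~_ on nonzero polynomials.
    _~_ : Polynomial k → Polynomial k → Set (c ⊔ˡ ℓ)
    f ~ g = ∃ λ x → x ≉ 0# × f ≈ᴾ x · g

    Nonzero : Polynomial k → Set ℓ
    Nonzero f = ∃ λ e → coeff f e ≉ 0#

    PartialDegree : Fin k → Polynomial k → ℕ → Set ℓ
    PartialDegree i f d =
      (∃ λ e → coeff f e ≉ 0# × lookup e i ≡ d) ×
      (∀ e → coeff f e ≉ 0# → lookup e i ≤ d)

    Deg : Polynomial k → Exponent k → Set ℓ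
    Deg f m = Nonzero f × (∀ i → PartialDegree i f (lookup m i))

    productᴾ : List (Polynomial k) → Polynomial k
    productᴾ = List.foldr _*ᴾ_ 1ᴾ

    ProductOfDistinctIrreducibles : Polynomial k → List (Polynomial k) → Set (c ⊔ˡ ℓ)
    ProductOfDistinctIrreducibles h ps =
      All Irreducible ps × AllPairs (λ p r → ¬ p ~ r) ps × h ~ productᴾ ps

    Supported : Polynomial k → Exponent k → Set ℓ
    Supported f m = ∀ e → coeff f e ≉ 0# → e ≼ m

    supported-bound : ∀ f → Supported f (bound f)
    supported-bound f e fe≉0 with e ≼? bound f
    ... | yes e≼ = e≼
    ... | no  e⋠ = contradiction (vanish f e e⋠) fe≉0

    ≈ᴾ-refl : ∀ (f : Polynomial k) → f ≈ᴾ f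
    ≈ᴾ-refl f e = F.refl

    ≈ᴾ-sym : ∀ (f g : Polynomial k) → f ≈ᴾ g → g ≈ᴾ f
    ≈ᴾ-sym f g h e = F.sym (h e)

    ≈ᴾ-trans : ∀ (f g h : Polynomial k) → f ≈ᴾ g → g ≈ᴾ h → f ≈ᴾ h
    ≈ᴾ-trans f g h p r e = F.trans (p e) (r e)

    *ᴾ-cong : ∀ (f f′ g g′ : Polynomial k) → f ≈ᴾ f′ → g ≈ᴾ g′ → f *ᴾ g ≈ᴾ f′ *ᴾ g′
    *ᴾ-cong f f′ g g′ p r e = ∑-cong (box e) λ a → *-cong (p a) (r (e ⊟ a))

    nonzero-cong : ∀ f g → f ≈ᴾ g → Nonzero f → Nonzero g
    nonzero-cong f g p (e , fe≉0) = e , λ ge≈0 → fe≉0 (F.trans (p e) ge≈0)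

    supported-cong : ∀ f g m → f ≈ᴾ g → Supported f m → Supported g m
    supported-cong f g m p s e ge≉0 = s e λ fe≈0 → ge≉0 (F.trans (F.sym (p e)) fe≈0)

    support? : ∀ {a} {Q : Exponent k → Set a} → (∀ e → Dec (Q e)) →
               ∀ f → Dec (∃ λ e → coeff f e ≉ 0# × Q e)
    support? Q? f = map′
      (λ any → let e , _ , w = find any in e , w)
      (λ (e , fe≉0 , qe) → lose (∈-box⁺ (supported-bound f e fe≉0)) (fe≉0 , qe))
      (Any.any? (λ e → ¬? (coeff f e ≈? 0#) ×-dec Q? e) (box (bound f)))

    nonzero-or-zero : ∀ f → Nonzero f ⊎ f ≈ᴾ 0ᴾ
    nonzero-or-zero f with support? {Q = λ _ → ℕ.zero ≤ ℕ.zero} (λ _ → yes z≤n) f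
    ... | yes (e , fe≉0 , _) = inj₁ (e , fe≉0)
    ... | no  none           = inj₂ λ e →
            decidable-stable (coeff f e ≈? 0#) λ fe≉0 → none (e , fe≉0 , z≤n)

    zero⇒¬nonzero : ∀ f → f ≈ᴾ 0ᴾ → ¬ Nonzero f
    zero⇒¬nonzero f p (e , fe≉0) = fe≉0 (p e)

    nonzero-1ᴾ : Nonzero 1ᴾ
    nonzero-1ᴾ = 𝟘 , lemma
      where
      lemma : coeff {k} 1ᴾ 𝟘 ≉ 0#
      lemma with 𝟘 {k} ≟ᵉ 𝟘
      ... | yes _   = F.1≉0
      ... | no  𝟘≢𝟘 = contradiction refl 𝟘≢𝟘

    zeroˡᴾ : ∀ (f : Polynomial k) → 0ᴾ *ᴾ f ≈ᴾ 0ᴾ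
    zeroˡᴾ f e = ∑-zero (box e) λ _ → zeroˡ _

    factors-nonzero : ∀ f g → Nonzero (f *ᴾ g) → Nonzero f × Nonzero g
    factors-nonzero f g nz with nonzero-or-zero f | nonzero-or-zero g
    ... | inj₁ nf | inj₁ ng = nf , ng
    ... | inj₂ zf | _       = ⊥-elim (zero⇒¬nonzero (f *ᴾ g)
            (λ e → ∑-zero (box e) λ {a} _ → F.trans (*-congʳ (zf a)) (zeroˡ _)) nz)
    ... | inj₁ _  | inj₂ zg = ⊥-elim (zero⇒¬nonzero (f *ᴾ g)
            (λ e → ∑-zero (box e) λ {a} _ → F.trans (*-congˡ (zg (e ⊟ a))) (zeroʳ _)) nz)

    module LeadingMonomial
      (w : Exponent k → ℕ) (w-⊞ : ∀ a b → w (a ⊞ b) ≡ w a ℕ.+ w b)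
      where

      key : Exponent k → Exponent (suc k)
      key e = w e ∷ e

      key-⊞ : ∀ a b → key (a ⊞ b) ≡ key a ⊞ key b
      key-⊞ a b = cong (_∷ a ⊞ b) (w-⊞ a b)

      Leading : Polynomial k → Exponent k → Set ℓ
      Leading f α = coeff f α ≉ 0# × (∀ e → key α ≺ key e → coeff f e ≈ 0#)

      key-max : ∀ f α → Leading f α → ∀ e → coeff f e ≉ 0# → w e ≤ w α
      key-max f α (_ , top) e fe≉0 = ℕ.≮⇒≥ λ wα<we → fe≉0 (top e (inj₁ wα<we))

      leading : ∀ f → Nonzero f → ∃ (Leading f)
      leading f (e₀ , fe₀≉0) with search (box (bound f))
        where
        search : ∀ xs → All (λ e → coeff f e ≈ 0#) xs ⊎
                 ∃ λ α → coeff f α ≉ 0# × All (λ e → key α ≺ key e → coeff f e ≈ 0#) xs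
        search [] = inj₁ []
        search (x ∷ xs) with coeff f x ≈? 0# | search xs
        ... | yes fx≈0 | inj₁ zs             = inj₁ (fx≈0 ∷ zs)
        ... | yes fx≈0 | inj₂ (α , fα≉0 , t) = inj₂ (α , fα≉0 , (λ _ → fx≈0) ∷ t)
        ... | no  fx≉0 | inj₁ zs             =
          inj₂ (x , fx≉0 , (λ x≺x → ⊥-elim (≺-irrefl (key x) x≺x)) ∷ All.map (λ z _ → z) zs)
        ... | no  fx≉0 | inj₂ (α , fα≉0 , t) with ≺-total (key α) (key x)
        ...   | inj₁ α≺x =
          inj₂ (x , fx≉0 , (λ x≺x → ⊥-elim (≺-irrefl (key x) x≺x)) ∷
                All.map (λ {e} z x≺e → z (≺-trans (key α) (key x) (key e) α≺x x≺e)) t)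
        ...   | inj₂ (inj₁ α≡x) =
          inj₂ (α , fα≉0 , (λ α≺x → ⊥-elim (≺-irrefl (key x) (subst (_≺ key x) α≡x α≺x))) ∷ t)
        ...   | inj₂ (inj₂ x≺α) =
          inj₂ (α , fα≉0 , (λ α≺x → ⊥-elim (≺-irrefl (key x)
            (≺-trans (key x) (key α) (key x) x≺α α≺x))) ∷ t)
      ... | inj₁ zs = contradiction
              (All.lookup zs (∈-box⁺ (supported-bound f e₀ fe₀≉0))) fe₀≉0
      ... | inj₂ (α , fα≉0 , t) = α , fα≉0 , top
        where
        top : ∀ e → key α ≺ key e → coeff f e ≈ 0#
        top e α≺e with e ≼? bound f
        ... | yes e≼ = All.lookup t (∈-box⁺ e≼) α≺e
        ... | no  e⋠ = vanish f e e⋠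

      product-leading : ∀ f g α β → Leading f α → Leading g β →
                        coeff (f *ᴾ g) (α ⊞ β) ≉ 0#
      product-leading f g α β (fα≉0 , ftop) (gβ≉0 , gtop) p =
        *≉0 fα≉0 gβ≉0 (F.trans (F.sym single) p)
        where
        term : Exponent k → Carrier
        term a = coeff f a * coeff g ((α ⊞ β) ⊟ a)

        others : ∀ {a} → a ∈ box (α ⊞ β) → a ≢ α → term a ≈ 0#
        others {a} a∈ a≢α with ≺-total (key α) (key a)
        ... | inj₁ α≺a        = F.trans (*-congʳ (ftop a α≺a)) (zeroˡ _)
        ... | inj₂ (inj₁ α≡a) = contradiction (≡.sym (Vec.∷-injectiveʳ α≡a)) a≢α
        ... | inj₂ (inj₂ a≺α) with (α ⊞ β) ⊟ a | a⊞[e⊟a]≡e (∈-box⁻ (α ⊞ β) a∈)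
        ...   | b | a⊞b≡α⊞β with ≺-total (key β) (key b)
        ...     | inj₁ β≺b        = F.trans (*-congˡ (gtop b β≺b)) (zeroʳ _)
        ...     | inj₂ β≽b        = ⊥-elim (≺-irrefl (key α ⊞ key β)
                    (subst (_≺ key α ⊞ key β) sums (below β≽b)))
          where
          sums : key a ⊞ key b ≡ key α ⊞ key β
          sums = ≡.trans (≡.sym (key-⊞ a b)) (≡.trans (cong key a⊞b≡α⊞β) (key-⊞ α β))

          below : key β ≡ key b ⊎ key b ≺ key β → key a ⊞ key b ≺ key α ⊞ key β
          below (inj₁ β≡b) =
            subst (λ z → key a ⊞ key b ≺ key α ⊞ z) (≡.sym β≡b)
                  (⊞-monoˡ-≺ (key b) (key a) (key α) a≺α)
          below (inj₂ b≺β) = ≺-trans (key a ⊞ key b) (key α ⊞ key b) (key α ⊞ key β)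
            (⊞-monoˡ-≺ (key b) (key a) (key α) a≺α)
            (⊞-monoʳ-≺ (key α) (key b) (key β) b≺β)

        single : coeff (f *ᴾ g) (α ⊞ β) ≈ coeff f α * coeff g β
        single = F.trans
          (∑-single {t = term} (box-unique (α ⊞ β)) (∈-box⁺ (a≼a⊞b α β)) others)
          (*-congˡ (F.reflexive (cong (coeff g) ([a⊞b]⊟a≡b α β))))

    factors-supported : ∀ f g m → Nonzero (f *ᴾ g) → Supported (f *ᴾ g) m →
                        Supported f m × Supported g m
    factors-supported f g m nz s =
      (λ e fe≉0 → ≼-lookup⁻ λ i → proj₁ (bounds i) e fe≉0) ,
      (λ e ge≉0 → ≼-lookup⁻ λ i → proj₂ (bounds i) e ge≉0)
      where
      bounds : ∀ i → (∀ e → coeff f e ≉ 0# → lookup e i ≤ lookup m i) ×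
                     (∀ e → coeff g e ≉ 0# → lookup e i ≤ lookup m i)
      bounds i =
        (λ e fe≉0 → ℕ.≤-trans (key-max f α lf e fe≉0)
                      (ℕ.≤-trans (ℕ.m≤m+n _ _) total)) ,
        (λ e ge≉0 → ℕ.≤-trans (key-max g β lg e ge≉0)
                      (ℕ.≤-trans (ℕ.m≤n+m _ _) total))
        where
        open LeadingMonomial (λ e → lookup e i) (λ a b → Vec.lookup-zipWith ℕ._+_ i a b)
        nf = proj₁ (factors-nonzero f g nz)
        ng = proj₂ (factors-nonzero f g nz)
        α  = proj₁ (leading f nf)
        lf = proj₂ (leading f nf)
        β  = proj₁ (leading g ng)
        lg = proj₂ (leading g ng)
        total : lookup α i ℕ.+ lookup β i ≤ lookup m i
        total = subst (_≤ lookup m i) (Vec.lookup-zipWith ℕ._+_ i α β)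
          (Pointwise.lookup (s (α ⊞ β) (product-leading f g α β lf lg)) i)

    product-supported : ∀ f g h → f *ᴾ g ≈ᴾ h → Nonzero h →
                        Supported f (bound h) × Supported g (bound h)
    product-supported f g h p nz = factors-supported f g (bound h)
      (nonzero-cong h (f *ᴾ g) (≈ᴾ-sym (f *ᴾ g) h p) nz)
      (supported-cong h (f *ᴾ g) (bound h) (≈ᴾ-sym (f *ᴾ g) h p) (supported-bound h))

    elements : List Carrier
    elements = List.map (Inverse.from F.finite) (allFin q)

    ∈-elements : ∀ x → ∃ λ y → y ∈ elements × y ≈ x
    ∈-elements x =
      Inverse.from F.finite (Inverse.to F.finite x) ,
      ∈-map⁺ (Inverse.from F.finite) (∈-allFin (Inverse.to F.finite x)) ,
      Inverse.strictlyInverseʳ F.finite x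

    update : Exponent k → Carrier → (Exponent k → Carrier) → Exponent k → Carrier
    update e x φ e′ with e′ ≟ᵉ e
    ... | yes _ = x
    ... | no  _ = φ e′

    functions : List (Exponent k) → List (Exponent k → Carrier)
    functions []       = (λ _ → 0#) ∷ []
    functions (e ∷ es) = cartesianProductWith (update e) elements (functions es)

    ∈-functions : ∀ (ψ : Exponent k → Carrier) es →
                  ∃ λ φ → φ ∈ functions es × All (λ e → ψ e ≈ φ e) es
    ∈-functions ψ [] = (λ _ → 0#) , here refl , []
    ∈-functions ψ (e ∷ es)
      with x , x∈ , x≈ ← ∈-elements (ψ e) | φ , φ∈ , agree ← ∈-functions ψ es
      = update e x φ , ∈-cartesianProductWith⁺ (update e) x∈ φ∈ , at-e ∷ All.map others agree
      where
      at-e : ψ e ≈ update e x φ e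
      at-e with e ≟ᵉ e
      ... | yes _  = F.sym x≈
      ... | no e≢e = contradiction refl e≢e
      others : ∀ {e′} → ψ e′ ≈ φ e′ → ψ e′ ≈ update e x φ e′
      others {e′} p with e′ ≟ᵉ e
      ... | yes refl = F.sym x≈
      ... | no  _    = p

    truncate : Exponent k → (Exponent k → Carrier) → Polynomial k
    truncate m φ = record { coeff = ψ ; bound = m ; vanish = out }
      where
      ψ : Exponent k → Carrier
      ψ e with e ≼? m
      ... | yes _ = φ e
      ... | no  _ = 0#
      out : ∀ e → ¬ e ≼ m → ψ e ≈ 0#
      out e e⋠ with e ≼? m
      ... | yes e≼ = contradiction e≼ e⋠
      ... | no  _  = F.refl

    -- Every polynomial supported below m, up to _≈ᴾ_.
    polynomialsBelow : Exponent k → List (Polynomial k)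
    polynomialsBelow m = List.map (truncate m) (functions (box m))

    ∈-polynomialsBelow : ∀ f m → Supported f m →
                         ∃ λ g → g ∈ polynomialsBelow m × f ≈ᴾ g
    ∈-polynomialsBelow f m s with φ , φ∈ , agree ← ∈-functions (coeff f) (box m)
      = truncate m φ , ∈-map⁺ (truncate m) φ∈ , eq
      where
      eq : f ≈ᴾ truncate m φ
      eq e with e ≼? m
      ... | yes e≼ = All.lookup agree (∈-box⁺ e≼)
      ... | no  e⋠ = decidable-stable (coeff f e ≈? 0#) λ fe≉0 → e⋠ (s e fe≉0)

    search : ∀ {a} (Q : Polynomial k → Set a) (m : Exponent k) →
             (∀ f → Dec (Q f)) → (∀ f g → f ≈ᴾ g → Q f → Q g) →
             (∀ f → Q f → Supported f m) → Dec (∃ Q)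
    search Q m Q? resp bounded = map′
      (λ any → let f , _ , qf = find any in f , qf)
      (λ (f , qf) → let g , g∈ , f≈g = ∈-polynomialsBelow f m (bounded f qf)
                    in lose g∈ (resp f g f≈g qf))
      (Any.any? Q? (polynomialsBelow m))

    _≈ᴾ?_ : Decidable (_≈ᴾ_ {k})
    f ≈ᴾ? g = map′ to (λ p → All.universal p _ , All.universal p _)
      (All.all? (λ e → coeff f e ≈? coeff g e) (box (bound f)) ×-dec
       All.all? (λ e → coeff f e ≈? coeff g e) (box (bound g)))
      where
      to : All (λ e → coeff f e ≈ coeff g e) (box (bound f)) ×
           All (λ e → coeff f e ≈ coeff g e) (box (bound g)) → f ≈ᴾ g
      to (p , r) e with e ≼? bound f | e ≼? bound g
      ... | yes e≼ | _      = All.lookup p (∈-box⁺ e≼)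
      ... | no _   | yes e≼ = All.lookup r (∈-box⁺ e≼)
      ... | no e⋠f | no e⋠g = F.trans (vanish f e e⋠f) (F.sym (vanish g e e⋠g))

    _~?_ : Decidable _~_
    f ~? g = map′
      (λ any → let x , _ , w = find any in x , w)
      (λ (x , x≉0 , p) → let y , y∈ , y≈x = ∈-elements x in
        lose y∈ ((λ y≈0 → x≉0 (F.trans (F.sym y≈x) y≈0)) ,
                 λ e → F.trans (p e) (*-congʳ (F.sym y≈x))))
      (Any.any? (λ x → ¬? (x ≈? 0#) ×-dec (f ≈ᴾ? (x · g))) elements)

    deg? : ∀ m f → Dec (Deg f m)
    deg? m f = nonzero? ×-dec Fin.all? λ i → partial? i (lookup m i)
      where
      nonzero? : Dec (Nonzero f)
      nonzero? with nonzero-or-zero f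
      ... | inj₁ nz = yes nz
      ... | inj₂ z  = no (zero⇒¬nonzero f z)
      partial? : ∀ i d → Dec (PartialDegree i f d)
      partial? i d = support? (λ e → lookup e i ℕ.≟ d) f ×-dec
                     map′ to from (¬? (support? (λ e → ¬? (lookup e i ℕ.≤? d)) f))
        where
        Exceeding : Set ℓ
        Exceeding = ∃ λ e → coeff f e ≉ 0# × ¬ lookup e i ≤ d

        to : ¬ Exceeding → ∀ e → coeff f e ≉ 0# → lookup e i ≤ d
        to none e fe≉0 = decidable-stable (lookup e i ℕ.≤? d) λ ≰ → none (e , fe≉0 , ≰)

        from : (∀ e → coeff f e ≉ 0# → lookup e i ≤ d) → ¬ Exceeding
        from all (e , fe≉0 , ≰) = ≰ (all e fe≉0)

    _∣?_ : Decidable _∣_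
    f ∣? g with nonzero-or-zero g
    ... | inj₂ z  = yes (0ᴾ , ≈ᴾ-trans (0ᴾ *ᴾ f) 0ᴾ g (zeroˡᴾ f) (≈ᴾ-sym g 0ᴾ z))
    ... | inj₁ nz = map′ (λ (r , p) → r , p) (λ (r , p) → r , p)
      (search (λ r → r *ᴾ f ≈ᴾ g) (bound g) (λ r → (r *ᴾ f) ≈ᴾ? g)
        (λ r r′ r≈r′ p → ≈ᴾ-trans (r′ *ᴾ f) (r *ᴾ f) g
          (*ᴾ-cong r′ r f f (≈ᴾ-sym r r′ r≈r′) (≈ᴾ-refl f)) p)
        (λ r p → proj₁ (product-supported r f g p nz)))

    ∣-congˡ : ∀ (f g h : Polynomial k) → f ≈ᴾ g → f ∣ h → g ∣ h
    ∣-congˡ f g h f≈g (r , p) = r , ≈ᴾ-trans (r *ᴾ g) (r *ᴾ f) h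
      (*ᴾ-cong r r g f (≈ᴾ-refl r) (≈ᴾ-sym f g f≈g)) p

    0∤1 : ∀ (f : Polynomial k) → f ≈ᴾ 0ᴾ → ¬ f ∣ 1ᴾ
    0∤1 f z (r , p) = zero⇒¬nonzero f z
      (proj₂ (factors-nonzero r f (nonzero-cong 1ᴾ (r *ᴾ f) (≈ᴾ-sym (r *ᴾ f) 1ᴾ p) nonzero-1ᴾ)))

    irreducible-nonzero : ∀ (f : Polynomial k) → Irreducible f → Nonzero f
    irreducible-nonzero f (mkIrred _ split) with nonzero-or-zero f
    ... | inj₁ nz = nz
    ... | inj₂ z  = ⊥-elim ([ 0∤1 0ᴾ (≈ᴾ-refl 0ᴾ) , 0∤1 0ᴾ (≈ᴾ-refl 0ᴾ) ]′
            (split {0ᴾ} {0ᴾ} (≈ᴾ-trans f 0ᴾ (0ᴾ *ᴾ 0ᴾ) z (≈ᴾ-sym (0ᴾ *ᴾ 0ᴾ) 0ᴾ (zeroˡᴾ 0ᴾ)))))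

    coprime? : Decidable Coprime
    coprime? f g = map′
      (λ none {z} z∣f z∣g → decidable-stable (z ∣? 1ᴾ) λ z∤1 → none (z , z∣f , z∣g , z∤1))
      (λ cop (z , z∣f , z∣g , z∤1) → z∤1 (cop {z} z∣f z∣g))
      (¬? common?)
      where
      CommonFactor : Polynomial k → Set (c ⊔ˡ ℓ)
      CommonFactor z = z ∣ f × z ∣ g × ¬ z ∣ 1ᴾ

      factor? : ∀ z → Dec (CommonFactor z)
      factor? z = (z ∣? f) ×-dec (z ∣? g) ×-dec ¬? (z ∣? 1ᴾ)

      resp : ∀ y z → y ≈ᴾ z → CommonFactor y → CommonFactor z
      resp y z y≈z (y∣f , y∣g , y∤1) =
        ∣-congˡ y z f y≈z y∣f , ∣-congˡ y z g y≈z y∣g ,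
        (λ z∣1 → y∤1 (∣-congˡ z y 1ᴾ (≈ᴾ-sym y z y≈z) z∣1))

      common? : Dec (∃ CommonFactor)
      common? with nonzero-or-zero f | nonzero-or-zero g
      ... | inj₁ nf | _       = search CommonFactor (bound f) factor? resp
              λ { z ((r , p) , _) → proj₂ (product-supported r z f p nf) }
      ... | inj₂ _  | inj₁ ng = search CommonFactor (bound g) factor? resp
              λ { z (_ , (r , p) , _) → proj₂ (product-supported r z g p ng) }
      ... | inj₂ zf | inj₂ zg = yes (0ᴾ ,
              (0ᴾ , ≈ᴾ-trans (0ᴾ *ᴾ 0ᴾ) 0ᴾ f (zeroˡᴾ 0ᴾ) (≈ᴾ-sym f 0ᴾ zf)) ,
              (0ᴾ , ≈ᴾ-trans (0ᴾ *ᴾ 0ᴾ) 0ᴾ g (zeroˡᴾ 0ᴾ) (≈ᴾ-sym g 0ᴾ zg)) ,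
              0∤1 0ᴾ (≈ᴾ-refl 0ᴾ))

    irreducible? : ∀ (f : Polynomial k) → Dec (Irreducible f)
    irreducible? f with nonzero-or-zero f
    ... | inj₂ z  = no λ irr → zero⇒¬nonzero f z (irreducible-nonzero f irr)
    ... | inj₁ nz = map′ to from (¬? (f ∣? 1ᴾ) ×-dec ¬? reducible?)
      where
      Split : Polynomial k → Polynomial k → Set (c ⊔ˡ ℓ)
      Split x y = f ≈ᴾ x *ᴾ y × ¬ x ∣ 1ᴾ × ¬ y ∣ 1ᴾ

      split? : ∀ x y → Dec (Split x y)
      split? x y = (f ≈ᴾ? (x *ᴾ y)) ×-dec ¬? (x ∣? 1ᴾ) ×-dec ¬? (y ∣? 1ᴾ)

      resp : ∀ x x′ y y′ → x ≈ᴾ x′ → y ≈ᴾ y′ → Split x y → Split x′ y′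
      resp x x′ y y′ p r (f≈xy , x∤1 , y∤1) =
        ≈ᴾ-trans f (x *ᴾ y) (x′ *ᴾ y′) f≈xy (*ᴾ-cong x x′ y y′ p r) ,
        x∤1 ∘ ∣-congˡ x′ x 1ᴾ (≈ᴾ-sym x x′ p) ,
        y∤1 ∘ ∣-congˡ y′ y 1ᴾ (≈ᴾ-sym y y′ r)

      bounded : ∀ x y → Split x y → Supported x (bound f) × Supported y (bound f)
      bounded x y (p , _) = product-supported x y f (≈ᴾ-sym f (x *ᴾ y) p) nz

      reducible? : Dec (∃ λ x → ∃ (Split x))
      reducible? = search (λ x → ∃ (Split x)) (bound f)
        (λ x → search (Split x) (bound f) (split? x)
          (λ y y′ → resp x x y y′ (≈ᴾ-refl x)) (λ y → proj₂ ∘ bounded x y))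
        (λ x x′ p (y , s) → y , resp x x′ y y p (≈ᴾ-refl y) s)
        (λ x (y , s) → proj₁ (bounded x y s))

      to : ¬ f ∣ 1ᴾ × ¬ (∃ λ x → ∃ (Split x)) → Irreducible f
      to (f∤1 , none) = mkIrred f∤1 λ {x} {y} p →
        decidable-stable ((x ∣? 1ᴾ) ⊎-dec (y ∣? 1ᴾ)) λ neither →
          none (x , y , p , neither ∘ inj₁ , neither ∘ inj₂)

      from : Irreducible f → ¬ f ∣ 1ᴾ × ¬ (∃ λ x → ∃ (Split x))
      from (mkIrred f∤1 split) =
        f∤1 , λ (x , y , p , x∤1 , y∤1) → [ x∤1 , y∤1 ]′ (split {x} {y} p)

    irreducible-cong : ∀ (f g : Polynomial k) → f ≈ᴾ g → Irreducible f → Irreducible g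
    irreducible-cong f g f≈g (mkIrred f∤1 split) = mkIrred
      (f∤1 ∘ ∣-congˡ g f 1ᴾ (≈ᴾ-sym f g f≈g))
      λ {x} {y} p → split {x} {y} (≈ᴾ-trans f g (x *ᴾ y) f≈g p)

    ~-cong : ∀ (f f′ g g′ : Polynomial k) → f ≈ᴾ f′ → g ≈ᴾ g′ → f ~ g → f′ ~ g′
    ~-cong f f′ g g′ p r (x , x≉0 , f≈xg) =
      x , x≉0 , λ e → F.trans (F.sym (p e)) (F.trans (f≈xg e) (*-congˡ (r e)))

    productᴾ-cong : ∀ {ps qs : List (Polynomial k)} → PW.Pointwise _≈ᴾ_ ps qs →
                    productᴾ ps ≈ᴾ productᴾ qs
    productᴾ-cong []                              = ≈ᴾ-refl 1ᴾ
    productᴾ-cong (_∷_ {p} {r} {ps} {rs} p≈r ps≈rs) =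
      *ᴾ-cong p r (productᴾ ps) (productᴾ rs) p≈r (productᴾ-cong ps≈rs)

    productOfDistinctIrreducibles-cong :
      ∀ (h : Polynomial k) {ps qs} → PW.Pointwise _≈ᴾ_ ps qs →
      ProductOfDistinctIrreducibles h ps → ProductOfDistinctIrreducibles h qs
    productOfDistinctIrreducibles-cong h {ps} {qs} ps≈qs (irr , distinct , h~Π) =
      all ps≈qs irr , pairs ps≈qs distinct ,
      ~-cong h h (productᴾ ps) (productᴾ qs) (≈ᴾ-refl h) (productᴾ-cong ps≈qs) h~Π
      where
      all : ∀ {ps qs} → PW.Pointwise _≈ᴾ_ ps qs → All Irreducible ps → All Irreducible qs
      all []                      []       = []
      all (_∷_ {p} {r} p≈r e) (i ∷ is) = irreducible-cong p r p≈r i ∷ all e is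

      apart : ∀ {p r ps qs} → p ≈ᴾ r → PW.Pointwise _≈ᴾ_ ps qs →
              All (λ s → ¬ p ~ s) ps → All (λ s → ¬ r ~ s) qs
      apart p≈r [] [] = []
      apart {p} {r} p≈r (_∷_ {s} {t} s≈t e) (n ∷ ns) =
        (n ∘ ~-cong r p t s (≈ᴾ-sym p r p≈r) (≈ᴾ-sym s t s≈t)) ∷ apart {p} {r} p≈r e ns

      pairs : ∀ {ps qs} → PW.Pointwise _≈ᴾ_ ps qs →
              AllPairs (λ p r → ¬ p ~ r) ps → AllPairs (λ p r → ¬ p ~ r) qs
      pairs []                            []       = []
      pairs (_∷_ {p} {r} p≈r ps≈qs) (n ∷ ns) =
        apart {p} {r} p≈r ps≈qs n ∷ pairs ps≈qs ns

    constant-* : ∀ x (f : Polynomial k) → (x · 1ᴾ) *ᴾ f ≈ᴾ x · f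
    constant-* x f e = F.trans
      (∑-single {t = term} (box-unique e) (∈-box⁺ (𝟘≼ e)) others) at-𝟘
      where
      term : Exponent k → Carrier
      term a = x * coeff {k} 1ᴾ a * coeff f (e ⊟ a)

      𝟘≼ : ∀ {j} (e : Exponent j) → 𝟘 ≼ e
      𝟘≼ []      = []
      𝟘≼ (d ∷ e) = z≤n ∷ 𝟘≼ e

      ⊟𝟘 : ∀ {j} (e : Exponent j) → e ⊟ 𝟘 ≡ e
      ⊟𝟘 []      = refl
      ⊟𝟘 (d ∷ e) = cong (d ∷_) (⊟𝟘 e)

      others : ∀ {a} → a ∈ box e → a ≢ 𝟘 → term a ≈ 0#
      others {a} _ a≢𝟘 with a ≟ᵉ 𝟘
      ... | yes a≡𝟘 = contradiction a≡𝟘 a≢𝟘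
      ... | no  _   = F.trans (*-congʳ (zeroʳ x)) (zeroˡ _)

      at-𝟘 : term 𝟘 ≈ x * coeff f e
      at-𝟘 with 𝟘 {k} ≟ᵉ 𝟘
      ... | yes _   = *-cong (*-identityʳ x) (F.reflexive (cong (coeff f) (⊟𝟘 e)))
      ... | no  𝟘≢𝟘 = contradiction refl 𝟘≢𝟘

    nonunit-nonconstant : ∀ (f : Polynomial k) → Nonzero f → ¬ f ∣ 1ᴾ →
                          ¬ (∀ e → coeff f e ≉ 0# → e ≡ 𝟘)
    nonunit-nonconstant f (e₀ , fe₀≉0) f∤1 const
      with refl ← const e₀ fe₀≉0
      with x , fx≈1 ← F.inverse (coeff f 𝟘) fe₀≉0
      = f∤1 (x · 1ᴾ , ≈ᴾ-trans ((x · 1ᴾ) *ᴾ f) (x · f) 1ᴾ (constant-* x f) eq)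
      where
      eq : x · f ≈ᴾ 1ᴾ
      eq e with e ≟ᵉ 𝟘
      ... | yes refl = F.trans (*-comm x _) fx≈1
      ... | no  e≢𝟘  = F.trans
              (*-congˡ (decidable-stable (coeff f e ≈? 0#) λ fe≉0 → e≢𝟘 (const e fe≉0)))
              (zeroʳ x)

    sum≡0⇒𝟘 : ∀ {j} (e : Exponent j) → Vec.sum e ≡ 0 → e ≡ 𝟘
    sum≡0⇒𝟘 []         _ = refl
    sum≡0⇒𝟘 (zero ∷ e) p = cong (0 ∷_) (sum≡0⇒𝟘 e p)

    product-size : ∀ (ps : List (Polynomial k)) → All Irreducible ps →
                   ∃ λ e → coeff (productᴾ ps) e ≉ 0# × length ps ≤ Vec.sum e
    product-size []       []           = proj₁ nonzero-1ᴾ , proj₂ nonzero-1ᴾ , z≤n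
    product-size (p ∷ ps) (irr ∷ irrs)
      with e , Πe≉0 , len ← product-size ps irrs
      = α ⊞ β , product-leading p (productᴾ ps) α β lα lβ ,
        subst (suc (length ps) ≤_) (≡.sym (sum-⊞ α β))
          (ℕ.+-mono-≤ positive (ℕ.≤-trans len (key-max (productᴾ ps) β lβ e Πe≉0)))
      where
      open LeadingMonomial Vec.sum sum-⊞
      nz = irreducible-nonzero p irr
      α  = proj₁ (leading p nz)
      lα = proj₂ (leading p nz)
      β  = proj₁ (leading (productᴾ ps) (e , Πe≉0))
      lβ = proj₂ (leading (productᴾ ps) (e , Πe≉0))
      positive : 1 ≤ Vec.sum α
      positive = ℕ.≰⇒> λ ∑α≤0 → nonunit-nonconstant p nz (Irreducible.p∤1 irr)
        λ e pe≉0 → sum≡0⇒𝟘 e (ℕ.n≤0⇒n≡0 (ℕ.≤-trans (key-max p α lα e pe≉0) ∑α≤0))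

    product-factors-supported :
      ∀ m (ps : List (Polynomial k)) → Nonzero (productᴾ ps) → Supported (productᴾ ps) m →
      All (λ p → Supported p m) ps
    product-factors-supported m []       _  _ = []
    product-factors-supported m (p ∷ ps) nz s =
      proj₁ both ∷ product-factors-supported m ps
        (proj₂ (factors-nonzero p (productᴾ ps) nz)) (proj₂ both)
      where both = factors-supported p (productᴾ ps) m nz s

    ∈-words : ∀ l m (ps : List (Polynomial k)) → length ps ≤ l →
              All (λ p → Supported p m) ps →
              ∃ λ qs → qs ∈ words l (polynomialsBelow m) × PW.Pointwise _≈ᴾ_ ps qs
    ∈-words zero    m []       _         _        = [] , here refl , []
    ∈-words (suc l) m []       _         _        = [] , here refl , []
    ∈-words (suc l) m (p ∷ ps) (s≤s len) (s ∷ ss)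
      with r , r∈ , p≈r ← ∈-polynomialsBelow p m s
         | rs , rs∈ , ps≈rs ← ∈-words l m ps len ss
      = r ∷ rs , there (∈-cartesianProductWith⁺ _∷_ r∈ rs∈) , p≈r ∷ ps≈rs

    productOfDistinctIrreducibles? :
      ∀ (h : Polynomial k) → Dec (∃ (ProductOfDistinctIrreducibles h))
    productOfDistinctIrreducibles? h = map′
      (λ any → let ps , _ , w = find any in ps , w)
      (λ (ps , w) → let qs , qs∈ , ps≈qs = ∈-words l (bound h) ps (short ps w) (below ps w)
                    in lose qs∈ (productOfDistinctIrreducibles-cong h ps≈qs w))
      (Any.any? holds? (words l (polynomialsBelow (bound h))))
      where
      l : ℕ
      l = Vec.sum (bound h)

      holds? : ∀ ps → Dec (ProductOfDistinctIrreducibles h ps)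
      holds? ps = All.all? irreducible? ps ×-dec
                  AllPairs.allPairs? (λ p r → ¬? (p ~? r)) ps ×-dec
                  (h ~? productᴾ ps)

      supported : ∀ ps → ProductOfDistinctIrreducibles h ps →
                  Supported (productᴾ ps) (bound h)
      supported ps (_ , _ , x , x≉0 , h≈xΠ) e Πe≉0 =
        supported-bound h e λ he≈0 → *≉0 x≉0 Πe≉0 (F.trans (F.sym (h≈xΠ e)) he≈0)

      sum-mono : ∀ {j} {a b : Exponent j} → a ≼ b → Vec.sum a ≤ Vec.sum b
      sum-mono []      = z≤n
      sum-mono (p ∷ r) = ℕ.+-mono-≤ p (sum-mono r)

      short : ∀ ps → ProductOfDistinctIrreducibles h ps → length ps ≤ l
      short ps w with e , Πe≉0 , len ← product-size ps (proj₁ w)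
        = ℕ.≤-trans len (sum-mono (supported ps w e Πe≉0))

      below : ∀ ps → ProductOfDistinctIrreducibles h ps →
              All (λ p → Supported p (bound h)) ps
      below ps w with e , Πe≉0 , _ ← product-size ps (proj₁ w)
        = product-factors-supported (bound h) ps (e , Πe≉0) (supported ps w)

    -- By unique factorization the length of the list found does not depend on
    -- the factorization, and none exists precisely when the square of an
    -- irreducible divides h (for h nonzero).
    μ : Polynomial k → ℤ
    μ h with productOfDistinctIrreducibles? h
    ... | yes (ps , _) = -1ℤ ℤ.^ length ps
    ... | no  _        = 0ℤ

    -- One representative of every normalized polynomial of vector degree m.
    𝒩 : Exponent k → List (Polynomial k)
    𝒩 m = deduplicate _~?_ (filter (deg? m) (polynomialsBelow m))

    N : Exponent k → ℕ
    N m = length (𝒩 m)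

    -- gcd(f, g) = 1 is the library's Coprime: every common divisor is a unit.
    P : Exponent k → Exponent k → ℕ
    P m n = length (filter (uncurry coprime?) (cartesianProduct (𝒩 m) (𝒩 n)))

    A : Exponent k → ℤ
    A d = List.foldr ℤ._+_ 0ℤ (List.map μ (𝒩 d))

    mainTerm : Exponent k → Exponent k → Exponent k → ℤ
    mainTerm t m n = List.foldr ℤ._+_ 0ℤ
      (List.map (λ d → ℤ.+ N (m ⊟ d) ℤ.* ℤ.+ N (n ⊟ d) ℤ.* A d) (box t))

module _ {k : ℕ} where

  ∏[_+1] : Exponent k → ℕ
  ∏[ m +1] = Vec.foldr′ ℕ._*_ 1 (Vec.map suc m)

  -- The natural-number quotients are exact, as mⱼ + 1 divides ∏ᵢ (mᵢ + 1); the
  -- base value 0 does not affect the maximum of naturals when k > 0.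
  errorExponent : Exponent k → Exponent k → Exponent k → ℕ
  errorExponent t m n = max 0 (List.map (λ j → part m j ℕ.+ part n j) (allFin k))
    where
    part : Exponent k → Fin k → ℕ
    part m j = ((lookup m j ∸ lookup t j) ℕ.* ∏[ m +1]) ℕ./ suc (lookup m j)

{-# OPTIONS --safe #-}
module Submission where

-- Write S(f, g) for the sum of μ(h) over the common divisors h of f and g with Deg h ≤ t.
-- As N(m − d) elements of 𝒩(m) are multiples of a given h of degree d, the main term is
-- the sum of S(f, g) over all pairs.  If every common divisor of f and g has degree ≤ t,
-- then S(f, g) is the indicator of coprimality, because multiplication by an irreducible
-- common divisor p is a sign-reversing matching between the square-free common divisors
-- prime to p and those divisible by p.  For the remaining pairs the discrepancy is bounded
-- in terms of t, and their number is at most the sum of N(d) N(m − d) N(n − d) over the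
-- d ≰ t.  Since N(d) ≤ q^∏(dᵢ + 1), it suffices that the exponent of such a term is at
-- most E + 2 tⱼ + 4 − (d₁ + ⋯ + dₖ) for some j with dⱼ > tⱼ, where E is the exponent of
-- the error term; the sum over d is then dominated by a geometric series.
--
-- The matching needs that irreducible polynomials are prime.  This is proved by induction
-- on the number of variables, by pseudo-division and Zermelo's descent, without passing
-- to the field of fractions.

open import Algebra.Bundles using (CommutativeRing; CommutativeSemiring; RawSemiring; Semiring)
import Algebra.Definitions.RawMagma as MagmaDefinitions
import Algebra.Definitions.RawSemiring as SemiringDefinitions
import Algebra.Properties.CommutativeSemigroup as CommutativeSemigroupProperties
import Algebra.Properties.CommutativeSemigroup.Divisibility as CommutativeSemigroupDivisibility
import Algebra.Properties.Monoid.Divisibility as MonoidDivisibility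
import Algebra.Properties.Ring as RingProperties
import Algebra.Properties.Semiring.Primality as SemiringPrimality
import Algebra.Solver.Ring.NaturalCoefficients.Default as SemiringSolver
open import Data.Fin.Base as Fin using (Fin; zero; suc)
open import Data.Fin.Properties using (¬∀⟶∃¬)
open import Data.Integer.Base as ℤ using (ℤ; 0ℤ; 1ℤ; -1ℤ)
import Data.Integer.Properties as ℤ
open import Data.List.Base as List
  using (List; []; _∷_; _++_; map; foldr; length; filter; deduplicate; upTo; allFin;
         concatMap; cartesianProduct; cartesianProductWith)
open import Data.List.Extrema.Nat using (xs≤max)
open import Data.List.Membership.Propositional using (_∈_; find; lose)
open import Data.List.Membership.Propositional.Properties
  using (∈-upTo⁺; ∈-upTo⁻; ∈-map⁺; ∈-allFin; ∈-filter⁺; ∈-filter⁻; ∈-concatMap⁺;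
         ∈-cartesianProduct⁻; ∈-deduplicate⁻)
import Data.List.Properties as List
open import Data.List.Relation.Unary.All as All using (All; []; _∷_)
import Data.List.Relation.Unary.All.Properties as All
open import Data.List.Relation.Unary.AllPairs as AllPairs using (AllPairs; []; _∷_)
import Data.List.Relation.Unary.AllPairs.Properties as AllPairs
open import Data.List.Relation.Unary.Any as Any using (Any; here; there)
import Data.List.Relation.Unary.Any.Properties as Any
import Data.List.Relation.Unary.Unique.Propositional.Properties as Unique
open import Data.Nat.Base as ℕ using (ℕ; zero; suc; _∸_; _≤_; _<_; z≤n; s≤s; NonZero)
import Data.Nat.DivMod as ℕ
import Data.Nat.Properties as ℕ
open import Data.Nat.Solver using (module +-*-Solver)
open import Data.Product.Base using (∃; _×_; _,_; proj₁; proj₂; uncurry)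
open import Data.Sum.Base as Sum using (_⊎_; inj₁; inj₂; [_,_]′; swap)
open import Data.Vec.Base as Vec using ([]; _∷_; lookup; tabulate)
import Data.Vec.Properties as Vec
open import Data.Vec.Relation.Binary.Pointwise.Inductive as Pointwise using ([]; _∷_)
open import Function.Base using (_∘_; id; const; flip)
open import Function.Bundles using (Inverse)
open import Level using (Level) renaming (suc to lsuc; _⊔_ to _⊔ˡ_)
open import Relation.Binary.Definitions using (Decidable)
open import Relation.Binary.PropositionalEquality as ≡
  using (_≡_; _≢_; refl; cong; cong₂; subst; subst₂)
import Relation.Binary.Reasoning.Setoid as SetoidReasoning
open import Relation.Nullary.Decidable
  using (Dec; yes; no; ¬?; _×-dec_; _⊎-dec_; decidable-stable)
open import Relation.Nullary.Negation using (¬_; contradiction)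
import Relation.Unary as Unary

open import Defs
  using (Exponent; box; ∈-box⁺; ∈-box⁻; box-unique; _≼_; _≼?_; _⊞_; _⊟_; ∏[_+1]; errorExponent;
         b≼a⊞b; a⊞[e⊟a]≡e; sum-⊞; ≼-trans; ≼-lookup⁻)

-- Unique factorization in polynomial extensions

-- Pseudo-division of u by p multiplies u by the leading coefficient of p, a polynomial in fewer
-- variables. It can be cancelled afterwards: its irreducible factors are prime in fewer variables
-- by induction, they stay prime in the larger ring by Gauss's argument, and none of them divides an
-- irreducible p of positive degree in the new variable. This settles the case where u or v has at
-- least the degree of p. Otherwise pseudo-division does nothing, and Zermelo's idea is to apply the
-- statement not to p but to the irreducible factors of the cofactor w in u v = w p, whose degrees
-- are smaller than that of u.
--
-- In the error term, let dⱼ > tⱼ. Nonzero entries dᵢ with i ≠ j raise the exponent of N(d) and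
-- lower those of N(m - d) and N(n - d). The bound max(mⱼ, nⱼ) ≥ 2tⱼ + 1 would already make the two
-- effects balance. The strict inequality leaves a surplus of one copy of the product of the dᵢ + 1
-- over i ≠ j, less 1, and this surplus pays for the decay of the terms in those dᵢ.

module _ {c ℓ} (R : CommutativeRing c ℓ) where
  open CommutativeRing R
  open SemiringDefinitions (Semiring.rawSemiring semiring) using (_∣_; Irreducible)

  -- An inductive predicate, so that cancelling irreducible factors one at a time, as in
  -- `constant-cancel` and `prime-cofactor`, is structural recursion.
  data Factored : Carrier → Set (c ⊔ˡ ℓ) where
    unit : ∀ {z} → z ∣ 1# → Factored z
    step : ∀ {z p w} → Irreducible p → Factored w → z ≈ p * w → Factored z

-- Only the existence of factorizations is assumed. Uniqueness is the separate property
-- `IrreduciblesPrime`, which is what the induction on the number of variables carries along.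
record FactorizationDomain (c ℓ : Level) : Set (lsuc (c ⊔ˡ ℓ)) where
  infix 4 _≈?_
  field
    commutativeRing : CommutativeRing c ℓ
  open CommutativeRing commutativeRing public renaming
    (refl to ≈-refl; sym to ≈-sym; trans to ≈-trans)
  field
    1≉0      : 1# ≉ 0#
    _≈?_     : Decidable _≈_
    *≉0      : ∀ {x y} → x ≉ 0# → y ≉ 0# → x * y ≉ 0#
    factored : ∀ {x} → x ≉ 0# → Factored commutativeRing x

  open SemiringDefinitions (Semiring.rawSemiring semiring) public using
    (Irreducible; mkIrred; Coprime)
  open CommutativeSemigroupDivisibility *-commutativeSemigroup public
  open MonoidDivisibility *-monoid public using (∣ʳ-refl; ε∣ʳ_)
  open RingProperties ring public
    using (-‿distribˡ-*; x[y-z]≈xy-xz; [y-z]x≈yx-zx; x∙y⁻¹≈ε⇒x≈y; x≈y⇒x∙y⁻¹≈ε; //-rightDividesˡ)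
  open SemiringSolver commutativeSemiring public using (solve; _:=_; _:*_)

  IrreduciblesPrime : Set (c ⊔ˡ ℓ)
  IrreduciblesPrime = ∀ {p} → Irreducible p → ∀ u v → p ∣ u * v → p ∣ u ⊎ p ∣ v

  *-cancelˡ : ∀ {p x y} → p ≉ 0# → p * x ≈ p * y → x ≈ y
  *-cancelˡ {p} {x} {y} p≉0 px≈py with x - y ≈? 0#
  ... | yes x-y≈0 = x∙y⁻¹≈ε⇒x≈y x y x-y≈0
  ... | no  x-y≉0 = contradiction
          (≈-trans (x[y-z]≈xy-xz p x y) (x≈y⇒x∙y⁻¹≈ε px≈py)) (*≉0 p≉0 x-y≉0)

  irreducible-≉0 : ∀ {p} → Irreducible p → p ≉ 0#
  irreducible-≉0 = SemiringPrimality.Irreducible⇒≉0 semiring (1≉0 ∘ ≈-sym)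

  irreducible-cong : ∀ {p q} → p ≈ q → Irreducible p → Irreducible q
  irreducible-cong p≈q (mkIrred p∤1 split) =
    mkIrred (p∤1 ∘ ∣ʳ-respˡ-≈ (≈-sym p≈q)) (split ∘ ≈-trans p≈q)

  ∣-+ : ∀ {p x y} → p ∣ x → p ∣ y → p ∣ x + y
  ∣-+ {p} (a , ap≈x) (b , bp≈y) = a + b , ≈-trans (distribʳ p a b) (+-cong ap≈x bp≈y)

  ∣-neg : ∀ {p x} → p ∣ x → p ∣ - x
  ∣-neg {p} (a , ap≈x) = - a , ≈-trans (≈-sym (-‿distribˡ-* a p)) (-‿cong ap≈x)

  ∣-- : ∀ {p x y} → p ∣ x → p ∣ y → p ∣ x - y
  ∣-- p∣x p∣y = ∣-+ p∣x (∣-neg p∣y)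

  ∣-minus⁻ : ∀ {p x y} → p ∣ x - y → p ∣ y → p ∣ x
  ∣-minus⁻ {p} {x} {y} p∣x-y p∣y = ∣ʳ-respʳ-≈ (//-rightDividesˡ y x) (∣-+ p∣x-y p∣y)

  ∣-*ʳ : ∀ {p x} y → p ∣ x → p ∣ x * y
  ∣-*ʳ {p} {x} y p∣x = ∣ʳ-respʳ-≈ (*-comm y x) (x∣ʳy⇒x∣ʳzy y p∣x)

  ∣0 : ∀ {p x} → x ≈ 0# → p ∣ x
  ∣0 {p} x≈0 = 0# , ≈-trans (zeroˡ p) (≈-sym x≈0)

  ≉0-factors : ∀ {x y z} → z ≉ 0# → z ≈ x * y → x ≉ 0# × y ≉ 0#
  ≉0-factors {x} {y} z≉0 z≈xy =
    (λ x≈0 → z≉0 (≈-trans z≈xy (≈-trans (*-congʳ x≈0) (zeroˡ y)))) ,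
    (λ y≈0 → z≉0 (≈-trans z≈xy (≈-trans (*-congˡ y≈0) (zeroʳ x))))

  unit-cancel : ∀ {c x y} → c ∣ 1# → y ∣ c * x → y ∣ x
  unit-cancel {c} {x} (b , bc≈1) y∣cx = ∣ʳ-respʳ-≈
    (≈-trans (≈-sym (*-assoc b c x)) (≈-trans (*-congʳ bc≈1) (*-identityˡ x)))
    (x∣ʳy⇒x∣ʳzy b y∣cx)

-- S plays the role of the polynomial ring R[X]; slice n is the coefficient of Xⁿ.
record PolynomialExtension {c ℓ} (R S : FactorizationDomain c ℓ) : Set (c ⊔ˡ ℓ) where
  private
    module R = FactorizationDomain R
    module S = FactorizationDomain S
  field
    ι         : R.Carrier → S.Carrier
    X         : S.Carrier
    slice     : ℕ → S.Carrier → R.Carrier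
    ext       : ∀ {f g} → (∀ n → slice n f R.≈ slice n g) → f S.≈ g
    slice-cong : ∀ n {f g} → f S.≈ g → slice n f R.≈ slice n g
    slice-+   : ∀ n f g → slice n (f S.+ g) R.≈ slice n f R.+ slice n g
    slice-neg : ∀ n f → slice n (S.- f) R.≈ R.- slice n f
    slice-ι   : ∀ n r f → slice n (ι r S.* f) R.≈ r R.* slice n f
    slice-X   : ∀ n f → slice (suc n) (X S.* f) R.≈ slice n f
    slice-1   : slice 0 S.1# R.≈ R.1#
    slice-1⁺  : ∀ n → slice (suc n) S.1# R.≈ R.0#
    bounded   : ∀ f → ∃ λ D → ∀ n → D ≤ n → slice n f R.≈ R.0#
    -- Of a product of two arbitrary elements only the top coefficient is described. This suffices
    -- for additivity of degrees, for the degree drop in the descent and for Gauss's argument on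
    -- leading coefficients.
    slice-top : ∀ d e f g →
                (∀ n → suc d ≤ n → slice n f R.≈ R.0#) → (∀ n → suc e ≤ n → slice n g R.≈ R.0#) →
                slice (d ℕ.+ e) (f S.* g) R.≈ slice d f R.* slice e g

  Vanishes : ℕ → S.Carrier → Set ℓ
  Vanishes D f = ∀ n → D ≤ n → slice n f R.≈ R.0#

-- From primes of R to primes of R[X]

module Gauss {c ℓ} (R S : FactorizationDomain c ℓ) (E : PolynomialExtension R S)
             (primeR : FactorizationDomain.IrreduciblesPrime R) where
  private
    module R = FactorizationDomain R
  open FactorizationDomain S
  open PolynomialExtension E

  slice-minus : ∀ n f g → slice n (f - g) R.≈ slice n f R.- slice n g
  slice-minus n f g = R.≈-trans (slice-+ n f (- g)) (R.+-congˡ (slice-neg n g))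

  slice-0 : ∀ n → slice n 0# R.≈ R.0#
  slice-0 n = R.≈-trans (slice-cong n (≈-sym (zeroʳ (ι R.0#))))
    (R.≈-trans (slice-ι n R.0# 0#) (R.zeroˡ _))

  zero-vanishing : ∀ {f} → Vanishes 0 f → f ≈ 0#
  zero-vanishing v = ext λ n → R.≈-trans (v n z≤n) (R.≈-sym (slice-0 n))

  -- The extension describes the coefficients of `ι r * f` only, so properties of `ι r` itself are
  -- read off after multiplication by `1#`.
  ι-cong : ∀ {x y} → x R.≈ y → ι x ≈ ι y
  ι-cong {x} {y} x≈y = ≈-trans (≈-sym (*-identityʳ (ι x))) (≈-trans
    (ext λ n → R.≈-trans (slice-ι n x 1#) (R.≈-trans (R.*-congʳ x≈y) (R.≈-sym (slice-ι n y 1#))))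
    (*-identityʳ (ι y)))

  ι-1 : ι R.1# ≈ 1#
  ι-1 = ≈-trans (≈-sym (*-identityʳ _))
    (ext λ n → R.≈-trans (slice-ι n R.1# 1#) (R.*-identityˡ _))

  ι-* : ∀ x y → ι (x R.* y) ≈ ι x * ι y
  ι-* x y = ≈-trans (≈-sym (*-identityʳ _)) (≈-trans
    (ext λ n → R.≈-trans (slice-ι n (x R.* y) 1#) (R.≈-trans (R.*-assoc x y _)
      (R.≈-trans (R.*-congˡ (R.≈-sym (slice-ι n y 1#))) (R.≈-sym (slice-ι n x _)))))
    (*-congˡ (*-identityʳ _)))

  slice-ι-0 : ∀ x → slice 0 (ι x) R.≈ x
  slice-ι-0 x = R.≈-trans (slice-cong 0 (≈-sym (*-identityʳ (ι x))))
    (R.≈-trans (slice-ι 0 x 1#) (R.≈-trans (R.*-congˡ slice-1) (R.*-identityʳ x)))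

  vanishes-ι : ∀ x → Vanishes 1 (ι x)
  vanishes-ι x (suc n) _ = R.≈-trans (slice-cong (suc n) (≈-sym (*-identityʳ (ι x))))
    (R.≈-trans (slice-ι (suc n) x 1#) (R.≈-trans (R.*-congˡ (slice-1⁺ n)) (R.zeroʳ x)))

  vanishes-1 : Vanishes 1 1#
  vanishes-1 (suc n) _ = slice-1⁺ n

  constant : ∀ {f} → Vanishes 1 f → f ≈ ι (slice 0 f)
  constant {f} v = ext λ where
    zero    → R.≈-sym (slice-ι-0 (slice 0 f))
    (suc n) → R.≈-trans (v (suc n) (s≤s z≤n)) (R.≈-sym (vanishes-ι _ (suc n) (s≤s z≤n)))

  ι-∣1 : ∀ {x} → ι x ∣ 1# → x R.∣ R.1#
  ι-∣1 {x} (w , wx≈1) = slice 0 w R., R.≈-trans (R.*-comm _ _)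
    (R.≈-trans (R.≈-sym (slice-ι 0 x w))
      (R.≈-trans (slice-cong 0 (≈-trans (*-comm (ι x) w) wx≈1)) slice-1))

  ι-∣ : ∀ {x y} → x R.∣ y → ι x ∣ ι y
  ι-∣ {x} (w R., wx≈y) = ι w , ≈-trans (≈-sym (ι-* w x)) (ι-cong wx≈y)

  ι-irreducible⁻ : ∀ {x} → Irreducible (ι x) → R.Irreducible x
  ι-irreducible⁻ {x} (mkIrred ιx∤1 split) = R.mkIrred
    (λ x∣1 → ιx∤1 (∣ʳ-respʳ-≈ ι-1 (ι-∣ x∣1)))
    λ {y} {z} x≈yz → Sum.map ι-∣1 ι-∣1 (split (≈-trans (ι-cong x≈yz) (ι-* y z)))

  infix 8 X^_
  X^_ : ℕ → Carrier
  X^ zero  = 1#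
  X^ suc n = X * X^ n

  slice-X^ : ∀ d n f → slice (n ℕ.+ d) (X^ d * f) R.≈ slice n f
  slice-X^ zero    n f rewrite ℕ.+-identityʳ n = slice-cong n (*-identityˡ f)
  slice-X^ (suc d) n f rewrite ℕ.+-suc n d =
    R.≈-trans (slice-cong _ (*-assoc X (X^ d) f))
      (R.≈-trans (slice-X _ (X^ d * f)) (slice-X^ d n f))

  ExactDegree : Carrier → ℕ → Set ℓ
  ExactDegree f d = slice d f R.≉ R.0# × Vanishes (suc d) f

  exactDegree : ∀ {f} → f ≉ 0# → ∃ (ExactDegree f)
  exactDegree {f} f≉0 with D , v ← bounded f = go D v
    where
    go : ∀ D → Vanishes D f → ∃ (ExactDegree f)
    go zero    v = contradiction (zero-vanishing v) f≉0
    go (suc D) v with slice D f R.≈? R.0#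
    ... | no  s≉0 = D , s≉0 , v
    ... | yes s≈0 = go D λ n D≤n → below n D≤n (D ℕ.≟ n)
      where
      below : ∀ n → D ≤ n → Dec (D ≡ n) → slice n f R.≈ R.0#
      below n D≤n (yes refl) = s≈0
      below n D≤n (no D≢n)   = v n (ℕ.≤∧≢⇒< D≤n D≢n)

  exactDegree-< : ∀ {f D d} → ExactDegree f d → Vanishes D f → d < D
  exactDegree-< {d = d} (s≉0 , _) v = ℕ.≰⇒> λ D≤d → s≉0 (v d D≤d)

  exactDegree-* : ∀ {f g h d e D} → ExactDegree f d → ExactDegree g e →
                  f * g ≈ h → Vanishes D h → d ℕ.+ e < D
  exactDegree-* {f} {g} {d = d} {e} (fd≉0 , fv) (ge≉0 , gv) fg≈h v = ℕ.≰⇒> λ D≤d+e →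
    R.*≉0 fd≉0 ge≉0 (R.≈-trans (R.≈-sym (slice-top d e f g fv gv))
      (R.≈-trans (slice-cong _ fg≈h) (v _ D≤d+e)))

  vanishes-* : ∀ {f g d e} → Vanishes (suc d) f → Vanishes (suc e) g →
               Vanishes (suc (d ℕ.+ e)) (f * g)
  vanishes-* {f} {g} {d} {e} fv gv n d+e<n = subst (λ n → slice n (f * g) R.≈ R.0#)
    (ℕ.m+[n∸m]≡n d≤n)
    (R.≈-trans (slice-top d (n ℕ.∸ d) f g fv λ k n-d<k → gv k (ℕ.≤-trans (ℕ.m≤n⇒m≤1+n e<n-d) n-d<k))
      (R.≈-trans (R.*-congˡ (gv (n ℕ.∸ d) e<n-d)) (R.zeroʳ _)))
    where
    d≤n   = ℕ.≤-trans (ℕ.m≤m+n d e) (ℕ.<⇒≤ d+e<n)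
    e<n-d : e < n ℕ.∸ d
    e<n-d = ℕ.+-cancelˡ-< d e (n ℕ.∸ d) (subst (d ℕ.+ e <_) (≡.sym (ℕ.m+[n∸m]≡n d≤n)) d+e<n)

  -- One step of pseudo-division: when `d` and `d + e` bound the degrees of `p` and `u`, the
  -- coefficients of X to the power `d + e` cancel. With `p = 1#` and `d = 0` it strips `u` of its
  -- top term.
  reduct : ℕ → ℕ → Carrier → Carrier → Carrier
  reduct d e p u = ι (slice d p) * u - ι (slice (d ℕ.+ e) u) * (X^ e * p)

  vanishes-reduct : ∀ d e {p u} → Vanishes (suc d) p → Vanishes (suc (d ℕ.+ e)) u →
                    Vanishes (d ℕ.+ e) (reduct d e p u)
  vanishes-reduct d e {p} {u} pv uv n d+e≤n = R.≈-trans (slice-minus n _ _)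
    (R.≈-trans (R.+-cong (slice-ι n _ u) (R.-‿cong (slice-ι n _ _))) (lemma (d ℕ.+ e ℕ.≟ n)))
    where
    lemma : Dec (d ℕ.+ e ≡ n) →
            slice d p R.* slice n u R.- slice (d ℕ.+ e) u R.* slice n (X^ e * p) R.≈ R.0#
    lemma (yes refl) = R.x≈y⇒x∙y⁻¹≈ε
      (R.≈-trans (R.*-comm _ _) (R.*-congˡ (R.≈-sym (slice-X^ e d p))))
    lemma (no d+e≢n) = R.x≈y⇒x∙y⁻¹≈ε (R.≈-trans
      (R.≈-trans (R.*-congˡ (uv n d+e<n)) (R.zeroʳ _))
      (R.≈-sym (R.≈-trans (R.*-congˡ high) (R.zeroʳ _))))
      where
      d+e<n = ℕ.≤∧≢⇒< d+e≤n d+e≢n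
      e≤n   = ℕ.≤-trans (ℕ.m≤n+m e d) d+e≤n
      high : slice n (X^ e * p) R.≈ R.0#
      high = subst (λ n → slice n (X^ e * p) R.≈ R.0#) (ℕ.m∸n+n≡m e≤n)
        (R.≈-trans (slice-X^ e (n ℕ.∸ e) p) (pv _ (ℕ.m+n≤o⇒m≤o∸n (suc d) d+e<n)))

  -- The divisor `q` is kept apart from `p` to serve both uses of `reduct`: in `prime-reduce` they
  -- coincide, in `ι-prime` the divisor is a constant and `p` is `1#`.
  reduct-∣ : ∀ d e {p q u v} → q ∣ ι (slice (d ℕ.+ e) u) * (X^ e * p) → q ∣ u * v →
             q ∣ reduct d e p u * v
  reduct-∣ d e {p} {q} {u} {v} q∣lead q∣uv = ∣ʳ-respʳ-≈ (≈-sym ([y-z]x≈yx-zx v _ _))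
    (∣-- (∣ʳ-respʳ-≈ (≈-sym (*-assoc _ u v)) (x∣ʳy⇒x∣ʳzy _ q∣uv)) (∣-*ʳ v q∣lead))

  -- Gauss's argument: p divides the product of the two top coefficients, hence one of them. The
  -- corresponding top term is a multiple of `ι p` and can be removed without affecting the
  -- divisibility, which lowers one of the two degree bounds.
  ι-prime : ∀ {p} → R.Irreducible p → ∀ Du Dv u v → Vanishes Du u → Vanishes Dv v →
            ι p ∣ u * v → ι p ∣ u ⊎ ι p ∣ v
  ι-prime irr zero     _        u v uz vz _ = inj₁ (∣0 (zero-vanishing uz))
  ι-prime irr (suc _)  zero     u v uz vz _ = inj₂ (∣0 (zero-vanishing vz))
  ι-prime {p} irr (suc du) (suc dv) u v uz vz (w , wp≈uv)
    with primeR irr (slice du u) (slice dv v)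
      (slice (du ℕ.+ dv) w R., (R.≈-trans (R.*-comm _ p) (R.≈-trans (R.≈-sym (slice-ι _ p w))
        (R.≈-trans (slice-cong _ (≈-trans (*-comm _ _) wp≈uv)) (slice-top du dv u v uz vz)))))
  ... | inj₁ p∣a = peel (∣-*ʳ _ (ι-∣ p∣a))
    where
    peel : ι p ∣ ι (slice du u) * (X^ du * 1#) → ι p ∣ u ⊎ ι p ∣ v
    peel p∣lead with ι-prime irr du (suc dv) (reduct 0 du 1# u) v
                       (vanishes-reduct 0 du vanishes-1 uz) vz (reduct-∣ 0 du p∣lead (w , wp≈uv))
    ... | inj₁ p∣u′ = inj₁ (∣ʳ-respʳ-≈
                        (≈-trans (*-congʳ (≈-trans (ι-cong slice-1) ι-1)) (*-identityˡ u))
                        (∣-minus⁻ p∣u′ p∣lead))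
    ... | inj₂ p∣v  = inj₂ p∣v
  ... | inj₂ p∣b = peel (∣-*ʳ _ (ι-∣ p∣b))
    where
    peel : ι p ∣ ι (slice dv v) * (X^ dv * 1#) → ι p ∣ u ⊎ ι p ∣ v
    peel p∣lead with ι-prime irr (suc du) dv u (reduct 0 dv 1# v) uz
                       (vanishes-reduct 0 dv vanishes-1 vz)
                       (∣ʳ-respʳ-≈ (*-comm _ u) (reduct-∣ 0 dv p∣lead
                         (w , ≈-trans wp≈uv (*-comm u v))))
    ... | inj₁ p∣u  = inj₁ p∣u
    ... | inj₂ p∣v′ = inj₂ (∣ʳ-respʳ-≈
                        (≈-trans (*-congʳ (≈-trans (ι-cong slice-1) ι-1)) (*-identityˡ v))
                        (∣-minus⁻ p∣v′ p∣lead))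

  ι-prime′ : ∀ {p} → R.Irreducible p → ∀ u v → ι p ∣ u * v → ι p ∣ u ⊎ ι p ∣ v
  ι-prime′ irr u v with Du , uz ← bounded u | Dv , vz ← bounded v = ι-prime irr Du Dv u v uz vz

  -- The prime factors of a are constants, hence do not divide p.
  constant-cancel : ∀ {p d} → Irreducible p → ExactDegree p (suc d) → ∀ {a} →
    Factored R.commutativeRing a → ∀ u → p ∣ ι a * u → p ∣ u
  constant-cancel irr deg (unit a∣1) u p∣au =
    unit-cancel (∣ʳ-respʳ-≈ ι-1 (ι-∣ a∣1)) p∣au
  constant-cancel {p} irr deg {a} (step {p = π} {w} irrπ fw a≈πw) u (h , hp≈au)
    with ι-prime′ irrπ h p (ι w * u , (≈-trans
      (solve 3 (λ x y z → (x :* y) :* z := (z :* x) :* y) ≈-refl (ι w) u (ι π))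
      (≈-trans (*-congʳ (≈-trans (≈-sym (ι-* π w)) (ι-cong (R.≈-sym a≈πw)))) (≈-sym hp≈au))))
  ... | inj₁ (h′ , h′π≈h) = constant-cancel irr deg fw u (h′ , *-cancelˡ ιπ≉0 (≈-trans
      (solve 3 (λ x y z → x :* (y :* z) := (y :* x) :* z) ≈-refl (ι π) h′ p)
      (≈-trans (*-congʳ h′π≈h) (≈-trans hp≈au (≈-trans (*-congʳ (≈-trans (ι-cong a≈πw) (ι-* π w)))
        (*-assoc _ _ _))))))
    where
    ιπ≉0 : ι π ≉ 0#
    ιπ≉0 ιπ≈0 = R.irreducible-≉0 irrπ
      (R.≈-trans (R.≈-sym (slice-ι-0 π)) (R.≈-trans (slice-cong 0 ιπ≈0) (slice-0 0)))
  -- If π divided the irreducible p, then b would be a unit and p an associate of the constant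
  -- `ι π`, contrary to its positive degree.
  ... | inj₂ (b , bπ≈p) with Irreducible.split-∣1 irr (≈-sym bπ≈p)
  ...   | inj₂ ιπ∣1 = contradiction (ι-∣1 ιπ∣1) (R.Irreducible.p∤1 irrπ)
  ...   | inj₁ (b′ , b′b≈1) with e , degb′ ← exactDegree (proj₁ (≉0-factors 1≉0 (≈-sym b′b≈1))) =
    contradiction (ℕ.n≤0⇒n≡0 (ℕ.s≤s⁻¹ (exactDegree-* degb′ deg b′p≈π (vanishes-ι π)))) (ℕ.m+1+n≢0 e)
    where
    b′p≈π : b′ * p ≈ ι π
    b′p≈π = ≈-trans (*-congˡ (≈-sym bπ≈p))
      (≈-trans (≈-sym (*-assoc _ _ _)) (≈-trans (*-congʳ b′b≈1) (*-identityˡ _)))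

  constant-prime : ∀ {p} → Irreducible p → Vanishes 1 p → ∀ u v → p ∣ u * v → p ∣ u ⊎ p ∣ v
  constant-prime {p} irr pv u v p∣uv
    with ι-prime′ (ι-irreducible⁻ (irreducible-cong p≈ιp₀ irr)) u v (∣ʳ-respˡ-≈ p≈ιp₀ p∣uv)
    where p≈ιp₀ = constant pv
  ... | inj₁ p∣u = inj₁ (∣ʳ-respˡ-≈ (≈-sym (constant pv)) p∣u)
  ... | inj₂ p∣v = inj₂ (∣ʳ-respˡ-≈ (≈-sym (constant pv)) p∣v)

  -- The statement is for all p at once, since the descent applies the induction hypothesis to
  -- irreducible factors of the cofactor in place of p.
  PrimeUpTo : ℕ → Set (c ⊔ˡ ℓ)
  PrimeUpTo n = ∀ {p} → Irreducible p → ∀ Du Dv → Du ℕ.+ Dv ≤ n → ∀ u v →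
                Vanishes Du u → Vanishes Dv v → p ∣ u * v → p ∣ u ⊎ p ∣ v

  -- The induction replaces u by its pseudo-remainder modulo p.
  prime-reduce : ∀ {n} → PrimeUpTo n → ∀ {p d} → Irreducible p → ExactDegree p d →
                 ∀ Du Dv → Du ℕ.+ Dv ≤ suc n → d < Du → ∀ u v →
                 Vanishes Du u → Vanishes Dv v → p ∣ u * v → p ∣ u ⊎ p ∣ v
  prime-reduce ih {p} {zero} irr (_ , pz) Du Dv le d<Du u v uz vz p∣uv =
    constant-prime irr pz u v p∣uv
  prime-reduce ih {p} {d@(suc _)} irr deg@(pd≉0 , pz) (suc Du) Dv le (s≤s d≤Du) u v uz vz p∣uv
    with e , refl ← ℕ.m≤n⇒∃[o]m+o≡n d≤Du
    with ih irr (d ℕ.+ e) Dv (ℕ.s≤s⁻¹ le) (reduct d e p u) v (vanishes-reduct d e pz uz) vz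
            (reduct-∣ d e (x∣ʳy⇒x∣ʳzy _ (x∣ʳyx p _)) p∣uv)
  ... | inj₁ p∣u′ = inj₁ (constant-cancel irr deg (R.factored pd≉0) u
                      (∣-minus⁻ p∣u′ (x∣ʳy⇒x∣ʳzy _ (x∣ʳyx p _))))
  ... | inj₂ p∣v  = inj₂ p∣v

  -- Zermelo's descent: when p has larger degree than u and v, the cofactor w in
  -- u v = w p has smaller degree, and its irreducible factors are cancelled
  -- one by one.
  prime-cofactor : ∀ {n} → PrimeUpTo n → ∀ {p d} → Irreducible p → ExactDegree p d →
                   ∀ {w} → Factored commutativeRing w →
                   ∀ Du Dv → Du ℕ.+ Dv ≤ suc n → Du ≤ d → Dv ≤ d → ∀ u v →
                   Vanishes Du u → Vanishes Dv v → w * p ≈ u * v → p ∣ u ⊎ p ∣ v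
  -- Here p is an associate of u v, so irreducibility makes one of u and v a unit, and p divides the
  -- other.
  prime-cofactor ih {p} irr deg {w} (unit (x , xw≈1)) Du Dv le Du≤d Dv≤d u v uz vz wp≈uv
    with Irreducible.split-∣1 irr (≈-sym (≈-trans (*-assoc x u v) xuv≈p))
    where
    xuv≈p : x * (u * v) ≈ p
    xuv≈p = ≈-trans (*-congˡ (≈-sym wp≈uv)) (≈-trans (≈-sym (*-assoc x w p))
              (≈-trans (*-congʳ xw≈1) (*-identityˡ p)))
  ... | inj₁ xu∣1 = inj₂ (unit-cancel (∣ʳ-trans (x∣ʳyx u x) xu∣1) (w , wp≈uv))
  ... | inj₂ v∣1  = inj₁ (unit-cancel v∣1 (w , ≈-trans wp≈uv (*-comm u v)))
  prime-cofactor ih {p} {d} irr deg@(pd≉0 , pz) {w} (step {p = π} {w′} irrπ fw w≈πw′)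
                 Du Dv le Du≤d Dv≤d u v uz vz wp≈uv
    with u ≈? 0# | v ≈? 0# | w ≈? 0#
  ... | yes u≈0 | _       | _       = inj₁ (∣0 u≈0)
  ... | no _    | yes v≈0 | _       = inj₂ (∣0 v≈0)
  ... | no u≉0  | no v≉0  | yes w≈0 = contradiction
          (≈-trans (≈-sym wp≈uv) (≈-trans (*-congʳ w≈0) (zeroˡ p))) (*≉0 u≉0 v≉0)
  ... | no u≉0  | no v≉0  | no w≉0
    with du , degu ← exactDegree u≉0 | dv , degv ← exactDegree v≉0 | dw , degw ← exactDegree w≉0
       | dπ , degπ ← exactDegree (irreducible-≉0 irrπ)
       | e , degw′ ← exactDegree (proj₂ (≉0-factors w≉0 w≈πw′))
    = finish (prime-reduce ih irrπ degπ Du Dv le dπ<Du u v uz vz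
        (w′ * p , ≈-trans (≈-trans (*-comm _ π) (≈-sym (*-assoc π w′ p)))
          (≈-trans (*-congʳ (≈-sym w≈πw′)) wp≈uv)))
    where
    -- In deg w + deg p = deg u + deg v the degree of v is below that of p. Thus every irreducible
    -- factor π of w has smaller degree than u, and `prime-reduce` applies to π.
    dw≤du : dw < du
    dw≤du = ℕ.+-cancelʳ-< d dw du (ℕ.≤-<-trans
      (ℕ.s≤s⁻¹ (exactDegree-* degw deg wp≈uv (vanishes-* (proj₂ degu) (proj₂ degv))))
      (ℕ.+-monoʳ-< du (ℕ.<-≤-trans (exactDegree-< degv vz) Dv≤d)))
    dπ<Du : dπ < Du
    dπ<Du = ℕ.≤-<-trans (ℕ.m+n≤o⇒m≤o dπ
      (ℕ.s≤s⁻¹ (exactDegree-* degπ degw′ (≈-sym w≈πw′) (proj₂ degw))))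
              (ℕ.<-trans dw≤du (exactDegree-< degu uz))

    cofactor-vanishes : ∀ {D f f′} → f ≉ 0# → f′ * π ≈ f → Vanishes D f → Vanishes D f′
    cofactor-vanishes {D} {f} {f′} f≉0 f′π≈f fz n D≤n
      with e , deg′ ← exactDegree (proj₁ (≉0-factors f≉0 (≈-sym f′π≈f)))
      = proj₂ deg′ n (ℕ.≤-trans (ℕ.≤-<-trans (ℕ.m≤m+n e dπ) (exactDegree-* deg′ degπ f′π≈f fz)) D≤n)

    cancelled : ∀ {f f′ g} → f′ * π ≈ f → w * p ≈ f * g → w′ * p ≈ f′ * g
    cancelled {f} {f′} {g} f′π≈f wp≈fg = *-cancelˡ (irreducible-≉0 irrπ) (≈-trans
      (≈-trans (≈-sym (*-assoc π w′ p)) (*-congʳ (≈-sym w≈πw′)))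
      (≈-trans wp≈fg (≈-trans (*-congʳ (≈-sym f′π≈f))
        (solve 3 (λ x y z → (x :* y) :* z := y :* (x :* z)) ≈-refl f′ π g))))

    finish : π ∣ u ⊎ π ∣ v → p ∣ u ⊎ p ∣ v
    finish (inj₁ (u′ , u′π≈u))
      with prime-cofactor ih irr deg fw Du Dv le Du≤d Dv≤d u′ v (cofactor-vanishes u≉0 u′π≈u uz) vz
             (cancelled u′π≈u wp≈uv)
    ... | inj₁ p∣u′ = inj₁ (∣ʳ-respʳ-≈ u′π≈u (∣-*ʳ π p∣u′))
    ... | inj₂ p∣v  = inj₂ p∣v
    finish (inj₂ (v′ , v′π≈v))
      with prime-cofactor ih irr deg fw Du Dv le Du≤d Dv≤d u v′ uz (cofactor-vanishes v≉0 v′π≈v vz)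
             (≈-trans (cancelled v′π≈v (≈-trans wp≈uv (*-comm u v))) (*-comm v′ u))
    ... | inj₁ p∣u  = inj₁ p∣u
    ... | inj₂ p∣v′ = inj₂ (∣ʳ-respʳ-≈ v′π≈v (∣-*ʳ π p∣v′))

  primeUpTo : ∀ n → PrimeUpTo n
  primeUpTo zero    irr zero Dv le u v uz vz _ = inj₁ (∣0 (zero-vanishing uz))
  primeUpTo (suc n) {p} irr Du Dv le u v uz vz p∣uv@(w , wp≈uv)
    with d , deg ← exactDegree (irreducible-≉0 irr)
    with suc d ℕ.≤? Du | suc d ℕ.≤? Dv | w ≈? 0#
  ... | yes d<Du | _        | _ = prime-reduce (primeUpTo n) irr deg Du Dv le d<Du u v uz vz p∣uv
  ... | no _     | yes d<Dv | _ = swap (prime-reduce (primeUpTo n) irr deg Dv Du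
          (subst (_≤ suc n) (ℕ.+-comm Du Dv) le) d<Dv v u vz uz (∣ʳ-respʳ-≈ (*-comm u v) p∣uv))
  ... | no d≮Du  | no d≮Dv  | no w≉0 = prime-cofactor (primeUpTo n) irr deg (factored w≉0) Du Dv le
          (ℕ.≮⇒≥ d≮Du) (ℕ.≮⇒≥ d≮Dv) u v uz vz wp≈uv
  ... | no _     | no _     | yes w≈0 with u ≈? 0# | v ≈? 0#
  ...   | yes u≈0 | _       = inj₁ (∣0 u≈0)
  ...   | no _    | yes v≈0 = inj₂ (∣0 v≈0)
  ...   | no u≉0  | no v≉0  = contradiction
            (≈-trans (≈-sym wp≈uv) (≈-trans (*-congʳ w≈0) (zeroˡ p))) (*≉0 u≉0 v≉0)

  irreduciblesPrime : IrreduciblesPrime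
  irreduciblesPrime irr u v with Du , uz ← bounded u | Dv , vz ← bounded v =
    primeUpTo _ irr Du Dv ℕ.≤-refl u v uz vz

-- Finite sums

-- The same identities serve the coefficients of polynomials in the field, the integer sums of μ and
-- the counts in the natural numbers.
module ListSum {r ℓ} (R : CommutativeSemiring r ℓ) where
  open CommutativeSemiring R renaming (refl to ≈-refl; sym to ≈-sym; trans to ≈-trans)
  open CommutativeSemigroupProperties +-commutativeSemigroup using (interchange; x∙yz≈y∙xz)
  open SetoidReasoning setoid

  sum : ∀ {a} {A : Set a} → List A → (A → Carrier) → Carrier
  sum xs t = foldr _+_ 0# (map t xs)

  -- Iverson bracket.
  [_]·_ : ∀ {p} {P : Set p} → Dec P → Carrier → Carrier
  [ yes _ ]· x = x
  [ no  _ ]· x = 0#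

  module _ {a} {A : Set a} where

    sum-cong-∈ : ∀ (xs : List A) {s t : A → Carrier} → (∀ {x} → x ∈ xs → s x ≈ t x) →
      sum xs s ≈ sum xs t
    sum-cong-∈ []       h = ≈-refl
    sum-cong-∈ (x ∷ xs) h = +-cong (h (here refl)) (sum-cong-∈ xs (h ∘ there))

    sum-cong : ∀ (xs : List A) {s t : A → Carrier} → (∀ x → s x ≈ t x) → sum xs s ≈ sum xs t
    sum-cong xs h = sum-cong-∈ xs λ {x} _ → h x

    sum-zero : ∀ (xs : List A) {t : A → Carrier} → (∀ {x} → x ∈ xs → t x ≈ 0#) → sum xs t ≈ 0#
    sum-zero []       h = ≈-refl
    sum-zero (x ∷ xs) h = ≈-trans (+-cong (h (here refl)) (sum-zero xs (h ∘ there)))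
      (+-identityˡ 0#)

    sum-+ : ∀ (xs : List A) (s t : A → Carrier) → sum xs (λ x → s x + t x) ≈ sum xs s + sum xs t
    sum-+ []       s t = ≈-sym (+-identityˡ 0#)
    sum-+ (x ∷ xs) s t = ≈-trans (+-congˡ (sum-+ xs s t))
      (interchange (s x) (t x) (sum xs s) (sum xs t))

    sum-*ˡ : ∀ c (xs : List A) (t : A → Carrier) → c * sum xs t ≈ sum xs (λ x → c * t x)
    sum-*ˡ c []       t = zeroʳ c
    sum-*ˡ c (x ∷ xs) t = ≈-trans (distribˡ c _ _) (+-congˡ (sum-*ˡ c xs t))

    sum-*ʳ : ∀ c (xs : List A) (t : A → Carrier) → sum xs t * c ≈ sum xs (λ x → t x * c)
    sum-*ʳ c xs t = ≈-trans (*-comm _ c)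
      (≈-trans (sum-*ˡ c xs t) (sum-cong xs λ x → *-comm c (t x)))

    sum-++ : ∀ (xs ys : List A) (t : A → Carrier) → sum (xs ++ ys) t ≈ sum xs t + sum ys t
    sum-++ []       ys t = ≈-sym (+-identityˡ _)
    sum-++ (x ∷ xs) ys t = ≈-trans (+-congˡ (sum-++ xs ys t)) (≈-sym (+-assoc _ _ _))

    sum-filter : ∀ {p} {P : A → Set p} (P? : Unary.Decidable P) (xs : List A) (t : A → Carrier) →
                 sum (filter P? xs) t ≈ sum xs (λ x → [ P? x ]· t x)
    sum-filter P? []       t = ≈-refl
    sum-filter P? (x ∷ xs) t with P? x
    ... | yes _ = +-congˡ (sum-filter P? xs t)
    ... | no  _ = ≈-trans (sum-filter P? xs t) (≈-sym (+-identityˡ _))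

  sum-map : ∀ {a b} {A : Set a} {B : Set b} (f : A → B) xs (t : B → Carrier) →
    sum (map f xs) t ≡ sum xs (t ∘ f)
  sum-map f xs t = cong (foldr _+_ 0#) (≡.sym (List.map-∘ xs))

  module _ {a b} {A : Set a} {B : Set b} where

    sum-swap : ∀ (xs : List A) (ys : List B) (t : A → B → Carrier) →
               sum xs (λ x → sum ys (t x)) ≈ sum ys (λ y → sum xs (λ x → t x y))
    sum-swap []       ys t = ≈-sym (sum-zero ys λ _ → ≈-refl)
    sum-swap (x ∷ xs) ys t = ≈-trans (+-congˡ (sum-swap xs ys t)) (≈-sym (sum-+ ys (t x) _))

    sum-cartesianProductWith : ∀ {c} {C : Set c} (f : A → B → C) xs ys (t : C → Carrier) →
      sum (cartesianProductWith f xs ys) t ≈ sum xs (λ x → sum ys (λ y → t (f x y)))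
    sum-cartesianProductWith f []       ys t = ≈-refl
    sum-cartesianProductWith f (x ∷ xs) ys t = ≈-trans (sum-++ (map (f x) ys) _ t)
      (+-cong (reflexive (sum-map (f x) ys t)) (sum-cartesianProductWith f xs ys t))

    sum-*-sum : ∀ (xs : List A) (ys : List B) (s : A → Carrier) (t : B → Carrier) →
      sum (cartesianProduct xs ys) (λ (x , y) → s x * t y) ≈ sum xs s * sum ys t
    sum-*-sum xs ys s t = ≈-trans (sum-cartesianProductWith _,_ xs ys _)
      (≈-trans (sum-cong xs λ x → ≈-sym (sum-*ˡ (s x) ys t)) (≈-sym (sum-*ʳ (sum ys t) xs s)))

  sum-upTo : ∀ n (t : ℕ → Carrier) → sum (upTo (suc n)) t ≡ t 0 + sum (upTo n) (t ∘ suc)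
  sum-upTo n t = cong (λ ys → t 0 + foldr _+_ 0# ys)
    (≡.trans (List.map-applyUpTo suc t n) (≡.sym (List.map-upTo (t ∘ suc) n)))

  -- Cauchy sums over pairs of exponents

  opaque
    -- The sum over i + j = n. It is opaque so that the arguments below run on its recursion
    -- equations and the underlying lists do not unfold.
    antidiagonal : ℕ → (ℕ → ℕ → Carrier) → Carrier
    antidiagonal n G = sum (upTo (suc n)) λ i → G i (n ∸ i)

    antidiagonal-cong : ∀ n {G H : ℕ → ℕ → Carrier} → (∀ i j → G i j ≈ H i j) →
      antidiagonal n G ≈ antidiagonal n H
    antidiagonal-cong n h = sum-cong (upTo (suc n)) λ i → h i (n ∸ i)

    antidiagonal-suc : ∀ n G → antidiagonal (suc n) G ≈ G 0 (suc n) + antidiagonal n (G ∘ suc)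
    antidiagonal-suc n G = reflexive (sum-upTo (suc n) _)

    antidiagonal-zero : ∀ G → antidiagonal 0 G ≈ G 0 0
    antidiagonal-zero G = +-identityʳ _

    antidiagonal-+ : ∀ n (G H : ℕ → ℕ → Carrier) →
                     antidiagonal n (λ i j → G i j + H i j) ≈ antidiagonal n G + antidiagonal n H
    antidiagonal-+ n G H = sum-+ (upTo (suc n)) _ _

  -- Splits off the last term where `antidiagonal-suc` splits off the first; reversing the order of
  -- summation in `antidiagonal-comm` exchanges the two.
  antidiagonal-sucʳ : ∀ n G →
    antidiagonal (suc n) G ≈ G (suc n) 0 + antidiagonal n (λ i j → G i (suc j))
  antidiagonal-sucʳ zero    G = begin
    antidiagonal 1 G                                ≈⟨ antidiagonal-suc 0 G ⟩
    G 0 1 + antidiagonal 0 (G ∘ suc)                ≈⟨ +-congˡ (antidiagonal-zero _) ⟩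
    G 0 1 + G 1 0                                   ≈⟨ +-comm _ _ ⟩
    G 1 0 + G 0 1                                   ≈⟨ +-congˡ (antidiagonal-zero _) ⟨
    G 1 0 + antidiagonal 0 (λ i j → G i (suc j))    ∎
  antidiagonal-sucʳ (suc n) G = begin
    antidiagonal (suc (suc n)) G
      ≈⟨ antidiagonal-suc (suc n) G ⟩
    G 0 (2 ℕ.+ n) + antidiagonal (suc n) (G ∘ suc)
      ≈⟨ +-congˡ (antidiagonal-sucʳ n (G ∘ suc)) ⟩
    G 0 (2 ℕ.+ n) + (G (2 ℕ.+ n) 0 + antidiagonal n (λ i j → G (suc i) (suc j)))
      ≈⟨ ≈-trans (≈-sym (+-assoc _ _ _)) (≈-trans (+-congʳ (+-comm _ _)) (+-assoc _ _ _)) ⟩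
    G (2 ℕ.+ n) 0 + (G 0 (2 ℕ.+ n) + antidiagonal n (λ i j → G (suc i) (suc j)))
      ≈⟨ +-congˡ (antidiagonal-suc n (λ i j → G i (suc j))) ⟨
    G (2 ℕ.+ n) 0 + antidiagonal (suc n) (λ i j → G i (suc j)) ∎

  antidiagonal-comm : ∀ n G → antidiagonal n G ≈ antidiagonal n (flip G)
  antidiagonal-comm zero    G = ≈-trans (antidiagonal-zero G) (≈-sym (antidiagonal-zero (flip G)))
  antidiagonal-comm (suc n) G = ≈-trans (antidiagonal-suc n G)
    (≈-trans (+-congˡ (antidiagonal-comm n (G ∘ suc))) (≈-sym (antidiagonal-sucʳ n (flip G))))

  -- Both sides run over j + l + r = n. The terms with j = 0 are split off, and the others form the
  -- same identity for n - 1 and a shifted F.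
  antidiagonal-assoc : ∀ n (F : ℕ → ℕ → ℕ → Carrier) →
    antidiagonal n (λ i r → antidiagonal i (λ j l → F j l r)) ≈
    antidiagonal n (λ j s → antidiagonal s (λ l r → F j l r))
  antidiagonal-assoc zero    F = ≈-trans (antidiagonal-zero _)
    (≈-trans (antidiagonal-zero _) (≈-sym (≈-trans (antidiagonal-zero _) (antidiagonal-zero _))))
  antidiagonal-assoc (suc n) F = begin
    antidiagonal (suc n) (λ i r → antidiagonal i (λ j l → F j l r))
      ≈⟨ antidiagonal-suc n _ ⟩
    antidiagonal 0 (λ j l → F j l (suc n)) +
      antidiagonal n (λ i r → antidiagonal (suc i) (λ j l → F j l r))
      ≈⟨ +-cong (antidiagonal-zero _) (antidiagonal-cong n λ i r → antidiagonal-suc i _) ⟩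
    F 0 0 (suc n) + antidiagonal n (λ i r → F 0 (suc i) r + antidiagonal i (λ j l → F (suc j) l r))
      ≈⟨ +-congˡ (antidiagonal-+ n _ _) ⟩
    F 0 0 (suc n) + (antidiagonal n (λ l r → F 0 (suc l) r) +
      antidiagonal n (λ i r → antidiagonal i (λ j l → F (suc j) l r)))
      ≈⟨ +-assoc _ _ _ ⟨
    F 0 0 (suc n) + antidiagonal n (λ l r → F 0 (suc l) r) +
      antidiagonal n (λ i r → antidiagonal i (λ j l → F (suc j) l r))
      ≈⟨ +-cong (≈-sym (antidiagonal-suc n (F 0))) (antidiagonal-assoc n (F ∘ suc)) ⟩
    antidiagonal (suc n) (F 0) + antidiagonal n (λ j s → antidiagonal s (λ l r → F (suc j) l r))
      ≈⟨ antidiagonal-suc n (λ j s → antidiagonal s (λ l r → F j l r)) ⟨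
    antidiagonal (suc n) (λ j s → antidiagonal s (λ l r → F j l r)) ∎

  opaque
    unfolding antidiagonal

    splitSum : ∀ {k} (e : Exponent k) → (Exponent k → Exponent k → Carrier) → Carrier
    splitSum e G = sum (box e) λ a → G a (e ⊟ a)

    splitSum-cong : ∀ {k} (e : Exponent k) {G H : Exponent k → Exponent k → Carrier} →
                    (∀ a b → G a b ≈ H a b) → splitSum e G ≈ splitSum e H
    splitSum-cong e h = sum-cong (box e) λ a → h a (e ⊟ a)

    splitSum-∷ : ∀ {k} d (m : Exponent k) G →
      splitSum (d ∷ m) G ≈ antidiagonal d (λ i j → splitSum m (λ a b → G (i ∷ a) (j ∷ b)))
    splitSum-∷ d m G = sum-cartesianProductWith _∷_ (upTo (suc d)) (box m) _

    splitSum-[] : ∀ G → splitSum [] G ≈ G [] []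
    splitSum-[] G = +-identityʳ _

    splitSum-antidiagonal : ∀ {k} d (m : Exponent k)
      (G : Exponent k → Exponent k → ℕ → ℕ → Carrier) →
      splitSum m (λ a b → antidiagonal d (G a b)) ≈
      antidiagonal d (λ i j → splitSum m (λ a b → G a b i j))
    splitSum-antidiagonal d m G = sum-swap (box m) (upTo (suc d)) _

    splitSum≡sum : ∀ {k} (e : Exponent k) G → splitSum e G ≡ sum (box e) (λ a → G a (e ⊟ a))
    splitSum≡sum e G = refl

    antidiagonal≡sum : ∀ n G → antidiagonal n G ≡ sum (upTo (suc n)) (λ i → G i (n ∸ i))
    antidiagonal≡sum n G = refl

  splitSum-comm : ∀ {k} (e : Exponent k) G → splitSum e G ≈ splitSum e (flip G)
  splitSum-comm []      G = ≈-trans (splitSum-[] G) (≈-sym (splitSum-[] (flip G)))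
  splitSum-comm (d ∷ m) G = begin
    splitSum (d ∷ m) G
      ≈⟨ splitSum-∷ d m G ⟩
    antidiagonal d (λ i j → splitSum m (λ a b → G (i ∷ a) (j ∷ b)))
      ≈⟨ antidiagonal-cong d (λ i j → splitSum-comm m _) ⟩
    antidiagonal d (λ i j → splitSum m (λ a b → G (i ∷ b) (j ∷ a)))
      ≈⟨ antidiagonal-comm d _ ⟩
    antidiagonal d (λ i j → splitSum m (λ a b → G (j ∷ b) (i ∷ a)))
      ≈⟨ splitSum-∷ d m (flip G) ⟨
    splitSum (d ∷ m) (flip G) ∎

  -- Induction on the number of coordinates: the sums over first coordinates are moved outside by
  -- `splitSum-antidiagonal`, where `antidiagonal-assoc` applies, and then moved back.
  splitSum-assoc : ∀ {k} (e : Exponent k) (F : Exponent k → Exponent k → Exponent k → Carrier) →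
    splitSum e (λ a r → splitSum a (λ b c → F b c r)) ≈
    splitSum e (λ b s → splitSum s (λ c r → F b c r))
  splitSum-assoc []      F = ≈-trans (splitSum-[] _)
    (≈-trans (splitSum-[] _) (≈-sym (≈-trans (splitSum-[] _) (splitSum-[] _))))
  splitSum-assoc (d ∷ m) F = begin
    splitSum (d ∷ m) (λ a r → splitSum a (λ b c → F b c r))
      ≈⟨ splitSum-∷ d m _ ⟩
    antidiagonal d (λ i k → splitSum m (λ a r → splitSum (i ∷ a) (λ b c → F b c (k ∷ r))))
      ≈⟨ antidiagonal-cong d (λ i k → splitSum-cong m λ a r → splitSum-∷ i a _) ⟩
    antidiagonal d (λ i k → splitSum m (λ a r → antidiagonal i (λ j l →
      splitSum a (λ b c → F (j ∷ b) (l ∷ c) (k ∷ r)))))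
      ≈⟨ antidiagonal-cong d (λ i k → splitSum-antidiagonal i m _) ⟩
    antidiagonal d (λ i k → antidiagonal i (λ j l → splitSum m (λ a r →
      splitSum a (λ b c → F (j ∷ b) (l ∷ c) (k ∷ r)))))
      ≈⟨ antidiagonal-cong d (λ i k → antidiagonal-cong i λ j l → splitSum-assoc m _) ⟩
    antidiagonal d (λ i k → antidiagonal i (λ j l → splitSum m (λ b s →
      splitSum s (λ c r → F (j ∷ b) (l ∷ c) (k ∷ r)))))
      ≈⟨ antidiagonal-assoc d _ ⟩
    antidiagonal d (λ j t → antidiagonal t (λ l k → splitSum m (λ b s →
      splitSum s (λ c r → F (j ∷ b) (l ∷ c) (k ∷ r)))))
      ≈⟨ antidiagonal-cong d (λ j t → splitSum-antidiagonal t m _) ⟨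
    antidiagonal d (λ j t → splitSum m (λ b s → antidiagonal t (λ l k →
      splitSum s (λ c r → F (j ∷ b) (l ∷ c) (k ∷ r)))))
      ≈⟨ antidiagonal-cong d (λ j t → splitSum-cong m λ b s → splitSum-∷ t s _) ⟨
    antidiagonal d (λ j t → splitSum m (λ b s → splitSum (t ∷ s) (λ c r → F (j ∷ b) c r)))
      ≈⟨ splitSum-∷ d m _ ⟨
    splitSum (d ∷ m) (λ b s → splitSum s (λ c r → F b c r)) ∎

  []·-cong : ∀ {p q} {P : Set p} {Q : Set q} (P? : Dec P) (Q? : Dec Q) {x y : Carrier} →
             (P → Q) → (Q → P) → (P → x ≈ y) → [ P? ]· x ≈ [ Q? ]· y
  []·-cong (yes p) (yes _) to from x≈y = x≈y p
  []·-cong (yes p) (no ¬q) to from x≈y = contradiction (to p) ¬q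
  []·-cong (no ¬p) (yes q) to from x≈y = contradiction (from q) ¬p
  []·-cong (no _)  (no _)  to from x≈y = ≈-refl

  []·-yes : ∀ {p} {P : Set p} (P? : Dec P) {x : Carrier} → P → [ P? ]· x ≈ x
  []·-yes (yes _) p = ≈-refl
  []·-yes (no ¬p) p = contradiction p ¬p

  []·-no : ∀ {p} {P : Set p} (P? : Dec P) {x : Carrier} → ¬ P → [ P? ]· x ≈ 0#
  []·-no (yes p) ¬p = contradiction p ¬p
  []·-no (no _)  ¬p = ≈-refl

  module _ {a} {A : Set a} where

    sum-partition : ∀ {p} {P : A → Set p} (P? : Unary.Decidable P) (xs : List A) (t : A → Carrier) →
                    sum xs t ≈ sum (filter P? xs) t + sum (filter (¬? ∘ P?) xs) t
    sum-partition P? []       t = ≈-sym (+-identityˡ 0#)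
    sum-partition P? (x ∷ xs) t with P? x
    ... | yes _ = ≈-trans (+-congˡ (sum-partition P? xs t)) (≈-sym (+-assoc _ _ _))
    ... | no  _ = begin
      t x + sum xs t
        ≈⟨ +-congˡ (sum-partition P? xs t) ⟩
      t x + (sum (filter P? xs) t + sum (filter (¬? ∘ P?) xs) t)   ≈⟨ x∙yz≈y∙xz (t x) _ _ ⟩
      sum (filter P? xs) t + (t x + sum (filter (¬? ∘ P?) xs) t)   ∎

    sum-unique : ∀ {p} {P : A → Set p} (P? : Unary.Decidable P) {xs : List A} (c : Carrier) →
                 AllPairs (λ x y → P x → ¬ P y) xs → Any P xs → sum xs (λ x → [ P? x ]· c) ≈ c
    sum-unique P? c (apart ∷ _) (here {x} {xs} px) = ≈-trans
      (+-cong ([]·-yes (P? x) px) (sum-zero xs λ {y} y∈ → []·-no (P? y) (All.lookup apart y∈ px)))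
      (+-identityʳ c)
    sum-unique P? c (apart ∷ distinct) (there {x} any) = ≈-trans
      (+-cong ([]·-no (P? x) λ px → All.lookupWith (λ ¬py py → ¬py px py) apart any)
              (sum-unique P? c distinct any))
      (+-identityˡ c)

    sum-concatMap : ∀ {b} {B : Set b} (f : B → List A) xs (t : A → Carrier) →
                    sum (concatMap f xs) t ≈ sum xs (λ x → sum (f x) t)
    sum-concatMap f []       t = ≈-refl
    sum-concatMap f (x ∷ xs) t = ≈-trans (sum-++ (f x) (concatMap f xs) t)
      (+-congˡ (sum-concatMap f xs t))

  -- Both sides are sums over the pairs related by _∼_.
  sum-matching : ∀ {a b p} {A : Set a} {B : Set b} {_∼_ : A → B → Set p}
    (_∼?_ : ∀ x y → Dec (x ∼ y))
    (xs : List A) (ys : List B) {s : A → Carrier} {t : B → Carrier} →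
    (∀ {x y} → x ∈ xs → y ∈ ys → x ∼ y → s x ≈ t y) →
    (∀ x → AllPairs (λ y y′ → x ∼ y → ¬ x ∼ y′) ys) →
    (∀ y → AllPairs (λ x x′ → x ∼ y → ¬ x′ ∼ y) xs) →
    (∀ {x} → x ∈ xs → s x ≈ 0# ⊎ Any (x ∼_) ys) →
    (∀ {y} → y ∈ ys → t y ≈ 0# ⊎ Any (_∼ y) xs) →
    sum xs s ≈ sum ys t
  sum-matching {_∼_ = _∼_} _∼?_ xs ys {s} {t} s≈t uniqueʳ uniqueˡ existsʳ existsˡ = begin
    sum xs s
      ≈⟨ sum-cong-∈ xs (λ x∈ → ≈-sym (left x∈ (existsʳ x∈))) ⟩
    sum xs (λ x → sum ys (λ y → [ x ∼? y ]· s x))  ≈⟨ sum-cong-∈ xs (λ x∈ → sum-cong-∈ ys λ y∈ →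
                                                        []·-cong (_ ∼? _) (_ ∼? _) id id
                                                          (s≈t x∈ y∈)) ⟩
    sum xs (λ x → sum ys (λ y → [ x ∼? y ]· t y))  ≈⟨ sum-swap xs ys _ ⟩
    sum ys (λ y → sum xs (λ x → [ x ∼? y ]· t y))  ≈⟨ sum-cong-∈ ys (λ y∈ → right y∈ (existsˡ y∈)) ⟩
    sum ys t                                       ∎
    where
    [_]·0 : ∀ {P : Set _} (P? : Dec P) {c} → c ≈ 0# → [ P? ]· c ≈ 0#
    [ yes _ ]·0 c≈0 = c≈0
    [ no _  ]·0 c≈0 = ≈-refl

    left : ∀ {x} → x ∈ xs → s x ≈ 0# ⊎ Any (x ∼_) ys → sum ys (λ y → [ x ∼? y ]· s x) ≈ s x
    left {x} _ (inj₁ z)   = ≈-trans (sum-zero ys λ _ → [ _ ∼? _ ]·0 z) (≈-sym z)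
    left {x} _ (inj₂ any) = sum-unique (x ∼?_) (s x) (uniqueʳ x) any

    right : ∀ {y} → y ∈ ys → t y ≈ 0# ⊎ Any (_∼ y) xs → sum xs (λ x → [ x ∼? y ]· t y) ≈ t y
    right {y} _ (inj₁ z)   = ≈-trans (sum-zero xs λ _ → [ _ ∼? _ ]·0 z) (≈-sym z)
    right {y} _ (inj₂ any) = sum-unique (_∼? y) (t y) (uniqueˡ y) any

-- The Möbius function

module SquarefreeFactorizations {c ℓ} (D : FactorizationDomain c ℓ)
  (prime : FactorizationDomain.IrreduciblesPrime D)
  (_∣?_ : Decidable (FactorizationDomain._∣_ D))
  where
  open FactorizationDomain D

  private
    ∤1 : ∀ {p} → Irreducible p → ¬ p ∣ 1#
    ∤1 (mkIrred p∤1 _) = p∤1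

  ∥-*ˡ : ∀ {x y} z → x ∥ y → z * x ∥ z * y
  ∥-*ˡ z (x∣y , y∣x) = x∣y⇒zx∣zy z x∣y , x∣y⇒zx∣zy z y∣x

  ∣-cancelˡ : ∀ {z x y} → z ≉ 0# → z * x ∣ z * y → x ∣ y
  ∣-cancelˡ {z} {x} z≉0 (w , wzx≈zy) = w , *-cancelˡ z≉0 (≈-trans
    (solve 3 (λ z w x → z :* (w :* x) := w :* (z :* x)) ≈-refl z w x) wzx≈zy)

  ∥-cancelˡ : ∀ {z x y} → z ≉ 0# → z * x ∥ z * y → x ∥ y
  ∥-cancelˡ z≉0 (p , r) = ∣-cancelˡ z≉0 p , ∣-cancelˡ z≉0 r

  irreducible-∣⇒∥ : ∀ {p r} → Irreducible p → Irreducible r → p ∣ r → p ∥ r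
  irreducible-∣⇒∥ {p} {r} (mkIrred p∤1 _) (mkIrred _ split) p∣r@(w , wp≈r) with split (≈-sym wp≈r)
  ... | inj₁ w∣1 = p∣r , unit-cancel w∣1 (1# , ≈-trans (*-identityˡ r) (≈-sym wp≈r))
  ... | inj₂ p∣1 = contradiction p∣1 p∤1

  product : List Carrier → Carrier
  product = foldr _*_ 1#

  product-≉0 : ∀ {ps} → All Irreducible ps → product ps ≉ 0#
  product-≉0 []           = 1≉0
  product-≉0 (irr ∷ irrs) = *≉0 (irreducible-≉0 irr) (product-≉0 irrs)

  Distinct : List Carrier → Set (c ⊔ˡ ℓ)
  Distinct = AllPairs (λ p r → ¬ p ∥ r)

  record SquarefreeFactorization (h : Carrier) (ps : List Carrier) : Set (c ⊔ˡ ℓ) where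
    constructor factorization
    field
      irreducible : All Irreducible ps
      distinct    : Distinct ps
      associate   : h ∥ product ps

  ∤-product : ∀ {p ps} → Irreducible p → All Irreducible ps → All (λ r → ¬ p ∥ r) ps →
    ¬ p ∣ product ps
  ∤-product irr []           []             p∣1 = ∤1 irr p∣1
  ∤-product irr (ir ∷ irrs) (p∦r ∷ p∦ps) p∣rΠ with prime irr _ _ p∣rΠ
  ... | inj₁ p∣r = p∦r (irreducible-∣⇒∥ irr ir p∣r)
  ... | inj₂ p∣Π = ∤-product irr irrs p∦ps p∣Π

  -- The effect of deleting from `ps` the one associate of p. That `rest` is a sublist is recorded
  -- by the field `all`, in the form in which it is applied.
  record Removal (p : Carrier) (ps : List Carrier) : Set (lsuc (c ⊔ˡ ℓ)) where
    field
      rest        : List Carrier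
      length-rest : length ps ≡ suc (length rest)
      associate   : product ps ∥ p * product rest
      distinct    : Distinct rest
      removed     : All (λ r → ¬ p ∥ r) rest
      all         : ∀ {Q : Carrier → Set (c ⊔ˡ ℓ)} → All Q ps → All Q rest

  remove : ∀ {p ps} → Irreducible p → All Irreducible ps → Distinct ps → p ∣ product ps →
    Removal p ps
  remove {ps = []} irr [] [] p∣1 = contradiction p∣1 (∤1 irr)
  remove {p} {r ∷ ps} irr (ir ∷ irrs) (r∦ps ∷ distinct) p∣rΠ with p ∣? r
  ... | yes p∣r = record
    { rest = ps ; length-rest = refl ; distinct = distinct
    ; associate = ∣-*-mono (proj₂ p∥r) , ∣-*-mono p∣r
    ; removed = All.map (λ r∦s p∥s → r∦s (∥-trans (∥-sym p∥r) p∥s)) r∦ps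
    ; all = All.tail }
    where
    p∥r : p ∥ r
    p∥r = irreducible-∣⇒∥ irr ir p∣r
    ∣-*-mono : ∀ {x y} → x ∣ y → x * product ps ∣ y * product ps
    ∣-*-mono x∣y = x∣ʳy⇒xz∣ʳyz (product ps) x∣y
  ... | no p∤r with prime irr _ _ p∣rΠ
  ...   | inj₁ p∣r = contradiction p∣r p∤r
  ...   | inj₂ p∣Π = record
    { rest = r ∷ R.rest ; length-rest = cong suc R.length-rest
    ; associate = ∣ʳ-respʳ-≈ commute (proj₁ r*) , ∣ʳ-respˡ-≈ commute (proj₂ r*)
    ; distinct = R.all r∦ps ∷ R.distinct
    ; removed = (p∤r ∘ proj₁) ∷ R.removed
    ; all = λ { (q ∷ qs) → q ∷ R.all qs } }
    where
    module R = Removal (remove irr irrs distinct p∣Π)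
    r* : r * product ps ∥ r * (p * product R.rest)
    r* = ∥-*ˡ r R.associate
    commute : r * (p * product R.rest) ≈ p * (r * product R.rest)
    commute = solve 3 (λ x y z → x :* (y :* z) := y :* (x :* z)) ≈-refl r p (product R.rest)

  -- The part of unique factorization on which the sign of μ depends. The head of `ps` divides the
  -- product of `qs`, so it is deleted there and cancelled on both sides.
  length-unique : ∀ {ps qs} → All Irreducible ps → All Irreducible qs → Distinct qs →
                  product ps ∥ product qs → length ps ≡ length qs
  length-unique {[]} {[]}    _  _ _ _ = refl
  length-unique {[]} {q ∷ qs} [] (irr ∷ _) _ (_ , qΠ∣1) =
    contradiction (∣ʳ-trans (∣-*ʳ (product qs) ∣ʳ-refl) qΠ∣1) (∤1 irr)
  length-unique {p ∷ ps} {qs} (irr ∷ irrs) irrqs distinct (pΠ∣Πqs , Πqs∣pΠ) =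
    ≡.trans (cong suc (length-unique irrs (R.all irrqs) R.distinct
      (∥-cancelˡ (irreducible-≉0 irr)
        (∣ʳ-trans pΠ∣Πqs (proj₁ R.associate) , ∣ʳ-trans (proj₂ R.associate) Πqs∣pΠ))))
      (≡.sym R.length-rest)
    where
    module R = Removal (remove irr irrqs distinct (∣ʳ-trans (∣-*ʳ (product ps) ∣ʳ-refl) pΠ∣Πqs))

  factorization-length : ∀ {h ps qs} → SquarefreeFactorization h ps → SquarefreeFactorization h qs →
                         length ps ≡ length qs
  factorization-length (factorization irr _ (a , b)) (factorization irr′ distinct (c , d)) =
    length-unique irr irr′ distinct (∣ʳ-trans b c , ∣ʳ-trans d a)

  factorization-∥ : ∀ {f g ps} → f ∥ g → SquarefreeFactorization f ps → SquarefreeFactorization g ps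
  factorization-∥ (f∣g , g∣f) (factorization irr distinct (a , b)) =
    factorization irr distinct (∣ʳ-trans g∣f a , ∣ʳ-trans b f∣g)

  factorization-* : ∀ {p h ps} → Irreducible p → ¬ p ∣ h → SquarefreeFactorization h ps →
                    SquarefreeFactorization (p * h) (p ∷ ps)
  factorization-* {p} {h} {ps} irr p∤h (factorization irrs distinct h∥Π) =
    factorization (irr ∷ irrs)
    (apart ps (λ p∣Π → p∤h (∣ʳ-trans p∣Π (proj₂ h∥Π))) ∷ distinct) (∥-*ˡ p h∥Π)
    where
    apart : ∀ ps → ¬ p ∣ product ps → All (λ r → ¬ p ∥ r) ps
    apart []       _     = []
    apart (r ∷ ps) p∤rΠ =
      (λ (p∣r , _) → p∤rΠ (∣-*ʳ (product ps) p∣r)) ∷ apart ps (p∤rΠ ∘ x∣ʳy⇒x∣ʳzy r)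

  factorization-*⁻ : ∀ {p h qs} → Irreducible p → SquarefreeFactorization (p * h) qs →
                     ∃ λ ps → SquarefreeFactorization h ps × All (λ r → ¬ p ∥ r) ps
  factorization-*⁻ {p} {h} {qs} irr (factorization irrs distinct (ph∣Π , Π∣ph)) =
    R.rest , factorization (R.all irrs) R.distinct (∥-cancelˡ (irreducible-≉0 irr)
      (∣ʳ-trans ph∣Π (proj₁ R.associate) , ∣ʳ-trans (proj₂ R.associate) Π∣ph)) , R.removed
    where module R = Removal (remove irr irrs distinct (∣ʳ-trans (∣-*ʳ h ∣ʳ-refl) ph∣Π))

  -- The specification from which all properties of μ are derived. The computed μ depends on
  -- whichever factorization a search returns, and `factorization-length` removes this dependence.
  MöbiusValue : Carrier → ℤ → Set (c ⊔ˡ ℓ)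
  MöbiusValue h z = (∃ λ ps → SquarefreeFactorization h ps × z ≡ -1ℤ ℤ.^ length ps) ⊎
                    ((∀ ps → ¬ SquarefreeFactorization h ps) × z ≡ 0ℤ)

  module MöbiusFunction (μ : Carrier → ℤ) (value : ∀ h → MöbiusValue h (μ h)) where

    μ-factorization : ∀ {h ps} → SquarefreeFactorization h ps → μ h ≡ -1ℤ ℤ.^ length ps
    μ-factorization {h} sf with value h
    ... | inj₁ (_ , sf′ , eq) = ≡.trans eq (cong (-1ℤ ℤ.^_) (factorization-length sf′ sf))
    ... | inj₂ (none , _)     = contradiction sf (none _)

    μ-none : ∀ {h} → (∀ ps → ¬ SquarefreeFactorization h ps) → μ h ≡ 0ℤ
    μ-none {h} none with value h
    ... | inj₁ (ps , sf , _) = contradiction sf (none ps)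
    ... | inj₂ (_ , eq)      = eq

    μ-∥ : ∀ {f g} → f ∥ g → μ f ≡ μ g
    μ-∥ {f} {g} f∥g with value f
    ... | inj₁ (_ , sf , eq) = ≡.trans eq (≡.sym (μ-factorization (factorization-∥ f∥g sf)))
    ... | inj₂ (none , eq)   = ≡.trans eq
        (≡.sym (μ-none λ ps → none ps ∘ factorization-∥ (∥-sym f∥g)))

    μ-unit : ∀ {h} → h ∣ 1# → μ h ≡ 1ℤ
    μ-unit h∣1 = μ-factorization (factorization [] [] (h∣1 , ε∣ʳ _))

    μ-* : ∀ {p h} → Irreducible p → ¬ p ∣ h → μ (p * h) ≡ ℤ.- μ h
    μ-* {p} {h} irr p∤h with value h
    ... | inj₁ (ps , sf , eq) = ≡.trans (μ-factorization (factorization-* irr p∤h sf))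
            (≡.trans (ℤ.-1*i≡-i _) (cong ℤ.-_ (≡.sym eq)))
    ... | inj₂ (none , eq)    = ≡.trans
            (μ-none λ qs sf → let ps , sf′ , _ = factorization-*⁻ irr sf in none ps sf′)
            (cong ℤ.-_ (≡.sym eq))

    -- Deleting p from a square-free factorization of p h leaves factors of h none of which is an
    -- associate of p, although p still divides their product.
    μ-square : ∀ {p h} → Irreducible p → p ∣ h → μ (p * h) ≡ 0ℤ
    μ-square irr p∣h = μ-none λ qs sf →
      let ps , factorization irrs _ h∥Π , p∦ps = factorization-*⁻ irr sf
      in ∤-product irr irrs p∦ps (∣ʳ-trans p∣h (proj₁ h∥Π))

    ∣μ∣≤1 : ∀ h → ℤ.∣ μ h ∣ ℕ.≤ 1
    ∣μ∣≤1 h with value h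
    ... | inj₁ (ps , _ , eq) rewrite eq = power (length ps)
      where
      power : ∀ n → ℤ.∣ -1ℤ ℤ.^ n ∣ ℕ.≤ 1
      power zero    = ℕ.s≤s ℕ.z≤n
      power (suc n) rewrite ℤ.-1*i≡-i (-1ℤ ℤ.^ n) | ℤ.∣-i∣≡∣i∣ (-1ℤ ℤ.^ n) = power n
    ... | inj₂ (_ , eq) rewrite eq = ℕ.z≤n

-- Counting coprime pairs

-- All that the counting identity needs from polynomials. The size of `𝒩` is left open here; it is
-- estimated only for the error term.
record GradedDomain (c ℓ : Level) (k : ℕ) : Set (lsuc (c ⊔ˡ ℓ)) where
  infix 4 _∣?_
  field
    domain : FactorizationDomain c ℓ
  open FactorizationDomain domain public
  field
    irreduciblesPrime : IrreduciblesPrime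
    _∣?_       : Decidable _∣_
    Deg        : Carrier → Exponent k → Set ℓ
    deg        : ∀ {f} → f ≉ 0# → ∃ (Deg f)
    deg-≉0     : ∀ {f d} → Deg f d → f ≉ 0#
    deg-unique : ∀ {f d e} → Deg f d → Deg f e → d ≡ e
    deg-∥      : ∀ {f g d} → f ∥ g → Deg f d → Deg g d
    deg-*      : ∀ {f g d e} → Deg f d → Deg g e → Deg (f * g) (d ⊞ e)
    𝒩          : Exponent k → List Carrier
    𝒩-deg      : ∀ {m f} → f ∈ 𝒩 m → Deg f m
    𝒩-complete : ∀ {m f} → Deg f m → Any (f ∥_) (𝒩 m)
    𝒩-distinct : ∀ m → AllPairs (λ f g → ¬ f ∥ g) (𝒩 m)

module Counting {c ℓ k} (G : GradedDomain c ℓ k) where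
  open GradedDomain G
  open import Data.Integer.Base using (+_)
  open SquarefreeFactorizations domain irreduciblesPrime _∣?_ using
    (∥-*ˡ; ∥-cancelˡ; MöbiusValue; module MöbiusFunction)

  ≈⇒∥ : ∀ {x y} → x ≈ y → x ∥ y
  ≈⇒∥ x≈y = ∣ʳ-respʳ-≈ x≈y ∣ʳ-refl , ∣ʳ-respʳ-≈ (≈-sym x≈y) ∣ʳ-refl

  _∥?_ : Decidable _∥_
  f ∥? g = (f ∣? g) ×-dec (g ∣? f)

  [a⊞b]⊟b≡a : ∀ {j} (a b : Exponent j) → (a ⊞ b) ⊟ b ≡ a
  [a⊞b]⊟b≡a []      []      = refl
  [a⊞b]⊟b≡a (x ∷ a) (y ∷ b) = cong₂ _∷_ (ℕ.m+n∸n≡m x y) ([a⊞b]⊟b≡a a b)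

  deg-∣ : ∀ {z f d m} → z ∣ f → Deg z d → Deg f m → ∃ λ w → w * z ≈ f × Deg w (m ⊟ d) × d ≼ m
  deg-∣ {z} {f} {d} {m} (w , wz≈f) dz df
    with e , dw ← deg (proj₁ (≉0-factors (deg-≉0 df) (≈-sym wz≈f)))
    with refl ← deg-unique df (deg-∥ (≈⇒∥ wz≈f) (deg-* dw dz))
    = w , wz≈f , subst (Deg w) (≡.sym ([a⊞b]⊟b≡a e d)) dw , b≼a⊞b e d

  module _ {r ℓ′} (R : CommutativeSemiring r ℓ′) where
    private module R = CommutativeSemiring R
    open ListSum R

    -- Division by h, up to associates: the quotient of two chosen representatives need not be a
    -- chosen representative, so the two lists are compared through a matching and not through a
    -- map.
    sum-multiples : ∀ {h d} m → Deg h d → d ≼ m →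
                    sum (𝒩 m) (λ f → [ h ∣? f ]· R.1#) R.≈ sum (𝒩 (m ⊟ d)) (const R.1#)
    sum-multiples {h} {d} m dh d≼m = sum-matching (λ f w → f ∥? (h * w)) (𝒩 m) (𝒩 (m ⊟ d))
      (λ {f} _ _ (_ , hw∣f) → []·-yes (h ∣? f) (∣ʳ-trans (∣-*ʳ _ ∣ʳ-refl) hw∣f))
      (λ f → AllPairs.map (λ w∦w′ f∥hw f∥hw′ →
        w∦w′ (∥-cancelˡ (deg-≉0 dh) (∥-trans (∥-sym f∥hw) f∥hw′))) (𝒩-distinct _))
      (λ w → AllPairs.map (λ f∦f′ f∥hw f′∥hw → f∦f′ (∥-trans f∥hw (∥-sym f′∥hw))) (𝒩-distinct _))
      quotient
      (λ {w} w∈ → inj₂ (Any.map ∥-sym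
        (𝒩-complete (subst (Deg (h * w)) (a⊞[e⊟a]≡e d≼m) (deg-* dh (𝒩-deg w∈))))))
      where
      quotient : ∀ {f} → f ∈ 𝒩 m → [ h ∣? f ]· R.1# R.≈ R.0# ⊎ Any (λ w → f ∥ h * w) (𝒩 (m ⊟ d))
      quotient {f} f∈ with h ∣? f
      ... | no _    = inj₁ R.refl
      ... | yes h∣f with w , wh≈f , dw , _ ← deg-∣ h∣f dh (𝒩-deg f∈) =
        inj₂ (Any.map (λ w∥w′ → ∥-trans (f∥hw w wh≈f) (∥-*ˡ h w∥w′)) (𝒩-complete dw))
        where
        f∥hw : ∀ w → w * h ≈ f → f ∥ h * w
        f∥hw w wh≈f = ≈⇒∥ (≈-trans (≈-sym wh≈f) (*-comm w h))

  module _ (t : Exponent k) where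

    divisors : List Carrier
    divisors = concatMap 𝒩 (box t)

    ∈-divisors⁺ : ∀ {z d} → Deg z d → d ≼ t → Any (z ∥_) divisors
    ∈-divisors⁺ dz d≼t with h , h∈ , z∥h ← find (𝒩-complete dz) =
      lose (∈-concatMap⁺ 𝒩 (lose (∈-box⁺ d≼t) h∈)) z∥h

    divisors-distinct : AllPairs (λ f g → ¬ f ∥ g) divisors
    divisors-distinct = AllPairs.concat⁺ (All.map⁺ (All.universal 𝒩-distinct (box t)))
      (AllPairs.map⁺ (AllPairs.map (λ d≢e → All.tabulate λ f∈ → All.tabulate λ g∈ f∥g →
        d≢e (deg-unique (deg-∥ f∥g (𝒩-deg f∈)) (𝒩-deg g∈))) (box-unique t)))

  open ListSum ℤ.+-*-commutativeSemiring
  private module ∑ℕ = ListSum ℕ.+-*-commutativeSemiring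

  -- The common divisors of f and g are paired as h and p h, for an irreducible
  -- common divisor p; the square-free ones cancel and the others contribute 0.
  module _ (μ : Carrier → ℤ) (value : ∀ h → MöbiusValue h (μ h)) (coprime? : Decidable Coprime)
    (t : Exponent k) where
    open MöbiusFunction μ value

    common? : ∀ f g h → Dec (h ∣ f × h ∣ g)
    common? f g h = (h ∣? f) ×-dec (h ∣? g)

    truncatedSum : Carrier → Carrier → ℤ
    truncatedSum f g = sum (divisors t) λ h → [ common? f g h ]· μ h

    module _ {f g} (f≉0 : f ≉ 0#) (small : ∀ {z d} → z ∣ f → z ∣ g → Deg z d → d ≼ t) where

      divisor-degree : ∀ {z} → z ∣ f → ∃ (Deg z)
      divisor-degree (w , wz≈f) = deg (proj₂ (≉0-factors f≉0 (≈-sym wz≈f)))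

      representative : ∀ {z} → z ∣ f → z ∣ g → Any (z ∥_) (divisors t)
      representative z∣f z∣g = ∈-divisors⁺ t (proj₂ (divisor-degree z∣f))
        (small z∣f z∣g (proj₂ (divisor-degree z∣f)))

      -- All common divisors are units, and the class of units has exactly one representative in
      -- `divisors t`. The sum is therefore matched with a sum over the single element `1#`.
      truncatedSum-coprime : Coprime f g → truncatedSum f g ≡ 1ℤ
      truncatedSum-coprime coprime = sum-matching (λ h o → h ∥? o) (divisors t) (1# ∷ [])
        (λ { {h} _ (here refl) (h∣1 , _) →
          ≡.trans ([]·-yes (common? f g h) (∣ʳ-trans h∣1 (ε∣ʳ f) , ∣ʳ-trans h∣1 (ε∣ʳ g)))
            (μ-unit h∣1) })
        (λ _ → [] ∷ [])
        (λ _ → AllPairs.map (λ h∦h′ h∥o h′∥o → h∦h′ (∥-trans h∥o (∥-sym h′∥o)))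
          (divisors-distinct t))
        (λ {h} _ → unit-only h)
        (λ { (here refl) → inj₂ (Any.map ∥-sym (representative (ε∣ʳ f) (ε∣ʳ g))) })
        where
        unit-only : ∀ h → [ common? f g h ]· μ h ≡ 0ℤ ⊎ Any (h ∥_) (1# ∷ [])
        unit-only h with common? f g h
        ... | no _            = inj₁ refl
        ... | yes (h∣f , h∣g) = inj₂ (here (coprime h∣f h∣g , ε∣ʳ h))

      -- The hypothesis is a bare negation. A witness comes from the finite list `divisors t`, which
      -- represents every common divisor and so must contain a common nonunit; the first factor of
      -- its factorization is p.
      common-irreducible : ¬ Coprime f g → ∃ λ p → Irreducible p × p ∣ f × p ∣ g
      common-irreducible ¬coprime
        with Any.any? (λ h → common? f g h ×-dec ¬? (h ∣? 1#)) (divisors t)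
      ... | no none = contradiction (λ {z} z∣f z∣g → decidable-stable (z ∣? 1#) λ z∤1 →
              none (Any.map (λ (z∣h , h∣z) → (∣ʳ-trans h∣z z∣f , ∣ʳ-trans h∣z z∣g) , λ h∣1 →
                z∤1 (∣ʳ-trans z∣h h∣1))
                (representative z∣f z∣g))) ¬coprime
      ... | yes any with h , _ , (h∣f , h∣g) , h∤1 ← find any
        with factored (deg-≉0 (proj₂ (divisor-degree h∣f)))
      ...   | unit h∣1 = contradiction h∣1 h∤1
      ...   | step {p = p} {w} irr _ h≈pw = p , irr , ∣ʳ-trans p∣h h∣f , ∣ʳ-trans p∣h h∣g
        where p∣h = ∣ʳ-respʳ-≈ (≈-sym h≈pw) (∣-*ʳ w ∣ʳ-refl)

      module _ {p} (irr : Irreducible p) (p∣f : p ∣ f) (p∣g : p ∣ g) where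

        with-p without-p : List Carrier
        with-p    = filter (p ∣?_) (divisors t)
        without-p = filter (¬? ∘ (p ∣?_)) (divisors t)

        *-common : ∀ {h x} → ¬ p ∣ h → p ∣ x → h ∣ x → p * h ∣ x
        *-common {h} {x} p∤h p∣x (w , wh≈x) with irreduciblesPrime irr w h
          (∣ʳ-respʳ-≈ (≈-sym wh≈x) p∣x)
        ... | inj₁ (v , vp≈w) = v , ≈-trans (≈-sym (*-assoc v p h)) (≈-trans (*-congʳ vp≈w) wh≈x)
        ... | inj₂ p∣h        = contradiction p∣h p∤h

        μ-common : Carrier → ℤ
        μ-common h = [ common? f g h ]· μ h

        cancelling : sum without-p μ-common ≡ sum with-p (ℤ.-_ ∘ μ-common)
        cancelling = sum-matching (λ h h′ → h′ ∥? (p * h)) without-p with-p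
          (λ {h} {h′} h∈ h′∈ → compatible h h′ (proj₂ (∈-filter⁻ _ {xs = divisors t} h∈)))
          (λ h → AllPairs.map (λ x∦y x∥ y∥ → x∦y (∥-trans x∥ (∥-sym y∥)))
            (AllPairs.filter⁺ _ (divisors-distinct t)))
          (λ h′ → AllPairs.map (λ x∦y ∥x ∥y →
            x∦y (∥-cancelˡ (irreducible-≉0 irr) (∥-trans (∥-sym ∥x) ∥y)))
            (AllPairs.filter⁺ _ (divisors-distinct t)))
          (λ {h} h∈ → multiple h (proj₂ (∈-filter⁻ _ {xs = divisors t} h∈)))
          (λ {h′} h′∈ → quotient h′ (proj₂ (∈-filter⁻ _ {xs = divisors t} h′∈)))
          where
          compatible : ∀ h h′ → ¬ p ∣ h → h′ ∥ p * h → μ-common h ≡ ℤ.- μ-common h′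
          compatible h h′ p∤h h′∥ph@(h′∣ph , ph∣h′) with common? f g h | common? f g h′
          ... | yes _           | yes _ =
              ≡.sym (≡.trans (cong ℤ.-_ (≡.trans (μ-∥ h′∥ph) (μ-* irr p∤h)))
                (ℤ.neg-involutive (μ h)))
          ... | no _            | no _  = refl
          ... | yes (h∣f , h∣g) | no ¬common = contradiction
                  (∣ʳ-trans h′∣ph (*-common p∤h p∣f h∣f) , ∣ʳ-trans h′∣ph (*-common p∤h p∣g h∣g))
                    ¬common
          ... | no ¬common      | yes (h′∣f , h′∣g) = contradiction
                  (∣ʳ-trans h∣h′ h′∣f , ∣ʳ-trans h∣h′ h′∣g) ¬common
            where h∣h′ = ∣ʳ-trans (x∣ʳyx h p) ph∣h′

          multiple : ∀ h → ¬ p ∣ h → μ-common h ≡ 0ℤ ⊎ Any (λ h′ → h′ ∥ p * h) with-p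
          multiple h p∤h with common? f g h
          ... | no _ = inj₁ refl
          ... | yes (h∣f , h∣g) with h′ , h′∈ , ph∥h′ ← find
              (representative (*-common p∤h p∣f h∣f) (*-common p∤h p∣g h∣g)) =
            inj₂ (lose (∈-filter⁺ (p ∣?_) h′∈ (∣ʳ-trans (∣-*ʳ h ∣ʳ-refl) (proj₁ ph∥h′)))
              (∥-sym ph∥h′))

          quotient : ∀ h′ → p ∣ h′ → ℤ.- μ-common h′ ≡ 0ℤ ⊎ Any (λ h → h′ ∥ p * h) without-p
          quotient h′ (w , wp≈h′) with common? f g h′ | p ∣? w
          ... | no _            | _       = inj₁ refl
          -- Here h′ is divisible by the square of p, so its term vanishes and it needs no partner.
          ... | yes _           | yes p∣w =
              inj₁ (cong ℤ.-_ (≡.trans (μ-∥ (≈⇒∥ h′≈pw)) (μ-square irr p∣w)))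
            where h′≈pw = ≈-trans (≈-sym wp≈h′) (*-comm w p)
          ... | yes (h′∣f , h′∣g) | no p∤w =
            let w∣h′ = ∣ʳ-respʳ-≈ wp≈h′ (∣-*ʳ p ∣ʳ-refl)
                h , h∈ , w∥h = find (representative (∣ʳ-trans w∣h′ h′∣f) (∣ʳ-trans w∣h′ h′∣g))
            in inj₂ (lose (∈-filter⁺ _ h∈ λ p∣h → p∤w (∣ʳ-trans p∣h (proj₂ w∥h)))
                 (∥-trans (≈⇒∥ (≈-trans (≈-sym wp≈h′) (*-comm w p))) (∥-*ˡ p w∥h)))

        truncatedSum-noncoprime : truncatedSum f g ≡ 0ℤ
        truncatedSum-noncoprime = begin
          truncatedSum f g
            ≡⟨ sum-partition (p ∣?_) (divisors t) _ ⟩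
          sum with-p μ-common ℤ.+ sum without-p μ-common
            ≡⟨ cong (λ z → sum with-p μ-common ℤ.+ z) cancelling ⟩
          sum with-p μ-common ℤ.+ sum with-p (ℤ.-_ ∘ μ-common)      ≡⟨ sum-+ with-p μ-common _ ⟨
          sum with-p (λ h → μ-common h ℤ.+ ℤ.- μ-common h)
            ≡⟨ sum-zero with-p (λ {h} _ → ℤ.+-inverseʳ (μ-common h)) ⟩
          0ℤ                                                        ∎
          where open ≡.≡-Reasoning

      truncatedSum-exact : truncatedSum f g ≡ [ coprime? f g ]· 1ℤ
      truncatedSum-exact with coprime? f g
      ... | yes coprime = truncatedSum-coprime coprime
      ... | no ¬coprime with p , irr , p∣f , p∣g ← common-irreducible ¬coprime =
        truncatedSum-noncoprime irr p∣f p∣g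

    module _ (m n : Exponent k) (t≼m : t ≼ m) (t≼n : t ≼ n) where

      pairs : List (Carrier × Carrier)
      pairs = cartesianProduct (𝒩 m) (𝒩 n)

      main : ℤ
      main = sum (box t) λ d → + length (𝒩 (m ⊟ d)) ℤ.* + length (𝒩 (n ⊟ d)) ℤ.* sum (𝒩 d) μ

      large : List (Exponent k)
      large = filter (λ d → (d ≼? n) ×-dec ¬? (d ≼? t)) (box m)

      +length : ∀ {a} {A : Set a} (xs : List A) → + length xs ≡ sum xs (const 1ℤ)
      +length []       = refl
      +length (x ∷ xs) = cong (ℤ._+_ 1ℤ) (+length xs)

      length≡sum : ∀ {a} {A : Set a} (xs : List A) → length xs ≡ ∑ℕ.sum xs (const 1)
      length≡sum []       = refl
      length≡sum (x ∷ xs) = cong suc (length≡sum xs)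

      common-indicator : ∀ f g h x → [ h ∣? f ]· 1ℤ ℤ.* [ h ∣? g ]· 1ℤ ℤ.* x ≡ [ common? f g h ]· x
      common-indicator f g h x with h ∣? f | h ∣? g
      ... | yes _ | yes _ = ℤ.*-identityˡ x
      ... | yes _ | no _  = refl
      ... | no _  | yes _ = refl
      ... | no _  | no _  = refl

      main≡sum-truncatedSum : main ≡ sum pairs (uncurry truncatedSum)
      main≡sum-truncatedSum = begin
        main
          ≡⟨ sum-cong-∈ (box t) (λ {d} d∈ →
               ≡.trans (sum-*ˡ (+ length (𝒩 (m ⊟ d)) ℤ.* + length (𝒩 (n ⊟ d))) (𝒩 d) μ)
               (sum-cong-∈ (𝒩 d) λ {h} h∈ → per-divisor d h (∈-box⁻ t d∈) (𝒩-deg h∈))) ⟩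
        sum (box t) (λ d → sum (𝒩 d) λ h → sum pairs λ (f , g) → [ common? f g h ]· μ h)
          ≡⟨ sum-concatMap 𝒩 (box t) _ ⟨
        sum (divisors t) (λ h → sum pairs λ (f , g) → [ common? f g h ]· μ h)
          ≡⟨ sum-swap (divisors t) pairs _ ⟩
        sum pairs (uncurry truncatedSum) ∎
        where
        open ≡.≡-Reasoning
        per-divisor : ∀ d h → d ≼ t → Deg h d →
          + length (𝒩 (m ⊟ d)) ℤ.* + length (𝒩 (n ⊟ d)) ℤ.* μ h ≡
          sum pairs (λ (f , g) → [ common? f g h ]· μ h)
        per-divisor d h d≼t dh = begin
          + length (𝒩 (m ⊟ d)) ℤ.* + length (𝒩 (n ⊟ d)) ℤ.* μ h
            ≡⟨ cong (ℤ._* μ h) (cong₂ ℤ._*_ (multiples m (≼-trans d≼t t≼m))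
                 (multiples n (≼-trans d≼t t≼n))) ⟩
          sum (𝒩 m) (λ f → [ h ∣? f ]· 1ℤ) ℤ.* sum (𝒩 n) (λ g → [ h ∣? g ]· 1ℤ) ℤ.* μ h
            ≡⟨ cong (ℤ._* μ h) (sum-*-sum (𝒩 m) (𝒩 n) _ _) ⟨
          sum pairs (λ (f , g) → [ h ∣? f ]· 1ℤ ℤ.* [ h ∣? g ]· 1ℤ) ℤ.* μ h
            ≡⟨ sum-*ʳ (μ h) pairs _ ⟩
          sum pairs (λ (f , g) → [ h ∣? f ]· 1ℤ ℤ.* [ h ∣? g ]· 1ℤ ℤ.* μ h)
            ≡⟨ sum-cong pairs (λ (f , g) → common-indicator f g h (μ h)) ⟩
          sum pairs (λ (f , g) → [ common? f g h ]· μ h) ∎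
          where
          multiples : ∀ m → d ≼ m → + length (𝒩 (m ⊟ d)) ≡ sum (𝒩 m) (λ f → [ h ∣? f ]· 1ℤ)
          multiples m d≼m = ≡.trans (+length (𝒩 (m ⊟ d)))
            (≡.sym (sum-multiples ℤ.+-*-commutativeSemiring m dh d≼m))

      -- If this is 0, all common divisors have degree at most t; for every other pair it is at
      -- least 1, so its sum over all pairs bounds the number of exceptional ones. The product of
      -- two brackets lets the sum over pairs factor.
      largeDivisors : Carrier → Carrier → ℕ
      largeDivisors f g = ∑ℕ.sum large λ d → ∑ℕ.sum (𝒩 d) λ h →
        ∑ℕ.[ h ∣? f ]· 1 ℕ.* ∑ℕ.[ h ∣? g ]· 1

      sum-largeDivisors : ∑ℕ.sum pairs (uncurry largeDivisors) ≡
        ∑ℕ.sum large (λ d → length (𝒩 d) ℕ.* (length (𝒩 (m ⊟ d)) ℕ.* length (𝒩 (n ⊟ d))))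
      sum-largeDivisors = begin
        ∑ℕ.sum pairs (uncurry largeDivisors)
          ≡⟨ ∑ℕ.sum-swap pairs large _ ⟩
        ∑ℕ.sum large (λ d → ∑ℕ.sum pairs λ (f , g) → ∑ℕ.sum (𝒩 d) λ h →
          ∑ℕ.[ h ∣? f ]· 1 ℕ.* ∑ℕ.[ h ∣? g ]· 1)
          ≡⟨ ∑ℕ.sum-cong large (λ d → ∑ℕ.sum-swap pairs (𝒩 d) _) ⟩
        ∑ℕ.sum large (λ d → ∑ℕ.sum (𝒩 d) λ h → ∑ℕ.sum pairs λ (f , g) →
          ∑ℕ.[ h ∣? f ]· 1 ℕ.* ∑ℕ.[ h ∣? g ]· 1)
          ≡⟨ ∑ℕ.sum-cong-∈ large (λ {d} d∈ → let d∈m , d≼n , _ = ∈-filter⁻ _ {xs = box m} d∈ in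
               ∑ℕ.sum-cong-∈ (𝒩 d) λ {h} h∈ → ≡.trans (∑ℕ.sum-*-sum (𝒩 m) (𝒩 n) _ _)
                 (≡.trans (cong₂ ℕ._*_ (multiples m h d (𝒩-deg h∈) (∈-box⁻ m d∈m))
                   (multiples n h d (𝒩-deg h∈) d≼n))
                   (≡.sym (ℕ.*-identityˡ _)))) ⟩
        ∑ℕ.sum large (λ d → ∑ℕ.sum (𝒩 d) λ h → 1 ℕ.* (length (𝒩 (m ⊟ d)) ℕ.* length (𝒩 (n ⊟ d))))
          ≡⟨ ∑ℕ.sum-cong large (λ d → let N = length (𝒩 (m ⊟ d)) ℕ.* length (𝒩 (n ⊟ d)) in
               ≡.trans (≡.sym (∑ℕ.sum-*ʳ N (𝒩 d) (const 1)))
                 (cong (ℕ._* N) (≡.sym (length≡sum (𝒩 d))))) ⟩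
        ∑ℕ.sum large (λ d → length (𝒩 d) ℕ.* (length (𝒩 (m ⊟ d)) ℕ.* length (𝒩 (n ⊟ d)))) ∎
        where
        open ≡.≡-Reasoning
        multiples : ∀ m h d → Deg h d → d ≼ m →
          ∑ℕ.sum (𝒩 m) (λ f → ∑ℕ.[ h ∣? f ]· 1) ≡ length (𝒩 (m ⊟ d))
        multiples m h d dh d≼m = ≡.trans (sum-multiples ℕ.+-*-commutativeSemiring m dh d≼m)
          (≡.sym (length≡sum (𝒩 (m ⊟ d))))

      ∣sum∣≤ : ∀ {a} {A : Set a} (xs : List A) {s : A → ℤ} {b : A → ℕ} →
               (∀ {x} → x ∈ xs → ℤ.∣ s x ∣ ≤ b x) → ℤ.∣ sum xs s ∣ ≤ ∑ℕ.sum xs b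
      ∣sum∣≤ []       h = z≤n
      ∣sum∣≤ (x ∷ xs) {s} h = ℕ.≤-trans (ℤ.∣i+j∣≤∣i∣+∣j∣ (s x) (sum xs s))
        (ℕ.+-mono-≤ (h (here refl)) (∣sum∣≤ xs {s} (h ∘ there)))

      term≤sum : ∀ {a} {A : Set a} {xs : List A} {x} (b : A → ℕ) → x ∈ xs → b x ≤ ∑ℕ.sum xs b
      term≤sum b (here refl) = ℕ.m≤m+n _ _
      term≤sum b (there x∈)  = ℕ.≤-trans (term≤sum b x∈) (ℕ.m≤n+m _ _)

      largeDivisors≡0⇒small : ∀ {f g} → Deg f m → Deg g n → largeDivisors f g ≡ 0 →
                              ∀ {z d} → z ∣ f → z ∣ g → Deg z d → d ≼ t
      largeDivisors≡0⇒small {f} {g} df dg none {z} {d} z∣f z∣g dz =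
        decidable-stable (d ≼? t) λ d⋠t →
        let _ , _ , _ , d≼m = deg-∣ z∣f dz df
            _ , _ , _ , d≼n = deg-∣ z∣g dz dg
            h , h∈ , z∥h = find (𝒩-complete dz)
        in ℕ.<⇒≱ (ℕ.≤-reflexive (≡.sym
            (indicator h (∣ʳ-trans (proj₂ z∥h) z∣f) (∣ʳ-trans (proj₂ z∥h) z∣g))))
             (ℕ.≤-trans (term≤sum (λ h → ∑ℕ.[ h ∣? f ]· 1 ℕ.* ∑ℕ.[ h ∣? g ]· 1) h∈)
               (ℕ.≤-trans (term≤sum _ (∈-filter⁺ _ (∈-box⁺ d≼m) (d≼n , d⋠t))) (ℕ.≤-reflexive none)))
        where
        indicator : ∀ h → h ∣ f → h ∣ g → ∑ℕ.[ h ∣? f ]· 1 ℕ.* ∑ℕ.[ h ∣? g ]· 1 ≡ 1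
        indicator h h∣f h∣g = cong₂ ℕ._*_ (∑ℕ.[]·-yes (h ∣? f) h∣f) (∑ℕ.[]·-yes (h ∣? g) h∣g)

      -- Without large common divisors the left side is 0. With one, the crude bound suffices: the
      -- indicator contributes at most 1 and every element of `divisors t` at most 1, because |μ| ≤
      -- 1.
      pair-error : ∀ {f g} → Deg f m → Deg g n →
        ℤ.∣ [ coprime? f g ]· 1ℤ ℤ.- truncatedSum f g ∣ ≤
        suc (length (divisors t)) ℕ.* largeDivisors f g
      pair-error {f} {g} df dg = bound _ refl
        where
        bound : ∀ l → largeDivisors f g ≡ l →
                ℤ.∣ [ coprime? f g ]· 1ℤ ℤ.- truncatedSum f g ∣ ≤ suc (length (divisors t)) ℕ.* l
        bound zero    none = ℕ.≤-trans (ℕ.≤-reflexive (cong ℤ.∣_∣ (ℤ.i≡j⇒i-j≡0 (≡.sym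
          (truncatedSum-exact (deg-≉0 df) (largeDivisors≡0⇒small df dg none)))))) z≤n
        bound (suc l) _    = ℕ.≤-trans (ℕ.≤-trans (ℤ.∣i-j∣≤∣i∣+∣j∣ ([ coprime? f g ]· 1ℤ) _)
          (ℕ.+-mono-≤ coprime≤1 (ℕ.≤-trans
            (∣sum∣≤ (divisors t) {λ h → [ common? f g h ]· μ h} {b = const 1} λ {h} _ → term≤1 h)
            (ℕ.≤-reflexive (≡.sym (length≡sum (divisors t))))))) (ℕ.m≤m*n _ (suc l))
          where
          coprime≤1 : ℤ.∣ [ coprime? f g ]· 1ℤ ∣ ≤ 1
          coprime≤1 with coprime? f g
          ... | yes _ = ℕ.≤-refl
          ... | no _  = z≤n
          term≤1 : ∀ h → ℤ.∣ [ common? f g h ]· μ h ∣ ≤ 1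
          term≤1 h with common? f g h
          ... | yes _ = ∣μ∣≤1 h
          ... | no _  = z≤n

      coprime-pairs-error :
        ℤ.∣ + length (filter (uncurry coprime?) pairs) ℤ.- main ∣ ≤ suc (length (divisors t)) ℕ.*
          ∑ℕ.sum large (λ d → length (𝒩 d) ℕ.* (length (𝒩 (m ⊟ d)) ℕ.* length (𝒩 (n ⊟ d))))
      coprime-pairs-error = begin
        ℤ.∣ + length (filter (uncurry coprime?) pairs) ℤ.- main ∣
          ≡⟨ cong ℤ.∣_∣ difference ⟩
        ℤ.∣ sum pairs (λ (f , g) → [ coprime? f g ]· 1ℤ ℤ.- truncatedSum f g) ∣
          ≤⟨ ∣sum∣≤ pairs (λ { {f , g} fg∈ → let f∈ , g∈ = ∈-cartesianProduct⁻ (𝒩 m) (𝒩 n) fg∈ in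
               pair-error (𝒩-deg f∈) (𝒩-deg g∈) }) ⟩
        ∑ℕ.sum pairs (λ (f , g) → suc (length (divisors t)) ℕ.* largeDivisors f g)
          ≡⟨ ∑ℕ.sum-*ˡ (suc (length (divisors t))) pairs (uncurry largeDivisors) ⟨
        suc (length (divisors t)) ℕ.* ∑ℕ.sum pairs (uncurry largeDivisors)
          ≡⟨ cong (suc (length (divisors t)) ℕ.*_) sum-largeDivisors ⟩
        suc (length (divisors t)) ℕ.*
          ∑ℕ.sum large (λ d → length (𝒩 d) ℕ.* (length (𝒩 (m ⊟ d)) ℕ.* length (𝒩 (n ⊟ d)))) ∎
        where
        open ℕ.≤-Reasoning
        sum-neg : ∀ (xs : List (Carrier × Carrier)) (s : Carrier × Carrier → ℤ) →
          ℤ.- sum xs s ≡ sum xs (ℤ.-_ ∘ s)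
        sum-neg xs s = ≡.trans (≡.sym (ℤ.-1*i≡-i _))
          (≡.trans (sum-*ˡ ℤ.-1ℤ xs s) (sum-cong xs λ x → ℤ.-1*i≡-i (s x)))

        difference : + length (filter (uncurry coprime?) pairs) ℤ.- main ≡
                     sum pairs (λ (f , g) → [ coprime? f g ]· 1ℤ ℤ.- truncatedSum f g)
        difference = ≡.trans
          (cong₂ ℤ._-_ (≡.trans (+length (filter (uncurry coprime?) pairs))
            (sum-filter (uncurry coprime?) pairs (const 1ℤ))) main≡sum-truncatedSum)
          (≡.trans (cong (λ z → sum pairs (λ p → [ uncurry coprime? p ]· 1ℤ) ℤ.+ z)
            (sum-neg pairs (uncurry truncatedSum)))
            (≡.sym (sum-+ pairs _ _)))

open import Defs hiding (_∣_; Coprime; Irreducible; mkIrred)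

-- Polynomial rings over a finite field

module PolynomialRing {c ℓ : Level} {q : ℕ} (𝔽 : FiniteField c ℓ q) where
  private
    module F = FiniteField 𝔽
  open FiniteField 𝔽 using (Carrier)
  open Polynomial
  open ListSum F.commutativeSemiring

  ∑≡sum : ∀ {a} {A : Set a} (xs : List A) (t : A → Carrier) → ∑ 𝔽 xs t ≡ sum xs t
  ∑≡sum []       t = refl
  ∑≡sum (x ∷ xs) t = cong (t x F.+_) (∑≡sum xs t)

  private
    infix  4 _≋_
    infixl 6 _⊕_
    infixl 7 _⊛_

    _≋_ : ∀ {k} → Polynomial 𝔽 k → Polynomial 𝔽 k → Set ℓ
    _≋_ = _≈ᴾ_ 𝔽

    _⊕_ _⊛_ : ∀ {k} → Polynomial 𝔽 k → Polynomial 𝔽 k → Polynomial 𝔽 k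
    _⊕_ = _+ᴾ_ 𝔽
    _⊛_ = _*ᴾ_ 𝔽

  coeff-* : ∀ {k} (f g : Polynomial 𝔽 k) e →
            coeff (f ⊛ g) e F.≈ splitSum e (λ a b → coeff f a F.* coeff g b)
  coeff-* f g e = F.reflexive (≡.trans (∑≡sum (box e) _) (≡.sym (splitSum≡sum e _)))

  negᴾ : ∀ {k} → Polynomial 𝔽 k → Polynomial 𝔽 k
  negᴾ f = record
    { coeff  = λ e → F.- coeff f e
    ; bound  = bound f
    ; vanish = λ e e⋠ → F.trans (F.-‿cong (vanish f e e⋠)) -0≈0
    }
    where
    open import Algebra.Properties.Ring F.ring using () renaming (-0#≈0# to -0≈0)

  *ᴾ-comm : ∀ {k} (f g : Polynomial 𝔽 k) → f ⊛ g ≋ g ⊛ f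
  *ᴾ-comm f g e = F.trans (coeff-* f g e) (F.trans (splitSum-comm e _)
    (F.trans (splitSum-cong e λ a b → F.*-comm _ _) (F.sym (coeff-* g f e))))

  splitSum-*ˡ : ∀ {k} c (e : Exponent k) G → c F.* splitSum e G F.≈ splitSum e (λ a b → c F.* G a b)
  splitSum-*ˡ c e G = F.trans (F.*-congˡ (F.reflexive (splitSum≡sum e G)))
    (F.trans (sum-*ˡ c (box e) _) (F.sym (F.reflexive (splitSum≡sum e _))))

  splitSum-*ʳ : ∀ {k} c (e : Exponent k) G → splitSum e G F.* c F.≈ splitSum e (λ a b → G a b F.* c)
  splitSum-*ʳ c e G = F.trans (F.*-congʳ (F.reflexive (splitSum≡sum e G)))
    (F.trans (sum-*ʳ c (box e) _) (F.sym (F.reflexive (splitSum≡sum e _))))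

  splitSum-+ : ∀ {k} (e : Exponent k) G H →
    splitSum e (λ a b → G a b F.+ H a b) F.≈ splitSum e G F.+ splitSum e H
  splitSum-+ e G H = F.trans (F.reflexive (splitSum≡sum e _)) (F.trans (sum-+ (box e) _ _)
    (F.sym (F.+-cong (F.reflexive (splitSum≡sum e G)) (F.reflexive (splitSum≡sum e H)))))

  *ᴾ-assoc : ∀ {k} (f g h : Polynomial 𝔽 k) →
             (f ⊛ g) ⊛ h ≋ f ⊛ (g ⊛ h)
  *ᴾ-assoc f g h e = begin
    coeff ((f ⊛ g) ⊛ h) e
      ≈⟨ coeff-* (f ⊛ g) h e ⟩
    splitSum e (λ a r → coeff (f ⊛ g) a F.* coeff h r)
      ≈⟨ splitSum-cong e (λ a r → F.trans (F.*-congʳ (coeff-* f g a)) (splitSum-*ʳ _ a _)) ⟩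
    splitSum e (λ a r → splitSum a (λ b c → coeff f b F.* coeff g c F.* coeff h r))
      ≈⟨ splitSum-assoc e _ ⟩
    splitSum e (λ b s → splitSum s (λ c r → coeff f b F.* coeff g c F.* coeff h r))
      ≈⟨ splitSum-cong e (λ b s → splitSum-cong s λ c r → F.*-assoc _ _ _) ⟩
    splitSum e (λ b s → splitSum s (λ c r → coeff f b F.* (coeff g c F.* coeff h r)))
      ≈⟨ splitSum-cong e (λ b s → F.trans (F.*-congˡ (coeff-* g h s)) (splitSum-*ˡ _ s _)) ⟨
    splitSum e (λ b s → coeff f b F.* coeff (g ⊛ h) s)
      ≈⟨ coeff-* f (g ⊛ h) e ⟨
    coeff (f ⊛ (g ⊛ h)) e ∎
    where open import Relation.Binary.Reasoning.Setoid F.setoid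

  *ᴾ-identityˡ : ∀ {k} (f : Polynomial 𝔽 k) → 1ᴾ 𝔽 ⊛ f ≋ f
  *ᴾ-identityˡ f e = F.trans
    (*ᴾ-cong 𝔽 (1ᴾ 𝔽) (_·_ 𝔽 F.1# (1ᴾ 𝔽)) f f (λ e → F.sym (F.*-identityˡ _)) (≈ᴾ-refl 𝔽 f) e)
    (F.trans (constant-* 𝔽 F.1# f e) (F.*-identityˡ _))

  *ᴾ-distribˡ-+ : ∀ {k} (f g h : Polynomial 𝔽 k) →
                  f ⊛ (g ⊕ h) ≋ f ⊛ g ⊕ f ⊛ h
  *ᴾ-distribˡ-+ f g h e = F.trans (coeff-* f (g ⊕ h) e)
    (F.trans (splitSum-cong e λ a b → F.distribˡ _ _ _)
    (F.trans (splitSum-+ e _ _) (F.sym (F.+-cong (coeff-* f g e) (coeff-* f h e)))))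

  polynomialRing : ℕ → CommutativeRing (c ⊔ˡ ℓ) ℓ
  polynomialRing k = record
    { Carrier = Polynomial 𝔽 k ; _≈_ = _≈ᴾ_ 𝔽 ; _+_ = _+ᴾ_ 𝔽 ; _*_ = _*ᴾ_ 𝔽
    ; -_ = negᴾ ; 0# = 0ᴾ 𝔽 ; 1# = 1ᴾ 𝔽
    ; isCommutativeRing = record
      { isRing = record
        { +-isAbelianGroup = record
          { isGroup = record
            { isMonoid = record
              { isSemigroup = record
                { isMagma = record
                  { isEquivalence = record
                    { refl  = λ e → F.refl
                    ; sym   = λ p e → F.sym (p e)
                    ; trans = λ p r e → F.trans (p e) (r e)
                    }
                  ; ∙-cong = λ p r e → F.+-cong (p e) (r e)
                  }
                ; assoc = λ f g h e → F.+-assoc _ _ _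
                }
              ; identity = (λ f e → F.+-identityˡ _) , (λ f e → F.+-identityʳ _)
              }
            ; inverse = (λ f e → F.-‿inverseˡ _) , (λ f e → F.-‿inverseʳ _)
            ; ⁻¹-cong = λ p e → F.-‿cong (p e)
            }
          ; comm = λ f g e → F.+-comm _ _
          }
        ; *-cong = λ {f} {f′} {g} {g′} → *ᴾ-cong 𝔽 f f′ g g′
        ; *-assoc = *ᴾ-assoc
        ; *-identity = *ᴾ-identityˡ , λ f e → F.trans (*ᴾ-comm f (1ᴾ 𝔽) e) (*ᴾ-identityˡ f e)
        ; distrib = *ᴾ-distribˡ-+ , λ f g h e → F.trans (*ᴾ-comm (g ⊕ h) f e)
            (F.trans (*ᴾ-distribˡ-+ f g h e) (F.+-cong (*ᴾ-comm f g e) (*ᴾ-comm f h e)))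
        }
      ; *-comm = *ᴾ-comm
      }
    }

  -- Degrees and existence of factorizations

  module _ {k : ℕ} where
    open CommutativeRing (polynomialRing k) using (_≈_; _*_; 0#; 1#; _≉_)
    open SemiringDefinitions (polynomials 𝔽 k) using (_∣_; Irreducible; mkIrred)
    open MagmaDefinitions (RawSemiring.*-rawMagma (polynomials 𝔽 k)) using (_,_)
    open CommutativeRing (polynomialRing k) using () renaming
      (refl to ≈-refl; sym to ≈-sym; trans to ≈-trans)

    nonzero⁺ : ∀ {f} → f ≉ 0# → Nonzero 𝔽 f
    nonzero⁺ {f} f≉0 = [ (λ nz → nz) , (λ z → contradiction z f≉0) ]′ (nonzero-or-zero 𝔽 f)

    nonzero⁻ : ∀ {f} → Nonzero 𝔽 f → f ≉ 0#
    nonzero⁻ {f} nz z = zero⇒¬nonzero 𝔽 f z nz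

    coeff-*-support : ∀ f g e → coeff (f * g) e F.≉ F.0# →
                      ∃ λ a → ∃ λ b → a ⊞ b ≡ e × coeff f a F.≉ F.0# × coeff g b F.≉ F.0#
    coeff-*-support f g e fge≉0 = witness
      where
      P? : ∀ a → Dec (coeff f a F.≉ F.0# × coeff g (e ⊟ a) F.≉ F.0#)
      P? a = ¬? (_≈?_ 𝔽 (coeff f a) F.0#) ×-dec ¬? (_≈?_ 𝔽 (coeff g (e ⊟ a)) F.0#)
      witness : ∃ λ a → ∃ λ b → a ⊞ b ≡ e × coeff f a F.≉ F.0# × coeff g b F.≉ F.0#
      witness with Any.any? P? (box e)
      ... | yes any = let a , a∈ , fa≉0 , gb≉0 = find any
                      in a , e ⊟ a , a⊞[e⊟a]≡e (∈-box⁻ e a∈) , fa≉0 , gb≉0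
      ... | no none = contradiction (∑-zero 𝔽 (box e) vanishing) fge≉0
        where
        vanishing : ∀ {a} → a ∈ box e → coeff f a F.* coeff g (e ⊟ a) F.≈ F.0#
        vanishing {a} a∈ with _≈?_ 𝔽 (coeff f a) F.0# | _≈?_ 𝔽 (coeff g (e ⊟ a)) F.0#
        ... | yes fa≈0 | _        = F.trans (F.*-congʳ fa≈0) (F.zeroˡ _)
        ... | no _     | yes gb≈0 = F.trans (F.*-congˡ gb≈0) (F.zeroʳ _)
        ... | no fa≉0  | no gb≉0  = contradiction (lose a∈ (fa≉0 , gb≉0)) none

    -- For additive weights w this treats the total degree, `w = Vec.sum`, and the partial degrees,
    -- `w = λ a → lookup a i`, in one argument through leading monomials.
    WeightedDegree : (Exponent k → ℕ) → Polynomial 𝔽 k → ℕ → Set ℓ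
    WeightedDegree w f d = (∃ λ e → coeff f e F.≉ F.0# × w e ≡ d) ×
      (∀ e → coeff f e F.≉ F.0# → w e ≤ d)

    module _ (w : Exponent k → ℕ) (w-⊞ : ∀ a b → w (a ⊞ b) ≡ w a ℕ.+ w b) where
      open LeadingMonomial 𝔽 w w-⊞

      weightedDegree-unique : ∀ {f g d e} → f ≈ g → WeightedDegree w f d → WeightedDegree w g e →
        d ≡ e
      weightedDegree-unique f≈g ((a , fa≉0 , refl) , f≤) ((b , gb≉0 , refl) , g≤) = ℕ.≤-antisym
        (g≤ a λ ga≈0 → fa≉0 (F.trans (f≈g a) ga≈0))
          (f≤ b λ fb≈0 → gb≉0 (F.trans (F.sym (f≈g b)) fb≈0))

      weightedDegree-leading : ∀ {f d} → WeightedDegree w f d → ∃ λ α → Leading f α × w α ≡ d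
      weightedDegree-leading {f} ((e , fe≉0 , we≡d) , f≤) with α , lα ← leading f (e , fe≉0) =
        α , lα , ℕ.≤-antisym (f≤ α (proj₁ lα)) (subst (_≤ w α) we≡d (key-max f α lα e fe≉0))

      weightedDegree : ∀ {f} → f ≉ 0# → ∃ (WeightedDegree w f)
      weightedDegree {f} f≉0 with α , lα ← leading f (nonzero⁺ {f} f≉0) =
        w α , (α , proj₁ lα , refl) , key-max f α lα

      weightedDegree-* : ∀ {f g d e} → WeightedDegree w f d → WeightedDegree w g e →
                         WeightedDegree w (f * g) (d ℕ.+ e)
      weightedDegree-* {f} {g} {d} {e} df dg
        with α , lα , refl ← weightedDegree-leading {f} df
           | β , lβ , refl ← weightedDegree-leading {g} dg
        = (α ⊞ β , product-leading f g α β lα lβ , w-⊞ α β) , upper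
        where
        upper : ∀ x → coeff (f * g) x F.≉ F.0# → w x ≤ w α ℕ.+ w β
        upper x fgx≉0 with a , b , refl , fa≉0 , gb≉0 ← coeff-*-support f g x fgx≉0 =
          subst (_≤ w α ℕ.+ w β) (≡.sym (w-⊞ a b)) (ℕ.+-mono-≤ (proj₂ df a fa≉0) (proj₂ dg b gb≉0))

    *-nonzero : ∀ {f g} → f ≉ 0# → g ≉ 0# → f * g ≉ 0#
    *-nonzero {f} {g} f≉0 g≉0 =
      let (e , fge≉0 , _) , _ = weightedDegree-* Vec.sum sum-⊞ {f} {g}
            (proj₂ (weightedDegree Vec.sum sum-⊞ {f} f≉0))
              (proj₂ (weightedDegree Vec.sum sum-⊞ {g} g≉0))
      in nonzero⁻ {f * g} (e , fge≉0)

    TotalDegree : Polynomial 𝔽 k → ℕ → Set ℓ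
    TotalDegree = WeightedDegree Vec.sum

    totalDegree : ∀ f → f ≉ 0# → ∃ (TotalDegree f)
    totalDegree f = weightedDegree Vec.sum sum-⊞ {f}

    totalDegree-* : ∀ f g {d e} → TotalDegree f d → TotalDegree g e → TotalDegree (f * g) (d ℕ.+ e)
    totalDegree-* f g = weightedDegree-* Vec.sum sum-⊞ {f} {g}

    totalDegree-unique : ∀ f g {d e} → f ≈ g → TotalDegree f d → TotalDegree g e → d ≡ e
    totalDegree-unique f g = weightedDegree-unique Vec.sum sum-⊞ {f} {g}

    nonunit-totalDegree : ∀ f → f ≉ 0# → ¬ f ∣ 1# → ∀ {d} → TotalDegree f d → 1 ≤ d
    nonunit-totalDegree f f≉0 f∤1 {suc _} _        = s≤s z≤n
    nonunit-totalDegree f f≉0 f∤1 {zero}  (_ , f≤) = contradiction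
      (λ a fa≉0 → sum≡0⇒𝟘 𝔽 {k} a (ℕ.n≤0⇒n≡0 (f≤ a fa≉0)))
      (nonunit-nonconstant 𝔽 f (nonzero⁺ {f} f≉0) f∤1)

    *-nonzero⁻ : ∀ f g h → f ≉ 0# → f ≈ g * h → g ≉ 0# × h ≉ 0#
    *-nonzero⁻ f g h f≉0 f≈gh =
      let ng , nh = factors-nonzero 𝔽 g h (nonzero-cong 𝔽 f (g * h) f≈gh (nonzero⁺ {f} f≉0))
      in nonzero⁻ {g} ng , nonzero⁻ {h} nh

    totalDegree-cofactor : ∀ f g h → f ≉ 0# → ¬ g ∣ 1# → f ≈ g * h →
                           ∀ {d e} → TotalDegree f d → TotalDegree h e → e < d
    totalDegree-cofactor f g h f≉0 g∤1 f≈gh {d} {e} df dh =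
      let g≉0 , h≉0 = *-nonzero⁻ f g h f≉0 f≈gh
          i , dg    = totalDegree g g≉0
      in subst (e <_) (≡.sym (totalDegree-unique f (g * h) f≈gh df (totalDegree-* g h dg dh)))
           (ℕ.+-monoˡ-≤ e (nonunit-totalDegree g g≉0 g∤1 dg))

    -- The support of a divisor is bounded by that of f, so a finite search decides whether an
    -- irreducible divisor exists. If there were none, f itself would be irreducible: in a splitting
    -- into two nonunits the second factor has smaller degree and, by induction, an irreducible
    -- divisor.
    irreducible-divisor : ∀ n f {d} → TotalDegree f d → d < n → f ≉ 0# → ¬ f ∣ 1# →
                          ∃ λ p → Irreducible p × p ∣ f
    irreducible-divisor (suc n) f {d} df (s≤s d≤n) f≉0 f∤1 = decide divisor?
      where
      IrreducibleDivisor : Polynomial 𝔽 k → Set (c ⊔ˡ ℓ)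
      IrreducibleDivisor p = Irreducible p × p ∣ f

      divisor? : Dec (∃ IrreducibleDivisor)
      divisor? = search 𝔽 IrreducibleDivisor (bound f)
        (λ p → irreducible? 𝔽 p ×-dec _∣?_ 𝔽 p f)
        (λ p r p≈r (irr , p∣f) → irreducible-cong 𝔽 p r p≈r irr , ∣-congˡ 𝔽 p r f p≈r p∣f)
        (λ { p (_ , (r , rp≈f)) → proj₂ (product-supported 𝔽 r p f rp≈f (nonzero⁺ {f} f≉0)) })

      decide : Dec (∃ IrreducibleDivisor) → ∃ IrreducibleDivisor
      decide (yes found) = found
      decide (no none)   = contradiction
        (f , mkIrred f∤1 (λ {x} {y} → split x y) , 1# , *ᴾ-identityˡ f) none
        where
        split : ∀ x y → f ≈ x * y → x ∣ 1# ⊎ y ∣ 1#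
        split x y f≈xy = decidable-stable (_∣?_ 𝔽 x 1# ⊎-dec _∣?_ 𝔽 y 1#) λ neither →
          let x≉0 , y≉0    = *-nonzero⁻ f x y f≉0 f≈xy
              e , dy       = totalDegree y y≉0
              p , irr , p∣y = irreducible-divisor n y dy
                (ℕ.<-≤-trans (totalDegree-cofactor f x y f≉0 (neither ∘ inj₁) f≈xy df dy) d≤n)
                y≉0 (neither ∘ inj₂)
          in none (p , irr , divides {p} {x} {y} p∣y f≈xy)
          where
          divides : ∀ {p x y} → p ∣ y → f ≈ x * y → p ∣ f
          divides {p} {x} {y} (r , rp≈y) f≈xy = x * r ,
            CR.trans {x * r * p} {x * (r * p)} {f} (*ᴾ-assoc x r p)
              (CR.trans {x * (r * p)} {x * y} {f} (CR.*-congˡ {x} {r * p} {y} rp≈y)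
                (CR.sym {f} {x * y} f≈xy))
            where module CR = CommutativeRing (polynomialRing k)

    polynomial-factored : ∀ n f {d} → TotalDegree f d → d < n → f ≉ 0# →
      Factored (polynomialRing k) f
    polynomial-factored (suc n) f {d} df (s≤s d≤n) f≉0 = decide (_∣?_ 𝔽 f 1#)
      where
      decide : Dec (f ∣ 1#) → Factored (polynomialRing k) f
      decide (yes f∣1) = unit f∣1
      decide (no f∤1)  = split (irreducible-divisor (suc n) f df (s≤s d≤n) f≉0 f∤1)
        where
        split : ∃ (λ p → Irreducible p × p ∣ f) → Factored (polynomialRing k) f
        split (p , irr , (h , hp≈f)) =
          let f≈ph : f ≈ p * h
              f≈ph e = F.trans (F.sym (hp≈f e)) (*ᴾ-comm h p e)
              h≉0 = proj₂ (*-nonzero⁻ f p h f≉0 f≈ph)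
              e , dh = totalDegree h h≉0
          in step irr (polynomial-factored n h dh
               (ℕ.<-≤-trans (totalDegree-cofactor f p h f≉0
                 (SemiringDefinitions.Irreducible.p∤1 irr) f≈ph df dh) d≤n) h≉0)
               f≈ph

  polynomialDomain : ℕ → FactorizationDomain (c ⊔ˡ ℓ) ℓ
  polynomialDomain k = record
    { commutativeRing = polynomialRing k
    ; 1≉0      = λ 1≈0 → zero⇒¬nonzero 𝔽 (1ᴾ 𝔽) 1≈0 (nonzero-1ᴾ 𝔽)
    ; _≈?_     = _≈ᴾ?_ 𝔽
    ; *≉0      = λ {f} {g} → *-nonzero {f = f} {g}
    ; factored = λ {f} f≉0 → polynomial-factored _ f (proj₂ (totalDegree f f≉0)) ℕ.≤-refl f≉0
    }

  -- Polynomials in k + 1 variables as polynomials in the first variable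

  sliceᴾ : ∀ {k} → ℕ → Polynomial 𝔽 (suc k) → Polynomial 𝔽 k
  sliceᴾ n f = record
    { coeff  = λ e → coeff f (n ∷ e)
    ; bound  = Vec.tail (bound f)
    ; vanish = λ e e⋠ → vanish f (n ∷ e) λ ne≼ → e⋠ (below (bound f) ne≼)
    }
    where
    below : ∀ {k n} {e : Exponent k} (b : Exponent (suc k)) → n ∷ e ≼ b → e ≼ Vec.tail b
    below (_ ∷ _) (_ ∷ e≼) = e≼

  -- The case `d = 0` embeds the coefficient ring and `d = 1`, `r = 1` is the variable, so that
  -- `slice-monomial-*` yields the product rules for both.
  monomialᴾ : ∀ {k} → ℕ → Polynomial 𝔽 k → Polynomial 𝔽 (suc k)
  monomialᴾ {k} d r = record { coeff = φ ; bound = d ∷ bound r ; vanish = out }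
    where
    φ : Exponent (suc k) → Carrier
    φ (n ∷ e) with n ℕ.≟ d
    ... | yes _ = coeff r e
    ... | no  _ = F.0#
    out : ∀ e → ¬ e ≼ d ∷ bound r → φ e F.≈ F.0#
    out (n ∷ e) e⋠ with n ℕ.≟ d
    ... | yes refl = vanish r e λ e≼ → e⋠ (ℕ.≤-refl ∷ e≼)
    ... | no  _    = F.refl

  module _ {k : ℕ} where
    private
      module S = FactorizationDomain (polynomialDomain (suc k))
      module R = FactorizationDomain (polynomialDomain k)

    monomial-slice : ∀ d r → sliceᴾ {k} d (monomialᴾ d r) R.≈ r
    monomial-slice d r e with d ℕ.≟ d
    ... | yes _  = F.refl
    ... | no d≢d = contradiction refl d≢d

    monomial-slice-≢ : ∀ {n d} r → n ≢ d → sliceᴾ {k} n (monomialᴾ d r) R.≈ R.0#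
    monomial-slice-≢ {n} {d} r n≢d e with n ℕ.≟ d
    ... | yes n≡d = contradiction n≡d n≢d
    ... | no _    = F.refl

    slice-1-0 : sliceᴾ {k} 0 S.1# R.≈ R.1#
    slice-1-0 e with e ≟ᵉ 𝟘 | (0 ∷ e) ≟ᵉ 𝟘
    ... | yes _    | yes _  = F.refl
    ... | no  _    | no _   = F.refl
    ... | yes refl | no ≢   = contradiction refl ≢
    ... | no  ≢    | yes eq = contradiction (cong Vec.tail eq) ≢

    slice-1-suc : ∀ n → sliceᴾ {k} (suc n) S.1# R.≈ R.0#
    slice-1-suc n e with (suc n ∷ e) ≟ᵉ 𝟘
    ... | no _ = F.refl

    slice-*-term : (f g : Polynomial 𝔽 (suc k)) → Exponent k → ℕ → ℕ → Carrier
    slice-*-term f g e i j = coeff (sliceᴾ i f R.* sliceᴾ j g) e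

    slice-* : ∀ n f g e → coeff (sliceᴾ n (f S.* g)) e F.≈ antidiagonal n (slice-*-term f g e)
    slice-* n f g e = F.trans (coeff-* f g (n ∷ e)) (F.trans (splitSum-∷ n e _)
      (antidiagonal-cong n λ i j → F.sym (coeff-* (sliceᴾ i f) (sliceᴾ j g) e)))

    -- The situation common to multiplication by a monomial and to the top coefficient of a product:
    -- a single term of the Cauchy sum survives.
    slice-*-single : ∀ d e f g → (∀ i j → i ℕ.+ j ≡ d ℕ.+ e → i ≢ d →
      sliceᴾ i f R.≈ R.0# ⊎ sliceᴾ j g R.≈ R.0#) →
                     sliceᴾ (d ℕ.+ e) (f S.* g) R.≈ sliceᴾ d f R.* sliceᴾ e g
    slice-*-single d e f g others x = F.trans (slice-* (d ℕ.+ e) f g x)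
      (F.trans (F.reflexive (≡.trans (antidiagonal≡sum (d ℕ.+ e) _)
        (≡.sym (∑≡sum (upTo (suc (d ℕ.+ e))) _))))
      (F.trans (∑-single 𝔽 (Unique.upTo⁺ (suc (d ℕ.+ e))) (∈-upTo⁺ (s≤s (ℕ.m≤m+n d e))) λ {i} i∈
        i≢d →
         vanishing i (d ℕ.+ e ∸ i) (others i (d ℕ.+ e ∸ i) (ℕ.m+[n∸m]≡n (ℕ.s≤s⁻¹ (∈-upTo⁻ i∈)))
           i≢d))
       (F.reflexive (cong (slice-*-term f g x d) (ℕ.m+n∸m≡n d e)))))
      where
      vanishing : ∀ i j → sliceᴾ i f R.≈ R.0# ⊎ sliceᴾ j g R.≈ R.0# →
        slice-*-term f g x i j F.≈ F.0#
      vanishing i j (inj₁ z) = F.trans (R.*-congʳ {sliceᴾ j g} {sliceᴾ i f} {R.0#} z x)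
        (R.zeroˡ (sliceᴾ j g) x)
      vanishing i j (inj₂ z) = F.trans (R.*-congˡ {sliceᴾ i f} {sliceᴾ j g} {R.0#} z x)
        (R.zeroʳ (sliceᴾ i f) x)

    slice-monomial-* : ∀ d n r f → sliceᴾ (d ℕ.+ n) (monomialᴾ d r S.* f) R.≈ r R.* sliceᴾ n f
    slice-monomial-* d n r f x = F.trans
      (slice-*-single d n (monomialᴾ d r) f (λ i j _ i≢d → inj₁ (monomial-slice-≢ r i≢d)) x)
      (R.*-congʳ {sliceᴾ n f} {sliceᴾ d (monomialᴾ d r)} {r} (monomial-slice d r) x)

    polynomialExtension : PolynomialExtension (polynomialDomain k) (polynomialDomain (suc k))
    polynomialExtension = record
      { ι = monomialᴾ 0
      ; X = monomialᴾ 1 R.1#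
      ; slice = sliceᴾ
      ; ext = λ { h (n ∷ e) → h n e }
      ; slice-cong = λ n f≈g e → f≈g (n ∷ e)
      ; slice-+ = λ n f g e → F.refl
      ; slice-neg = λ n f e → F.refl
      ; slice-ι = λ n → slice-monomial-* 0 n
      ; slice-X = λ n f x → F.trans (slice-monomial-* 1 n R.1# f x) (R.*-identityˡ (sliceᴾ n f) x)
      ; slice-1 = slice-1-0
      ; slice-1⁺ = slice-1-suc
      ; bounded = λ f → suc (Vec.head (bound f)) , λ n n> e → vanish f (n ∷ e) (beyond (bound f) n>)
      ; slice-top = λ d e f g fz gz → slice-*-single d e f g λ i j i+j≡d+e i≢d →
          cases {d} {e} {f} {g} i j i+j≡d+e i≢d fz gz
      }
      where
      beyond : ∀ {n} {e : Exponent k} (b : Exponent (suc k)) → suc (Vec.head b) ≤ n → ¬ n ∷ e ≼ b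
      beyond (_ ∷ _) n> (n≤ ∷ _) = ℕ.<⇒≱ n> n≤

      cases : ∀ {d e} {f g : Polynomial 𝔽 (suc k)} i j → i ℕ.+ j ≡ d ℕ.+ e → i ≢ d →
              (∀ n → suc d ≤ n → sliceᴾ n f R.≈ R.0#) → (∀ n → suc e ≤ n → sliceᴾ n g R.≈ R.0#) →
              sliceᴾ i f R.≈ R.0# ⊎ sliceᴾ j g R.≈ R.0#
      cases {d} {e} i j i+j≡d+e i≢d fz gz with suc d ℕ.≤? i | suc e ℕ.≤? j
      ... | yes d<i | _       = inj₁ (fz i d<i)
      ... | no  _   | yes e<j = inj₂ (gz j e<j)
      ... | no d≮i  | no e≮j  = contradiction
              (ℕ.+-cancelʳ-≤ j d i (ℕ.≤-trans (ℕ.+-monoʳ-≤ d (ℕ.≮⇒≥ e≮j))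
                (ℕ.≤-reflexive (≡.sym i+j≡d+e))))
              (ℕ.<⇒≱ (ℕ.≤∧≢⇒< (ℕ.≮⇒≥ d≮i) i≢d))

  -- Without variables every nonzero polynomial is a unit, so there are no irreducibles. Each
  -- further variable is one application of `Gauss`.
  polynomial-primes : ∀ k → FactorizationDomain.IrreduciblesPrime (polynomialDomain k)
  polynomial-primes zero {p} irr@(SemiringDefinitions.mkIrred p∤1 _) u v _ = contradiction constant
    (nonunit-nonconstant 𝔽 p (irreducible-nonzero 𝔽 p irr) p∤1)
    where
    constant : ∀ e → coeff p e F.≉ F.0# → e ≡ 𝟘
    constant [] _ = refl
  polynomial-primes (suc k) = Gauss.irreduciblesPrime (polynomialDomain k)
    (polynomialDomain (suc k))
    polynomialExtension (polynomial-primes k)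

open import Defs
open import Data.Nat.Base using (_+_; _*_; _^_; _⊔_)

-- The error term

1≤∏ : ∀ {k} (m : Exponent k) → 1 ≤ ∏[ m +1]
1≤∏ []      = ℕ.≤-refl
1≤∏ (x ∷ m) = ℕ.*-mono-≤ (s≤s {n = x} z≤n) (1≤∏ m)

-- The exact quotient of `∏[ m +1]` by the factor at j, obtained without division.
productExcept : ∀ {k} → Exponent k → Fin k → ℕ
productExcept (x ∷ m) zero    = ∏[ m +1]
productExcept (x ∷ m) (suc j) = suc x * productExcept m j

∏-productExcept : ∀ {k} (m : Exponent k) j → ∏[ m +1] ≡ suc (lookup m j) * productExcept m j
∏-productExcept (x ∷ m) zero    = refl
∏-productExcept (x ∷ m) (suc j) = ≡.trans (cong (suc x *_) (∏-productExcept m j))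
  (solve 3 (λ x y z → x :* (y :* z) := y :* (x :* z)) refl (suc x) (suc (lookup m j))
    (productExcept m j))
  where open +-*-Solver

1≤productExcept : ∀ {k} (m : Exponent k) j → 1 ≤ productExcept m j
1≤productExcept (x ∷ m) zero    = 1≤∏ m
1≤productExcept (x ∷ m) (suc j) = ℕ.*-mono-≤ (s≤s {n = x} z≤n) (1≤productExcept m j)

-- The induction step for one more coordinate, where p, p′ and r are the products over the previous
-- ones. Both p′ and r are at most p, so (x - y) p′ + y r ≤ x p, and what remains is the hypothesis
-- on p′ + r.
product-split : ∀ {x y p p′ r} → y ≤ x → 1 ≤ p′ → 1 ≤ r → p′ + r ≤ suc p →
                suc (x ∸ y) * p′ + suc y * r ≤ suc (suc x * p)
product-split {x} {y} {p} {p′} {r} y≤x 1≤p′ 1≤r p′+r≤1+p = begin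
  suc (x ∸ y) * p′ + suc y * r
    ≡⟨ solve 4 (λ z y p r → (con 1 :+ z) :* p :+ (con 1 :+ y) :* r := (z :* p :+ y :* r) :+
         (p :+ r)) refl (x ∸ y) y p′ r ⟩
  ((x ∸ y) * p′ + y * r) + (p′ + r)
    ≤⟨ ℕ.+-mono-≤ (ℕ.+-mono-≤ (ℕ.*-monoʳ-≤ (x ∸ y) p′≤p) (ℕ.*-monoʳ-≤ y r≤p)) p′+r≤1+p ⟩
  ((x ∸ y) * p + y * p) + suc p             ≡⟨ cong (_+ suc p) (ℕ.*-distribʳ-+ p (x ∸ y) y) ⟨
  (x ∸ y + y) * p + suc p                   ≡⟨ cong (λ z → z * p + suc p) (ℕ.m∸n+n≡m y≤x) ⟩
  x * p + suc p
    ≡⟨ solve 2 (λ x p → x :* p :+ (con 1 :+ p) := con 1 :+ (p :+ x :* p)) refl x p ⟩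
  suc (suc x * p)                           ∎
  where
  open ℕ.≤-Reasoning
  open +-*-Solver
  p′≤p : p′ ≤ p
  p′≤p = ℕ.s≤s⁻¹ (ℕ.≤-trans (ℕ.≤-trans (ℕ.≤-reflexive (ℕ.+-comm 1 p′)) (ℕ.+-monoʳ-≤ p′ 1≤r))
    p′+r≤1+p)
  r≤p : r ≤ p
  r≤p = ℕ.s≤s⁻¹ (ℕ.≤-trans (ℕ.+-monoˡ-≤ r 1≤p′) p′+r≤1+p)

-- Numbers of monomials are superadditive up to 1; for `d = 𝟘` equality holds.
∏-split : ∀ {k} {d m : Exponent k} → d ≼ m → ∏[ m ⊟ d +1] + ∏[ d +1] ≤ suc ∏[ m +1]
∏-split []                              = ℕ.≤-refl
∏-split (_∷_ {xs = d} {ys = m} y≤x d≼m) = product-split y≤x (1≤∏ (m ⊟ d)) (1≤∏ d) (∏-split d≼m)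

productExcept-split : ∀ {k} {d m : Exponent k} → d ≼ m → ∀ j →
                  productExcept (m ⊟ d) j + productExcept d j ≤ suc (productExcept m j)
productExcept-split (_ ∷ d≼m)                               zero    = ∏-split d≼m
productExcept-split (_∷_ {xs = d} {ys = m} y≤x d≼m) (suc j) =
  product-split y≤x (1≤productExcept (m ⊟ d) j) (1≤productExcept d j) (productExcept-split d≼m j)

sum<∏ : ∀ {k} (d : Exponent k) → suc (Vec.sum d) ≤ ∏[ d +1]
sum<∏ []      = ℕ.≤-refl
sum<∏ (x ∷ d) = begin
  suc (x + Vec.sum d)          ≡⟨ ℕ.+-suc x (Vec.sum d) ⟨
  x + suc (Vec.sum d)
    ≤⟨ ℕ.+-mono-≤ (ℕ.≤-trans (ℕ.≤-reflexive (≡.sym (ℕ.*-identityʳ x))) (ℕ.*-monoʳ-≤ x (1≤∏ d)))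
         (sum<∏ d) ⟩
  x * ∏[ d +1] + ∏[ d +1]      ≡⟨ ℕ.+-comm _ ∏[ d +1] ⟩
  ∏[ x ∷ d +1]                 ∎
  where open ℕ.≤-Reasoning

-- Replaces the sum that governs the decay of the terms by the two quantities that occur in
-- `exponent-gap`.
sum≤lookup+productExcept : ∀ {k} (d : Exponent k) j → Vec.sum d ≤ lookup d j + productExcept d j
sum≤lookup+productExcept (x ∷ d) zero    = ℕ.+-monoʳ-≤ x (ℕ.<⇒≤ (sum<∏ d))
sum≤lookup+productExcept (x ∷ d) (suc j) = begin
  x + Vec.sum d
    ≤⟨ ℕ.+-mono-≤ (ℕ.≤-trans (ℕ.≤-reflexive (≡.sym (ℕ.*-identityʳ x)))
         (ℕ.*-monoʳ-≤ x (1≤productExcept d j))) (sum≤lookup+productExcept d j) ⟩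
  x * productExcept d j + (lookup d j + productExcept d j)
    ≡⟨ solve 3 (λ x l c → x :* c :+ (l :+ c) := l :+ (c :+ x :* c)) refl x (lookup d j)
         (productExcept d j) ⟩
  lookup d j + suc x * productExcept d j                   ∎
  where
  open ℕ.≤-Reasoning
  open +-*-Solver

-- Here d_j = τ + 1 + σ, m_j = d_j + α, n_j = d_j + β, and 1 + δ, A, A′, B, B′ are
-- the products over i ≠ j belonging to d, m, m − d, n, n − d.
exponent-gap : ∀ τ σ α β δ {A A′ B B′} → suc τ ≤ α + β + σ → A′ + δ ≤ A → B′ + δ ≤ B →
               suc δ ≤ A → suc δ ≤ B →
               suc (suc τ + σ) * suc δ + (suc α * A′ + suc β * B′) + (suc τ + σ + suc δ) ≤
               (suc α + σ) * A + (suc β + σ) * B + (2 * τ + 4)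
exponent-gap τ σ α β δ {A} {A′} {B} {B′} τ< A′≤ B′≤ δ<A δ<B = begin
  suc (suc τ + σ) * suc δ + (suc α * A′ + suc β * B′) + (suc τ + σ + suc δ)
    ≡⟨ solve 7 (λ τ σ α β δ A′ B′ →
         (con 1 :+ (con 1 :+ τ :+ σ)) :* (con 1 :+ δ) :+
           ((con 1 :+ α) :* A′ :+ (con 1 :+ β) :* B′) :+ (con 1 :+ τ :+ σ :+ (con 1 :+ δ)) :=
         ((con 1 :+ τ) :* δ) :+ (((con 1 :+ α) :* A′ :+ (con 1 :+ β) :* B′) :+ (con 2 :+ σ) :* δ
           :+ (σ :+ σ) :+ (con 2 :* τ :+ con 4)))
         refl τ σ α β δ A′ B′ ⟩
  suc τ * δ + ((suc α * A′ + suc β * B′) + (2 + σ) * δ + (σ + σ) + (2 * τ + 4))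
    -- Here the lower bound on the maximum of mⱼ and nⱼ is spent. Of the τ + 1 copies of δ, τ come
    -- from the exponent of N(d) and one from the added sum of d.
    ≤⟨ ℕ.+-monoˡ-≤ _ (ℕ.*-monoˡ-≤ δ τ<) ⟩
  (α + β + σ) * δ + ((suc α * A′ + suc β * B′) + (2 + σ) * δ + (σ + σ) + (2 * τ + 4))
    ≡⟨ solve 7 (λ τ σ α β δ A′ B′ →
         (α :+ β :+ σ) :* δ :+ (((con 1 :+ α) :* A′ :+ (con 1 :+ β) :* B′) :+ (con 2 :+ σ) :* δ :+
           (σ :+ σ) :+ (con 2 :* τ :+ con 4)) :=
         (con 1 :+ α) :* (A′ :+ δ) :+ (con 1 :+ β) :* (B′ :+ δ) :+
           (σ :* (con 1 :+ δ) :+ σ :* (con 1 :+ δ)) :+ (con 2 :* τ :+ con 4))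
         refl τ σ α β δ A′ B′ ⟩
  suc α * (A′ + δ) + suc β * (B′ + δ) + (σ * suc δ + σ * suc δ) + (2 * τ + 4)
    ≤⟨ ℕ.+-monoˡ-≤ (2 * τ + 4) (ℕ.+-mono-≤
         (ℕ.+-mono-≤ (ℕ.*-monoʳ-≤ (suc α) A′≤) (ℕ.*-monoʳ-≤ (suc β) B′≤))
         (ℕ.+-mono-≤ (ℕ.*-monoʳ-≤ σ δ<A) (ℕ.*-monoʳ-≤ σ δ<B))) ⟩
  suc α * A + suc β * B + (σ * A + σ * B) + (2 * τ + 4)
    ≡⟨ solve 6 (λ τ σ α β A B →
         (con 1 :+ α) :* A :+ (con 1 :+ β) :* B :+ (σ :* A :+ σ :* B) :+ (con 2 :* τ :+ con 4) :=
         (con 1 :+ α :+ σ) :* A :+ (con 1 :+ β :+ σ) :* B :+ (con 2 :* τ :+ con 4)) refl τ σ α β A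
           B ⟩
  (suc α + σ) * A + (suc β + σ) * B + (2 * τ + 4) ∎
  where
  open ℕ.≤-Reasoning
  open +-*-Solver

errorExponent-≥ : ∀ {k} (t m n : Exponent k) j →
  (lookup m j ∸ lookup t j) * productExcept m j + (lookup n j ∸ lookup t j) * productExcept n j ≤
    errorExponent t m n
errorExponent-≥ {k} t m n j = subst₂ (λ x y → x + y ≤ errorExponent t m n) (quotient m) (quotient n)
  (All.lookup (xs≤max 0 _) (∈-map⁺ _ (∈-allFin j)))
  where
  quotient : ∀ m → ((lookup m j ∸ lookup t j) * ∏[ m +1]) ℕ./ suc (lookup m j) ≡
    (lookup m j ∸ lookup t j) * productExcept m j
  quotient m = ≡.trans
    (cong (ℕ._/ suc (lookup m j)) (≡.trans
      (cong ((lookup m j ∸ lookup t j) *_) (∏-productExcept m j))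
      (solve 3 (λ x y z → x :* (y :* z) := x :* z :* y) refl (lookup m j ∸ lookup t j)
        (suc (lookup m j)) (productExcept m j))))
    (ℕ.m*n/n≡m _ (suc (lookup m j)))
    where open +-*-Solver

-- The decay appears as `Vec.sum d` on the left, which avoids truncated subtraction on the right.
large-exponent : ∀ {k} (t m n d : Exponent k) j →
  2 * lookup t j + 1 < lookup m j ⊔ lookup n j → d ≼ m → d ≼ n → lookup t j < lookup d j →
  ∏[ d +1] + (∏[ m ⊟ d +1] + ∏[ n ⊟ d +1]) + Vec.sum d ≤ errorExponent t m n + (2 * lookup t j + 4)
large-exponent t m n d j max> d≼m d≼n t<d = begin
  ∏[ d +1] + (∏[ m ⊟ d +1] + ∏[ n ⊟ d +1]) + Vec.sum d
    ≤⟨ ℕ.+-monoʳ-≤ (∏[ d +1] + (∏[ m ⊟ d +1] + ∏[ n ⊟ d +1])) (sum≤lookup+productExcept d j) ⟩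
  ∏[ d +1] + (∏[ m ⊟ d +1] + ∏[ n ⊟ d +1]) + (lookup d j + productExcept d j)
    ≡⟨ cong₂ _+_ (cong₂ _+_ (∏-productExcept d j) (cong₂ _+_ (at-difference m) (at-difference n)))
         refl ⟩
  suc s * productExcept d j + (suc α * A′ + suc β * B′) + (s + productExcept d j)
    ≡⟨ cong₂ (λ s D → suc s * D + (suc α * A′ + suc β * B′) + (s + D)) s≡ D≡ ⟩
  suc (suc τ + σ) * suc δ + (suc α * A′ + suc β * B′) + (suc τ + σ + suc δ)
    ≤⟨ exponent-gap τ σ α β δ τ< (below m d≼m) (below n d≼n) (above m d≼m) (above n d≼n) ⟩
  (suc α + σ) * productExcept m j + (suc β + σ) * productExcept n j + (2 * τ + 4)
    ≡⟨ cong₂ (λ x y → x * productExcept m j + y * productExcept n j + (2 * τ + 4)) (shift m d≼m)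
         (shift n d≼n) ⟩
  (lookup m j ∸ τ) * productExcept m j + (lookup n j ∸ τ) * productExcept n j + (2 * τ + 4)
    ≤⟨ ℕ.+-monoˡ-≤ (2 * τ + 4) (errorExponent-≥ t m n j) ⟩
  errorExponent t m n + (2 * τ + 4) ∎
  where
  open ℕ.≤-Reasoning
  τ = lookup t j
  s = lookup d j
  σ = s ∸ suc τ
  α = lookup m j ∸ s
  β = lookup n j ∸ s
  δ = ℕ.pred (productExcept d j)
  A′ = productExcept (m ⊟ d) j
  B′ = productExcept (n ⊟ d) j
  s≡ : s ≡ suc τ + σ
  s≡ = ≡.sym (ℕ.m+[n∸m]≡n t<d)
  D≡ : productExcept d j ≡ suc δ
  D≡ = ≡.sym (ℕ.suc-pred (productExcept d j) {{ℕ.>-nonZero (1≤productExcept d j)}})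
  at-difference : ∀ m → ∏[ m ⊟ d +1] ≡ suc (lookup m j ∸ s) * productExcept (m ⊟ d) j
  at-difference m = ≡.trans (∏-productExcept (m ⊟ d) j)
    (cong (λ x → suc x * productExcept (m ⊟ d) j) (Vec.lookup-zipWith _∸_ j m d))
  below : ∀ m → d ≼ m → productExcept (m ⊟ d) j + δ ≤ productExcept m j
  below m d≼m = ℕ.s≤s⁻¹ (subst (_≤ suc (productExcept m j))
    (≡.trans (cong (productExcept (m ⊟ d) j +_) D≡) (ℕ.+-suc _ δ)) (productExcept-split d≼m j))
  above : ∀ m → d ≼ m → suc δ ≤ productExcept m j
  above m d≼m = ℕ.≤-trans (ℕ.+-monoˡ-≤ δ (1≤productExcept (m ⊟ d) j)) (below m d≼m)
  recombine : ∀ m → d ≼ m → lookup m j ≡ τ + (suc (lookup m j ∸ s) + σ)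
  recombine m d≼m = ≡.trans (≡.sym (ℕ.m∸n+n≡m (Pointwise.lookup d≼m j)))
    (≡.trans (cong (lookup m j ∸ s +_) s≡)
      (solve 3 (λ x τ σ → x :+ (con 1 :+ τ :+ σ) := τ :+ (con 1 :+ x :+ σ)) refl (lookup m j ∸ s)
        τ σ))
    where open +-*-Solver
  shift : ∀ m → d ≼ m → suc (lookup m j ∸ s) + σ ≡ lookup m j ∸ τ
  shift m d≼m = ≡.sym (≡.trans (cong (_∸ τ) (recombine m d≼m)) (ℕ.m+n∸m≡n τ _))
  -- By `recombine`, mⱼ is τ + 1 + (mⱼ - s) + σ, and τ + 1 is cancelled from 2τ + 2 ≤ mⱼ + 0 after
  -- one τ has been taken from each side.
  far : ∀ m → d ≼ m → 2 * τ + 1 < lookup m j → suc τ ≤ lookup m j ∸ s + σ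
  far m d≼m 2τ+1< = ℕ.s≤s⁻¹ (ℕ.+-cancelˡ-≤ τ _ _ (subst₂ _≤_
    (solve 1 (λ τ → con 1 :+ (con 2 :* τ :+ con 1) := τ :+ (con 1 :+ (con 1 :+ τ))) refl τ)
      (recombine m d≼m) 2τ+1<))
    where open +-*-Solver
  τ< : suc τ ≤ α + β + σ
  τ< with ℕ.⊔-sel (lookup m j) (lookup n j)
  ... | inj₁ eq = ℕ.≤-trans (far m d≼m (subst (2 * τ + 1 <_) eq max>)) (ℕ.+-monoˡ-≤ σ (ℕ.m≤m+n α β))
  ... | inj₂ eq = ℕ.≤-trans (far n d≼n (subst (2 * τ + 1 <_) eq max>)) (ℕ.+-monoˡ-≤ σ (ℕ.m≤n+m β α))

lookup≤sum : ∀ {k} (t : Exponent k) j → lookup t j ≤ Vec.sum t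
lookup≤sum (x ∷ t) zero    = ℕ.m≤m+n x _
lookup≤sum (x ∷ t) (suc j) = ℕ.≤-trans (lookup≤sum t j) (ℕ.m≤n+m _ x)

-- Summation over the large degrees

module _ (q : ℕ) (2≤q : 2 ≤ q) where
  open ListSum ℕ.+-*-commutativeSemiring

  private instance
    q≢0 : NonZero q
    q≢0 = ℕ.>-nonZero (ℕ.<⇒≤ 2≤q)

  sum-mono : ∀ {a} {A : Set a} (xs : List A) {s b : A → ℕ} → (∀ {x} → x ∈ xs → s x ≤ b x) →
    sum xs s ≤ sum xs b
  sum-mono []       h = z≤n
  sum-mono (x ∷ xs) h = ℕ.+-mono-≤ (h (here refl)) (sum-mono xs (h ∘ there))

  sum-filter-≤ : ∀ {a p} {A : Set a} {P : A → Set p} (P? : Unary.Decidable P) xs (s : A → ℕ) →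
    sum (filter P? xs) s ≤ sum xs s
  sum-filter-≤ P? []       s = z≤n
  sum-filter-≤ P? (x ∷ xs) s with P? x
  ... | yes _ = ℕ.+-monoʳ-≤ (s x) (sum-filter-≤ P? xs s)
  ... | no _  = ℕ.≤-trans (sum-filter-≤ P? xs s) (ℕ.m≤n+m _ (s x))

  -- The additional 1 makes the base case an equality. In the step the earlier terms together are at
  -- most 2 qˣ ≤ q · qˣ, that is, at most the new leading term.
  geometric : ∀ x → suc (sum (upTo (suc x)) (λ i → q ^ (x ∸ i))) ≤ 2 * q ^ x
  geometric zero    = ℕ.≤-refl
  geometric (suc x) = begin
    suc (sum (upTo (suc (suc x))) (λ i → q ^ (suc x ∸ i)))
      ≡⟨ cong suc (sum-upTo (suc x) (λ i → q ^ (suc x ∸ i))) ⟩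
    suc (q ^ suc x + sum (upTo (suc x)) (λ i → q ^ (x ∸ i)))     ≡⟨ ℕ.+-suc (q ^ suc x) _ ⟨
    q ^ suc x + suc (sum (upTo (suc x)) (λ i → q ^ (x ∸ i)))
      ≤⟨ ℕ.+-monoʳ-≤ (q ^ suc x) (ℕ.≤-trans (geometric x) (ℕ.*-monoˡ-≤ (q ^ x) 2≤q)) ⟩
    q ^ suc x + q ^ suc x
      ≡⟨ cong (q ^ suc x +_) (ℕ.+-identityʳ (q ^ suc x)) ⟨
    2 * q ^ suc x                                                ∎
    where open ℕ.≤-Reasoning

  -- Over a box the sum is a product of k one-dimensional geometric sums, each contributing a factor
  -- 2.
  box-geometric : ∀ {k} (m : Exponent k) →
    sum (box m) (λ d → q ^ Vec.sum (m ⊟ d)) ≤ 2 ^ k * q ^ Vec.sum m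
  box-geometric []                = ℕ.≤-refl
  box-geometric {suc k} (x ∷ m) = begin
    sum (box (x ∷ m)) (λ d → q ^ Vec.sum ((x ∷ m) ⊟ d))
      ≡⟨ sum-cartesianProductWith _∷_ (upTo (suc x)) (box m) (λ d → q ^ Vec.sum ((x ∷ m) ⊟ d)) ⟩
    sum (upTo (suc x)) (λ i → sum (box m) λ d → q ^ (x ∸ i + Vec.sum (m ⊟ d)))
      ≡⟨ sum-cong (upTo (suc x)) (λ i →
           ≡.trans (sum-cong (box m) λ d → ℕ.^-distribˡ-+-* q (x ∸ i) _)
           (≡.sym (sum-*ˡ (q ^ (x ∸ i)) (box m) _))) ⟩
    sum (upTo (suc x)) (λ i → q ^ (x ∸ i) * sum (box m) λ d → q ^ Vec.sum (m ⊟ d))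
      ≡⟨ sum-*ʳ (sum (box m) λ d → q ^ Vec.sum (m ⊟ d)) (upTo (suc x)) (λ i → q ^ (x ∸ i)) ⟨
    sum (upTo (suc x)) (λ i → q ^ (x ∸ i)) * sum (box m) (λ d → q ^ Vec.sum (m ⊟ d))
      ≤⟨ ℕ.*-mono-≤ (ℕ.<⇒≤ (geometric x)) (box-geometric m) ⟩
    2 * q ^ x * (2 ^ k * q ^ Vec.sum m)
      ≡⟨ solve 4 (λ a b c d → a :* b :* (c :* d) := a :* c :* (b :* d)) refl 2 (q ^ x) (2 ^ k)
           (q ^ Vec.sum m) ⟩
    2 ^ suc k * (q ^ x * q ^ Vec.sum m)
      ≡⟨ cong (2 ^ suc k *_) (ℕ.^-distribˡ-+-* q x (Vec.sum m)) ⟨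
    2 ^ suc k * q ^ Vec.sum (x ∷ m) ∎
    where
    open ℕ.≤-Reasoning
    open +-*-Solver

  module _ {k} (t m n : Exponent k) (max> : ∀ j → 2 * lookup t j + 1 < lookup m j ⊔ lookup n j)
           (N : Exponent k → ℕ) (N≤ : ∀ d → N d ≤ q ^ ∏[ d +1]) where

    large? : Unary.Decidable (λ d → d ≼ n × ¬ d ≼ t)
    large? d = (d ≼? n) ×-dec ¬? (d ≼? t)

    large-index : ∀ d → ¬ d ≼ t → ∃ λ j → lookup t j < lookup d j
    large-index d d⋠t with j , ≰ ← ¬∀⟶∃¬ k _ (λ j → lookup d j ℕ.≤? lookup t j)
      (d⋠t ∘ ≼-lookup⁻) = j , ℕ.≰⇒> ≰

    private
      term : Exponent k → ℕ
      term d = N d * (N (m ⊟ d) * N (n ⊟ d))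
      K = errorExponent t m n + (2 * Vec.sum t + 4)

    -- The decay of q to the power minus the sum of d is expressed within the natural numbers: both
    -- sides are multiplied by `q ^ Vec.sum m`, which `large-sum` cancels at the end.
    large-term : ∀ d → d ≼ m → d ≼ n → ¬ d ≼ t →
      term d * q ^ Vec.sum m ≤ q ^ K * q ^ Vec.sum (m ⊟ d)
    large-term d d≼m d≼n d⋠t with j , t<d ← large-index d d⋠t = begin
      term d * q ^ Vec.sum m
        ≤⟨ ℕ.*-monoˡ-≤ (q ^ Vec.sum m) (ℕ.*-mono-≤ (N≤ d) (ℕ.*-mono-≤ (N≤ (m ⊟ d)) (N≤ (n ⊟ d)))) ⟩
      q ^ ∏[ d +1] * (q ^ ∏[ m ⊟ d +1] * q ^ ∏[ n ⊟ d +1]) * q ^ Vec.sum m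
        ≡⟨ cong₂ _*_ (≡.trans (cong (q ^ ∏[ d +1] *_)
             (≡.sym (ℕ.^-distribˡ-+-* q ∏[ m ⊟ d +1] ∏[ n ⊟ d +1])))
             (≡.sym (ℕ.^-distribˡ-+-* q ∏[ d +1] _)))
             (≡.trans (cong (q ^_) (≡.trans (cong Vec.sum (≡.sym (a⊞[e⊟a]≡e d≼m)))
               (sum-⊞ d (m ⊟ d))))
               (ℕ.^-distribˡ-+-* q (Vec.sum d) _)) ⟩
      q ^ G * (q ^ Vec.sum d * q ^ Vec.sum (m ⊟ d))
        ≡⟨ ℕ.*-assoc (q ^ G) (q ^ Vec.sum d) (q ^ Vec.sum (m ⊟ d)) ⟨
      q ^ G * q ^ Vec.sum d * q ^ Vec.sum (m ⊟ d)
        ≡⟨ cong (_* q ^ Vec.sum (m ⊟ d)) (ℕ.^-distribˡ-+-* q G (Vec.sum d)) ⟨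
      q ^ (G + Vec.sum d) * q ^ Vec.sum (m ⊟ d)
        ≤⟨ ℕ.*-monoˡ-≤ (q ^ Vec.sum (m ⊟ d)) (ℕ.^-monoʳ-≤ q (ℕ.≤-trans
             (large-exponent t m n d j (max> j) d≼m d≼n t<d)
             (ℕ.+-monoʳ-≤ (errorExponent t m n)
               (ℕ.+-monoˡ-≤ 4 (ℕ.*-monoʳ-≤ 2 (lookup≤sum t j)))))) ⟩
      q ^ K * q ^ Vec.sum (m ⊟ d) ∎
      where
      open ℕ.≤-Reasoning
      G = ∏[ d +1] + (∏[ m ⊟ d +1] + ∏[ n ⊟ d +1])

    large-sum : sum (filter large? (box m)) (λ d → N d * (N (m ⊟ d) * N (n ⊟ d))) ≤
                2 ^ k * q ^ (2 * Vec.sum t + 4) * q ^ errorExponent t m n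
    large-sum = ℕ.*-cancelʳ-≤ _ _ (q ^ Vec.sum m) {{ℕ.m^n≢0 q (Vec.sum m)}} (begin
      sum (filter large? (box m)) term * q ^ Vec.sum m
        ≡⟨ sum-*ʳ (q ^ Vec.sum m) (filter large? (box m)) term ⟩
      sum (filter large? (box m)) (λ d → term d * q ^ Vec.sum m)
        ≤⟨ sum-mono (filter large? (box m)) (λ {d} d∈ →
             let d∈m , d≼n , d⋠t = ∈-filter⁻ large? {xs = box m} d∈ in large-term d (∈-box⁻ m d∈m)
                 d≼n d⋠t) ⟩
      sum (filter large? (box m)) (λ d → q ^ K * q ^ Vec.sum (m ⊟ d))
        ≤⟨ sum-filter-≤ large? (box m) _ ⟩
      sum (box m) (λ d → q ^ K * q ^ Vec.sum (m ⊟ d))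
        ≡⟨ sum-*ˡ (q ^ K) (box m) _ ⟨
      q ^ K * sum (box m) (λ d → q ^ Vec.sum (m ⊟ d))
        ≤⟨ ℕ.*-monoʳ-≤ (q ^ K) (box-geometric m) ⟩
      q ^ K * (2 ^ k * q ^ Vec.sum m)
        ≡⟨ cong (_* (2 ^ k * q ^ Vec.sum m))
             (ℕ.^-distribˡ-+-* q (errorExponent t m n) (2 * Vec.sum t + 4)) ⟩
      q ^ errorExponent t m n * q ^ (2 * Vec.sum t + 4) * (2 ^ k * q ^ Vec.sum m)
        ≡⟨ solve 4 (λ a b c d → a :* b :* (c :* d) := c :* b :* a :* d) refl
             (q ^ errorExponent t m n) (q ^ (2 * Vec.sum t + 4)) (2 ^ k) (q ^ Vec.sum m) ⟩
      2 ^ k * q ^ (2 * Vec.sum t + 4) * q ^ errorExponent t m n * q ^ Vec.sum m ∎)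
      where
      open ℕ.≤-Reasoning
      open +-*-Solver

-- Normalized polynomials

deduplicate-distinct : ∀ {a r} {A : Set a} {R : A → A → Set r} (R? : Decidable R) (xs : List A) →
                       AllPairs (λ x y → ¬ R x y) (deduplicate R? xs)
deduplicate-distinct R? []       = []
deduplicate-distinct R? (x ∷ xs) =
  All.all-filter (¬? ∘ R? x) (deduplicate R? xs) ∷ AllPairs.filter⁺ (¬? ∘ R? x)
    (deduplicate-distinct R? xs)

length-cartesianProductWith : ∀ {a b c} {A : Set a} {B : Set b} {C : Set c} (f : A → B → C) xs ys →
                              length (cartesianProductWith f xs ys) ≡ length xs * length ys
length-cartesianProductWith f []       ys = refl
length-cartesianProductWith f (x ∷ xs) ys = ≡.trans (List.length-++ (List.map (f x) ys))
  (cong₂ _+_ (List.length-map (f x) ys) (length-cartesianProductWith f xs ys))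

length-box : ∀ {k} (m : Exponent k) → length (box m) ≡ ∏[ m +1]
length-box []      = refl
length-box (x ∷ m) = ≡.trans (length-cartesianProductWith _∷_ (upTo (suc x)) (box m))
  (cong₂ _*_ (List.length-upTo (suc x)) (length-box m))

module _ {c ℓ : Level} {q : ℕ} (𝔽 : FiniteField c ℓ q) where

  open PolynomialRing 𝔽
  private module F = FiniteField 𝔽
  open Polynomial

  2≤q : 2 ≤ q
  2≤q = two q F.finite
    where
    two : ∀ q → Inverse F.setoid (≡.setoid (Fin q)) → 2 ≤ q
    two zero          finite with () ← Inverse.to finite F.0#
    two (suc (suc _)) finite = s≤s (s≤s z≤n)
    two (suc zero)    finite = contradiction (F.trans (F.sym (Inverse.strictlyInverseʳ finite F.1#))
      (F.trans (F.reflexive (cong (Inverse.from finite) (Fin1 _ _)))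
        (Inverse.strictlyInverseʳ finite F.0#))) F.1≉0
      where
      Fin1 : ∀ (i j : Fin 1) → i ≡ j
      Fin1 Fin.zero Fin.zero = refl

  module _ {k : ℕ} where
    private module D = FactorizationDomain (polynomialDomain k)
    open D using (_∥_)
    open MagmaDefinitions (RawSemiring.*-rawMagma (polynomials 𝔽 k)) using (_,_)

    length-functions : ∀ (es : List (Exponent k)) → length (functions 𝔽 es) ≡ q ^ length es
    length-functions []       = refl
    length-functions (e ∷ es) = ≡.trans
      (length-cartesianProductWith (update 𝔽 e) (elements 𝔽 {k}) (functions 𝔽 es))
      (cong₂ _*_ (≡.trans (List.length-map (Inverse.from F.finite) (allFin q))
        (List.length-tabulate {n = q} (λ i → i)))
        (length-functions es))

    N≤ : ∀ m → N 𝔽 {k} m ≤ q ^ ∏[ m +1]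
    N≤ m = begin
      length (𝒩 𝔽 m)
        ≤⟨ List.length-deduplicate (_~?_ 𝔽) (filter (deg? 𝔽 m) (polynomialsBelow 𝔽 m)) ⟩
      length (filter (deg? 𝔽 m) (polynomialsBelow 𝔽 m))
        ≤⟨ List.length-filter (deg? 𝔽 m) (polynomialsBelow 𝔽 m) ⟩
      length (polynomialsBelow 𝔽 m)
        ≡⟨ List.length-map (truncate 𝔽 m) (functions 𝔽 (box m)) ⟩
      length (functions 𝔽 (box m))                          ≡⟨ length-functions (box m) ⟩
      q ^ length (box m)                                     ≡⟨ cong (q ^_) (length-box m) ⟩
      q ^ ∏[ m +1]                                           ∎
      where open ℕ.≤-Reasoning

    ~⇒∥ : ∀ (f g : Polynomial 𝔽 k) → _~_ 𝔽 f g → f ∥ g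
    ~⇒∥ f g (x , x≉0 , f≈xg) with y , xy≈1 ← F.inverse x x≉0 =
      (_·_ 𝔽 y (1ᴾ 𝔽) , λ e → F.trans (constant-* 𝔽 y f e) (F.trans (F.*-congˡ (f≈xg e))
        (F.trans (F.sym (F.*-assoc y x _))
          (F.trans (F.*-congʳ (F.trans (F.*-comm y x) xy≈1)) (F.*-identityˡ _))))) ,
      (_·_ 𝔽 x (1ᴾ 𝔽) , λ e → F.trans (constant-* 𝔽 x g e) (F.sym (f≈xg e)))

    constant : ∀ a → TotalDegree a 0 → D._≈_ a (_·_ 𝔽 (coeff a 𝟘) (1ᴾ 𝔽))
    constant a (_ , a≤) e with e ≟ᵉ 𝟘
    ... | yes refl = F.sym (F.*-identityʳ _)
    ... | no  e≢𝟘  = F.trans (decidable-stable (_≈?_ 𝔽 (coeff a e) F.0#) λ ae≉0 →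
            e≢𝟘 (sum≡0⇒𝟘 𝔽 {k} e (ℕ.n≤0⇒n≡0 (a≤ e ae≉0)))) (F.sym (F.zeroʳ _))

    -- From f = a g and g = b f the total degrees of a and b add up to 0. Hence a is constant, and
    -- its constant coefficient is the required scalar.
    ∥⇒~ : ∀ (f g : Polynomial 𝔽 k) → f D.≉ D.0# → f ∥ g → _~_ 𝔽 f g
    ∥⇒~ f g f≉0 ((b , bf≈g) , (a , ag≈f)) =
      coeff a 𝟘 , a𝟘≉0 , λ e → F.trans (F.sym (ag≈f e))
        (F.trans (D.*-congʳ {g} {a} {_·_ 𝔽 (coeff a 𝟘) (1ᴾ 𝔽)} a≈ e) (constant-* 𝔽 (coeff a 𝟘) g e))
      where
      f≈ag : f D.≈ a D.* g
      f≈ag e = F.sym (ag≈f e)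
      a≉0 = proj₁ (*-nonzero⁻ f a g f≉0 f≈ag)
      g≉0 = proj₂ (*-nonzero⁻ f a g f≉0 f≈ag)
      b≉0 = proj₁ (*-nonzero⁻ g b f g≉0 (λ e → F.sym (bf≈g e)))
      da = totalDegree a a≉0
      db = totalDegree b b≉0
      df = totalDegree f f≉0
      dg = totalDegree g g≉0
      degree-a : proj₁ da ≡ 0
      degree-a = ℕ.m+n≡0⇒m≡0 (proj₁ da) (ℕ.+-cancelʳ-≡ (proj₁ df) (proj₁ da + proj₁ db) 0 (begin
        proj₁ da + proj₁ db + proj₁ df     ≡⟨ ℕ.+-assoc (proj₁ da) (proj₁ db) (proj₁ df) ⟩
        proj₁ da + (proj₁ db + proj₁ df)
          ≡⟨ cong (λ x → proj₁ da + x) (totalDegree-unique (b D.* f) g bf≈g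
               (totalDegree-* b f (proj₂ db) (proj₂ df)) (proj₂ dg)) ⟩
        proj₁ da + proj₁ dg
          ≡⟨ totalDegree-unique (a D.* g) f ag≈f (totalDegree-* a g (proj₂ da) (proj₂ dg))
               (proj₂ df) ⟩
        proj₁ df                           ∎))
        where open ≡.≡-Reasoning
      a≈ : a D.≈ _·_ 𝔽 (coeff a 𝟘) (1ᴾ 𝔽)
      a≈ = constant a (subst (TotalDegree a) degree-a (proj₂ da))
      a𝟘≉0 : coeff a 𝟘 F.≉ F.0#
      a𝟘≉0 a𝟘≈0 = a≉0 λ e → F.trans (a≈ e) (F.trans (F.*-congʳ a𝟘≈0) (F.zeroˡ _))

    deg-~ : ∀ (f g : Polynomial 𝔽 k) d → _~_ 𝔽 f g → Deg 𝔽 f d → Deg 𝔽 g d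
    deg-~ f g d (x , x≉0 , f≈xg) ((e , fe≉0) , partial) = (e , to e fe≉0) , λ i →
      let (a , fa≉0 , eq) , upper = partial i in (a , to a fa≉0 , eq) , λ a → upper a ∘ from a
      where
      to : ∀ e → coeff f e F.≉ F.0# → coeff g e F.≉ F.0#
      to e fe≉0 ge≈0 = fe≉0 (F.trans (f≈xg e) (F.trans (F.*-congˡ ge≈0) (F.zeroʳ x)))
      from : ∀ e → coeff g e F.≉ F.0# → coeff f e F.≉ F.0#
      from e ge≉0 fe≈0 = *≉0 𝔽 x≉0 ge≉0 (F.trans (F.sym (f≈xg e)) fe≈0)

    ~-sym : ∀ (f g : Polynomial 𝔽 k) → _~_ 𝔽 f g → _~_ 𝔽 g f
    ~-sym f g (x , x≉0 , f≈xg) with y , xy≈1 ← F.inverse x x≉0 = y ,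
      (λ y≈0 → F.1≉0 (F.trans (F.sym xy≈1) (F.trans (F.*-congˡ y≈0) (F.zeroʳ x)))) ,
      λ e → F.sym (F.trans (F.*-congˡ (f≈xg e)) (F.trans (F.sym (F.*-assoc y x _))
        (F.trans (F.*-congʳ (F.trans (F.*-comm y x) xy≈1)) (F.*-identityˡ _))))

    𝒩-deg : ∀ m (f : Polynomial 𝔽 k) → f ∈ 𝒩 𝔽 m → Deg 𝔽 f m
    𝒩-deg m f f∈ = proj₂ (∈-filter⁻ (deg? 𝔽 m) {xs = polynomialsBelow 𝔽 m}
      (∈-deduplicate⁻ (_~?_ 𝔽) (filter (deg? 𝔽 m) (polynomialsBelow 𝔽 m)) f∈))

    deg-nonzero : ∀ f d → Deg 𝔽 f d → f D.≉ D.0#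
    deg-nonzero f d (nz , _) = nonzero⁻ {k} {f} nz

    coordinate-⊞ : ∀ i (a b : Exponent k) → lookup (a ⊞ b) i ≡ lookup a i + lookup b i
    coordinate-⊞ i a b = Vec.lookup-zipWith _+_ i a b

    lookup-injective : ∀ (d e : Exponent k) → (∀ i → lookup d i ≡ lookup e i) → d ≡ e
    lookup-injective d e eq = ≡.trans (≡.sym (Vec.tabulate∘lookup d))
      (≡.trans (Vec.tabulate-cong eq) (Vec.tabulate∘lookup e))

    𝒩-complete : ∀ m f → Deg 𝔽 f m → Any (f ∥_) (𝒩 𝔽 m)
    𝒩-complete m f df = Any.deduplicate⁺ (_~?_ 𝔽)
      (λ {x} {y} y~x f∥x → D.∥-trans f∥x (~⇒∥ x y (~-sym y x y~x)))
      (represent (∈-polynomialsBelow 𝔽 f m λ e fe≉0 → ≼-lookup⁻ λ i → proj₂ (proj₂ df i) e fe≉0))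
      where
      represent : ∃ (λ g → g ∈ polynomialsBelow 𝔽 m × _≈ᴾ_ 𝔽 f g) →
        Any (f ∥_) (filter (deg? 𝔽 m) (polynomialsBelow 𝔽 m))
      represent (g , g∈ , f≈g) = lose (∈-filter⁺ (deg? 𝔽 m) g∈ (deg-~ f g m f~g df)) (~⇒∥ f g f~g)
        where
        f~g : _~_ 𝔽 f g
        f~g = F.1# , F.1≉0 , λ e → F.trans (f≈g e) (F.sym (F.*-identityˡ _))

    𝒩-distinct : ∀ m → AllPairs (λ f g → ¬ f ∥ g) (𝒩 𝔽 m)
    𝒩-distinct m = nonassociated (𝒩 𝔽 m) (All.tabulate λ {f} f∈ → deg-nonzero f m (𝒩-deg m f f∈))
      (deduplicate-distinct (_~?_ 𝔽) (filter (deg? 𝔽 m) (polynomialsBelow 𝔽 m)))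
      where
      nonassociated : ∀ fs → All (D._≉ D.0#) fs → AllPairs (λ f g → ¬ _~_ 𝔽 f g) fs →
        AllPairs (λ f g → ¬ f ∥ g) fs
      nonassociated []       []           []         = []
      nonassociated (f ∷ fs) (f≉0 ∷ fs≉0) (n ∷ ns) =
        All.map (λ {g} f≁g f∥g → f≁g (∥⇒~ f g f≉0 f∥g)) n ∷ nonassociated fs fs≉0 ns

    gradedPolynomials : GradedDomain (c ⊔ˡ ℓ) ℓ k
    gradedPolynomials = record
      { domain = polynomialDomain k
      ; irreduciblesPrime = polynomial-primes k
      ; _∣?_ = _∣?_ 𝔽
      ; Deg = Deg 𝔽
      ; deg = λ {f} → degree f
      ; deg-≉0 = λ {f} {d} → deg-nonzero f d
      ; deg-unique = λ {f} {d} {e} df de → lookup-injective d e λ i →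
          weightedDegree-unique (λ a → lookup a i) (coordinate-⊞ i) {f} {f} (D.≈-refl {f})
            (proj₂ df i) (proj₂ de i)
      ; deg-∥ = λ {f} {g} {d} f∥g df → deg-~ f g d (∥⇒~ f g (deg-nonzero f d df) f∥g) df
      ; deg-* = λ {f} {g} {d} {e} df dg →
          nonzero⁺ {k} {f D.* g} (*-nonzero {k} {f} {g} (deg-nonzero f d df) (deg-nonzero g e dg))
            , λ i →
          subst (PartialDegree 𝔽 i (f D.* g)) (≡.sym (coordinate-⊞ i d e))
            (weightedDegree-* (λ a → lookup a i) (coordinate-⊞ i) {f} {g} (proj₂ df i) (proj₂ dg i))
      ; 𝒩 = 𝒩 𝔽
      ; 𝒩-deg = λ {m} {f} → 𝒩-deg m f
      ; 𝒩-complete = λ {m} {f} → 𝒩-complete m f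
      ; 𝒩-distinct = 𝒩-distinct
      }
      where
      degree : ∀ f → f D.≉ D.0# → ∃ (Deg 𝔽 f)
      degree f f≉0 = tabulate (proj₁ ∘ at) , nonzero⁺ {k} {f} f≉0 , λ i →
        subst (PartialDegree 𝔽 i f) (≡.sym (Vec.lookup∘tabulate (proj₁ ∘ at) i)) (proj₂ (at i))
        where
        at : ∀ i → ∃ (PartialDegree 𝔽 i f)
        at i = weightedDegree (λ a → lookup a i) (coordinate-⊞ i) {f} f≉0

    open SquarefreeFactorizations (polynomialDomain k) (polynomial-primes k) (_∣?_ 𝔽)

    μ-value : ∀ h → MöbiusValue h (μ 𝔽 h)
    μ-value h with productOfDistinctIrreducibles? 𝔽 h
    ... | yes (ps , irr , distinct , h~Π) = inj₁ (ps , factorization irr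
            (nonassociated ps irr distinct) (~⇒∥ h (productᴾ 𝔽 ps) h~Π) , refl)
      where
      nonassociated : ∀ ps → All (Irreducible 𝔽) ps → AllPairs (λ p r → ¬ _~_ 𝔽 p r) ps → Distinct ps
      nonassociated []       []         []       = []
      nonassociated (p ∷ ps) (ip ∷ ips) (n ∷ ns) =
        All.map (λ {r} p≁r p∥r → p≁r (∥⇒~ p r (D.irreducible-≉0 {p} ip) p∥r)) n ∷ nonassociated ps
          ips ns
    ... | no none = inj₂ ((λ ps (factorization irr distinct h∥Π) →
            none (ps , irr , AllPairs.map (λ {p} {r} p∦r p~r → p∦r (~⇒∥ p r p~r)) distinct ,
              ~-sym (productᴾ 𝔽 ps) h (∥⇒~ (productᴾ 𝔽 ps) h (product-≉0 irr) (D.∥-sym h∥Π)))) ,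
                refl)

open import Data.Integer.Base using (∣_∣; +_; _-_)

theorem5p6 : ∀ {c ℓ : Level} {q : ℕ} (𝔽 : FiniteField c ℓ q) {k : ℕ} → 2 ≤ k →
    (t : Exponent k) →
    ∃ λ (C : ℕ) → ∀ (m n : Exponent k) → t ≼ m → t ≼ n →
    (∀ (i : Fin k) → 2 * lookup t i + 1 < lookup m i ⊔ lookup n i) →
    ∣ + P 𝔽 m n - mainTerm 𝔽 t m n ∣ ≤ C * q ^ errorExponent t m n
-- The factor `suc D` is the discrepancy allowed for one exceptional pair. In the other factor,
-- `2 ^ k` comes from the geometric series and the power of q from the constant 2tⱼ + 4, with tⱼ
-- bounded by the sum of t.
theorem5p6 {q = q} 𝔽 {k} _ t = suc D * (2 ^ k * q ^ (2 * Vec.sum t + 4)) , λ m n t≼m t≼n max> →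
  let K = 2 ^ k * q ^ (2 * Vec.sum t + 4) in
  ℕ.≤-trans (coprime-pairs-error (μ 𝔽) (μ-value 𝔽) (coprime? 𝔽) t m n t≼m t≼n)
    (ℕ.≤-trans (ℕ.*-monoʳ-≤ (suc D) (large-sum q (2≤q 𝔽) t m n max> (N 𝔽) (N≤ 𝔽)))
      (ℕ.≤-reflexive (≡.sym (ℕ.*-assoc (suc D) K (q ^ errorExponent t m n)))))
  where
  open Counting (gradedPolynomials 𝔽 {k})
  D : ℕ
  D = length (divisors t)
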